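{- Assume the following conjecture (BC) holds. (BC): for every positive integer $m$ and every non-zero polynomial $h\in\mathbb{Q}[x_3,x_5,\ldots,x_{2m+1}]$ that is homogeneous with respect to the grading $\deg(x_{2k+1})=2k+1$, there exist infinitely many primes $p$ such that $p$ does not divide the numerator of $h(B_{p-3},B_{p-5},\ldots,B_{p-2m-1})$, where $B_i$ denotes the $i$-th Bernoulli number. Let $f\in\Lambda$ be a symmetric function over $\mathbb{Q}$ and let $n$ be a positive integer. Then the congruence $$f\left(\frac{p}{1},\frac{p}{2},\ldots,\frac{p}{p-1}\right)\equiv 0 \mod p^n$$ holds for all sufficiently large primes $p$ if and only if $\overline{f}\in I^{[n]}$, where $\overline{f}$ is the reduction of $f$ modulo $\mathcal{I}_n$, and $I^{[n]}\subset\Lambda/\mathcal{I}_n$ is the ideal generated by the elements $$\beta_k^{[n]}:=e_k+\sum_{j\geq k}(-1)^{j+1}\binom{j}{k}e_j\in\Lambda/\mathcal{I}_n,\qquad k\geq 0.$$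
   Context: $\Lambda=\Lambda_{\mathbb{Q}}$ is the ring of symmetric functions over $\mathbb{Q}$: formal power series of bounded degree in countably many variables with rational coefficients, invariant under all permutations of the variables. $e_k$ is the $k$-th elementary symmetric function ($e_0=1$); $\Lambda$ is the free commutative $\mathbb{Q}$-algebra on $e_1,e_2,\ldots$. A symmetric function is evaluated at a finite list of rationals by setting the remaining variables to $0$. The grading by $H$-degree on $\Lambda$ is the multiplicative grading in which $e_k$ (for $k\geq 1$) is homogeneous of $H$-degree $k+1$ (constants have $H$-degree $0$). For $f=\sum_m f_m$ with $f_m$ homogeneous of $H$-degree $m$, put $v(f):=\inf\{m: f_m\neq 0\}\in\mathbb{Z}_{\geq 0}\cup\{\infty\}$, and define the ideal $\mathcal{I}_n:=\{f\in\Lambda: v(f)\geq n\}$. The sum defining $\beta_k^{[n]}$ is finite since $e_j\in\mathcal{I}_n$ for all sufficiently large $j$. For $f\in\Lambda$ and all sufficiently large primes $p$ the value $f(p/1,\ldots,p/(p-1))$ lies in the localization $\mathbb{Z}_{(p)}$, and congruences modulo $p^n$ are understood in $\mathbb{Z}_{(p)}$. The numerator of a rational number refers to its expression in lowest terms. -}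

module Defs where

open import Algebra.Bundles using (CommutativeRing)
open import Data.Bool using (if_then_else_)
open import Data.Fin using (Fin; toℕ)
import Data.Integer as ℤ
open import Data.List using (List; []; _∷_)
open import Data.List.Relation.Unary.All using (all?)
open import Data.Nat using (ℕ; zero; suc; _∸_; NonZero)
import Data.Nat as ℕ
open import Data.Nat.Combinatorics using (_C_)
open import Data.Nat.Divisibility using (_∣_)
import Data.Nat.ListAction as ListAction
open import Data.Nat.Primality using (Prime)
open import Data.Product using (Σ; ∃; ∃-syntax; _×_; _,_)
open import Data.Rational using (ℚ; 0ℚ; 1ℚ; _+_; _*_; _-_; -_; _/_; ↥_; ↧ₙ_)
import Data.Rational.Properties as ℚ
open import Data.Vec using (Vec; []; _∷_; _∷ʳ_; last; lookup; tabulate; toList)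
open import Function using (_∘_; _↔_; Inverse)
open import Relation.Binary.PropositionalEquality using (_≡_; _≢_)
open import Relation.Nullary using (¬_; does; _×-dec_)

open import Algebra.Properties.CommutativeMonoid.Sum ℚ.+-0-commutativeMonoid public
  using (sum; sum-syntax)
open import Algebra.Properties.Semiring.Exp
  (CommutativeRing.semiring ℚ.+-*-commutativeRing) public
  using (_^_)

fromℕ : ℕ → ℚ
fromℕ k = ℤ.+ k / 1

-- A monomial in x₀, x₁, x₂, … is given by a list of exponents, all later
-- exponents being zero.  Trailing zeros do not change the monomial.

Exponents : Set
Exponents = List ℕ

exponent : Exponents → ℕ → ℕ
exponent []      _       = 0
exponent (a ∷ _) zero    = a
exponent (_ ∷ α) (suc i) = exponent α i

degree : Exponents → ℕ
degree = ListAction.sum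

-- A series sends each monomial to its coefficient.

Series : Set
Series = Exponents → ℚ

infix 4 _≈_

_≈_ : Series → Series → Set
f ≈ g = ∀ α → f α ≡ g α

infixl 6 _⊕_ _⊖_
infixl 7 _⊛_

0ˢ : Series
0ˢ _ = 0ℚ

_⊕_ : Series → Series → Series
(f ⊕ g) α = f α + g α

_⊖_ : Series → Series → Series
(f ⊖ g) α = f α - g α

-- Cauchy product: the coefficient at α is the sum of f β * g γ over all
-- factorisations β + γ = α.

_⊛_ : Series → Series → Series
(f ⊛ g) []      = f [] * g []
(f ⊛ g) (a ∷ α) =
  ∑[ i < suc a ] ((f ∘ (toℕ i ∷_)) ⊛ (g ∘ ((a ∸ toℕ i) ∷_))) α

∑ˢ : (n : ℕ) → (Fin n → Series) → Series
∑ˢ n F α = ∑[ i < n ] F i α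

constant : ℚ → Series
constant c α = if does (degree α ℕ.≟ 0) then c else 0ℚ

elementary : ℕ → Series
elementary k α =
  if does (all? (ℕ._≤? 1) α ×-dec (degree α ℕ.≟ k)) then 1ℚ else 0ℚ

-- Substituting x_{σ i} for x_i takes the monomial α to the monomial β
-- with exponent β (σ i) ≡ exponent α i.  Taking σ to be the identity, the
-- condition also says that f does not see trailing zeros.

Symmetric : Series → Set
Symmetric f = ∀ (σ : ℕ ↔ ℕ) (α β : Exponents) →
  (∀ i → exponent β (Inverse.to σ i) ≡ exponent α i) → f α ≡ f β

record Λ : Set where
  field
    series     : Series
    bound      : ℕ
    bounded    : ∀ α → bound ℕ.< degree α → series α ≡ 0ℚ
    symmetric  : Symmetric series

monomial : ∀ {N} → Vec ℚ N → Vec ℕ N → ℚ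
monomial []       []      = 1ℚ
monomial (x ∷ xs) (a ∷ α) = x ^ a * monomial xs α

-- Sum over all exponent vectors with entries at most d.

∑-box : (N d : ℕ) → (Vec ℕ N → ℚ) → ℚ
∑-box zero    d F = F []
∑-box (suc N) d F = ∑[ i < suc d ] ∑-box N d (F ∘ (toℕ i ∷_))

-- Every monomial of degree at most d has exponents at most d, so this is
-- the value of the polynomial with coefficients c when c vanishes in
-- degrees above d.

evaluate : ∀ {N} → ℕ → (Vec ℕ N → ℚ) → Vec ℚ N → ℚ
evaluate {N} d c xs = ∑-box N d (λ α → c α * monomial xs α)

-- Setting the variables beyond the N-th to zero leaves exactly the
-- monomials whose exponent list can be given length N.

infix 30 _⟨_⟩

_⟨_⟩ : ∀ {N} → Λ → Vec ℚ N → ℚ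
f ⟨ xs ⟩ = evaluate (Λ.bound f) (Λ.series f ∘ toList) xs

-- The multiplicative ℚ-linear grading generated by e_k, k ≥ 1, in
-- H-degree k + 1.

data Homogeneous : ℕ → Series → Set where
  scalar : ∀ c → Homogeneous 0 (constant c)
  gen    : ∀ k → Homogeneous (suc k ℕ.+ 1) (elementary (suc k))
  zero   : ∀ {m} → Homogeneous m 0ˢ
  add    : ∀ {m f g} → Homogeneous m f → Homogeneous m g →
           Homogeneous m (f ⊕ g)
  mul    : ∀ {m n f g} → Homogeneous m f → Homogeneous n g →
           Homogeneous (m ℕ.+ n) (f ⊛ g)
  resp   : ∀ {m f g} → f ≈ g → Homogeneous m f → Homogeneous m g

record HDecomposition (f : Series) : Set where
  field
    component   : ℕ → Series
    homogeneous : ∀ m → Homogeneous m (component m)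
    top         : ℕ
    finite      : ∀ m → top ℕ.< m → component m ≈ 0ˢ
    decomposes  : f ≈ ∑ˢ (suc top) (component ∘ toℕ)

-- f ∈ 𝓘 n means v(f) ≥ n.  The decomposition of a symmetric function
-- exists and is unique because Λ is free on e₁, e₂, …, so it does not
-- matter which decomposition is used.

infix 4 _∈𝓘_

_∈𝓘_ : Series → ℕ → Set
f ∈𝓘 n = Σ (HDecomposition f) λ D →
  ∀ m → ¬ (HDecomposition.component D m ≈ 0ˢ) → n ℕ.≤ m

-- Elements of Λ / 𝓘 n are handled through representatives.  In the sum
-- j = k + i; the terms with i ≥ n are omitted, since then j ≥ n and
-- j ≥ 1, so that e_j has H-degree j + 1 > n and is zero in Λ / 𝓘 n.

β : (n k : ℕ) → Series
β n k = elementary k ⊕ ∑ˢ n λ i → let j = k ℕ.+ toℕ i in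
  constant ((- 1ℚ) ^ suc j * fromℕ (j C k)) ⊛ elementary j

-- The class of f is a finite Λ-linear combination of the classes of the
-- β n k.

infix 4 _∈I[_]

_∈I[_] : Λ → ℕ → Set
f ∈I[ n ] = ∃[ K ] Σ (Fin K → Λ) λ g →
  (Λ.series f ⊖ ∑ˢ K (λ k → Λ.series (g k) ⊛ β n (toℕ k))) ∈𝓘 n

_∈ℤ₍_₎ : ℚ → ℕ → Set
q ∈ℤ₍ p ₎ = ¬ (p ∣ ↧ₙ q)

infix 4 _≡0[mod_^_]

_≡0[mod_^_] : ℚ → ℕ → ℕ → Set
q ≡0[mod p ^ n ] = ∃[ r ] r ∈ℤ₍ p ₎ × q ≡ fromℕ p ^ n * r

ForAllLargePrimes : (ℕ → Set) → Set
ForAllLargePrimes P = ∃[ N ] ∀ p → N ℕ.< p → Prime p → P p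

ForInfinitelyManyPrimes : (ℕ → Set) → Set
ForInfinitelyManyPrimes P = ∀ N → ∃[ p ] N ℕ.< p × Prime p × P p

harmonicPoint : (p : ℕ) → Vec ℚ (p ∸ 1)
harmonicPoint p = tabulate λ i → ℤ.+ p / suc (toℕ i)

-- The recursion ∑_{k ≤ n} C(n+1,k) B_k = [n = 0], solved for B_n
-- (so B_1 = -1/2).
-- bernoulliTable n is (B_0, …, B_{n-1}).

bernoulliTable : (n : ℕ) → Vec ℚ n
bernoulliTable zero    = []
bernoulliTable (suc n) =
  B ∷ʳ (ℤ.1ℤ / suc n) * (δ - ∑[ k < n ] (fromℕ (suc n C toℕ k) * lookup B k))
  where
  B : Vec ℚ n
  B = bernoulliTable n

  δ : ℚ
  δ = if does (n ℕ.≟ 0) then 1ℚ else 0ℚ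

bernoulli : ℕ → ℚ
bernoulli n = last (bernoulliTable (suc n))

-- An element of ℚ[x₃, x₅, …, x_{2m+1}].  The variable with index
-- i : Fin m is x_{2i+3}.

record Polynomial (m : ℕ) : Set where
  field
    coeff   : Vec ℕ m → ℚ
    bound   : ℕ
    bounded : ∀ α → bound ℕ.< degree (toList α) → coeff α ≡ 0ℚ

index : ∀ {m} → Fin m → ℕ
index i = 2 ℕ.* toℕ i ℕ.+ 3

weight : ∀ {m} → Vec ℕ m → ℕ
weight {m} α = ListAction.sum (toList (tabulate {n = m} λ i → index i ℕ.* lookup α i))

NonZeroPolynomial : ∀ {m} → Polynomial m → Set
NonZeroPolynomial h = ¬ (∀ α → Polynomial.coeff h α ≡ 0ℚ)

WeightedHomogeneous : ∀ {m} → Polynomial m → Set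
WeightedHomogeneous h = ∃[ d ] ∀ α → Polynomial.coeff h α ≢ 0ℚ → weight α ≡ d

-- (B_{p-3}, B_{p-5}, …, B_{p-2m-1}).  The subtraction is truncated, which
-- affects only the finitely many p < 2m + 1.

bernoulliPoint : (m p : ℕ) → Vec ℚ m
bernoulliPoint m p = tabulate λ i → bernoulli (p ∸ index i)

BernoulliConjecture : Set
BernoulliConjecture = ∀ (m : ℕ) → .{{NonZero m}} → (h : Polynomial m) →
  NonZeroPolynomial h → WeightedHomogeneous h →
  ForInfinitelyManyPrimes λ p →
    let value = evaluate (Polynomial.bound h) (Polynomial.coeff h) (bernoulliPoint m p)
    in ¬ (p ∣ ℤ.∣ ↥ value ∣)

{-# OPTIONS --safe #-}

-- Let x_i = p/i.  The substitution i ↦ p - i sends x_i to x_i/(x_i - 1),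
-- which makes every β_k vanish at (x_1, …, x_{p-1}).  Moreover e_k(x) is
-- divisible by p^{k+1}, so elements of 𝓘_n vanish modulo p^n; this gives
-- one direction.
--
-- Conversely, for odd k the relation β_k expresses e_k through e_j with
-- j > k, so modulo I^{[n]} every f is a polynomial in e_2, e_4, ….  By
-- Newton's identities for 1, …, p - 1, Wilson's theorem and the congruence
-- ∑_{i<p} i^r ≡ p B_r mod p²,
--   -(k+1) e_k(x) ≡ p^{k+1} B_{p-1-k}  mod p^{k+2}   for even k ≥ 2.
-- Hence if the polynomial in the even e_k takes values divisible by p^n, its
-- lowest homogeneous part, if of H-degree below n, is a weighted homogeneous
-- polynomial whose value at the Bernoulli numbers is divisible by every
-- large p, and the conjecture forces it to be zero.

module Submission where

open import Defs
open import Algebra.Bundles using (CommutativeRing)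
open import Data.Bool using (true; false; if_then_else_; _∧_)
open import Data.Bool.Properties using (∧-zeroʳ)
open import Data.Empty using (⊥-elim)
open import Data.Fin using (Fin; toℕ)
import Data.Fin as Fin
import Data.Integer as ℤ
import Data.Integer.GCD as ℤ
import Data.Integer.Properties as ℤ
open import Data.List using (List; []; _∷_; _++_; map; length; replicate; foldr)
import Data.List.Properties as List
open import Data.List.Relation.Binary.Permutation.Propositional using (_↭_; ↭-sym; ↭-trans; ↭-refl; prep; swap)
import Data.List.Relation.Binary.Permutation.Propositional as Perm
import Data.List.Relation.Binary.Permutation.Propositional.Properties as Perm
open import Data.List.Relation.Unary.All using (All; []; _∷_; all?)
import Data.List.Relation.Unary.All as All
open import Data.Nat using (ℕ; zero; suc; _∸_; NonZero; z≤n; s≤s)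
import Data.Nat as ℕ
open import Data.Nat.Combinatorics using (_C_; nCk≡nC[n∸k]; nCk+nC[k+1]≡[n+1]C[k+1]; nCn≡1; nC1≡n; k>n⇒nCk≡0)
open import Data.Nat.Divisibility using (_∣_; divides)
import Data.Nat.Divisibility as ℕ
import Data.Nat.ListAction as ListAction
open import Data.Nat.Primality using (Prime; euclidsLemma; prime⇒nonZero; prime⇒nonTrivial; prime⇒irreducible)
import Data.Nat.Properties as ℕ
import Data.Nat.Solver as ℕSolver
open import Data.Product using (Σ; ∃-syntax; _×_; _,_; proj₁; proj₂)
open import Data.Rational using (ℚ; 0ℚ; 1ℚ; _+_; _*_; _-_; -_; _/_; ↥_; ↧_; ↧ₙ_)
import Data.Rational as ℚ
import Data.Rational.Properties as ℚ
import Data.Rational.Solver as ℚSolver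
import Data.Rational.Unnormalised as ℚᵘ
import Data.Rational.Unnormalised.Properties as ℚᵘ
open import Data.Sum using (_⊎_; inj₁; inj₂; [_,_]′)
open import Data.Vec using (Vec; []; _∷_; _∷ʳ_; lookup; tabulate; toList)
import Data.Vec as Vec
import Data.Vec.Properties as Vec
open import Function using (id; _∘_; _↔_; Inverse; mk↔ₛ′)
open import Function.Bundles using (_⇔_; mk⇔)
open import Function.Construct.Composition using (_↔-∘_)
open import Function.Construct.Identity using (↔-id)
open import Relation.Binary.PropositionalEquality
  using (_≡_; _≢_; refl; sym; trans; cong; cong₂; subst; subst₂; module ≡-Reasoning)
open import Relation.Nullary using (¬_; yes; no; does)
open import Relation.Nullary.Decidable using (decidable-stable; dec-true; dec-false; does-⇔)

open import Algebra.Properties.CommutativeMonoid.Sum ℚ.+-0-commutativeMonoid using (sum-cong-≗)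
open import Algebra.Properties.CommutativeSemiring.Exp
  (CommutativeRing.commutativeSemiring ℚ.+-*-commutativeRing) using (^-homo-*)

-- Finite sums of rationals

-- The relations `β` come from a generating function. If (1 - x) y = -x, then (1 - x)(1 + T y) = 1 -
-- (1 + T) x; taking the product over all variables and comparing coefficients of T^k turns (1 +
-- T)^j into the binomials C(j,k). The prefactor ∏ (1 - x_i) equals 1 at the harmonic point because
-- p is odd. For even k the Bernoulli number attached to e_k is B_{p-(k+1)}, and k + 1 is also the
-- H-degree of e_k. The grading of the conjecture is therefore the H-grading, and a lowest
-- homogeneous part is an admissible h. For odd k the index p - 1 - k is odd, so the leading term
-- carries no information; this is why the odd e_k have to be eliminated before the conjecture can
-- be applied. The same polynomial has to be read as a symmetric function, as a value at the
-- harmonic point and as a value at Bernoulli numbers. It is kept as a list of terms, and each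
-- reading is a linear functional on such lists; vanishing coefficients then make all readings
-- vanish together.

Σ< : ℕ → (ℕ → ℚ) → ℚ
Σ< n F = ∑[ i < n ] F (toℕ i)

Σ-cong< : ∀ n {F G : ℕ → ℚ} → (∀ i → i ℕ.< n → F i ≡ G i) → Σ< n F ≡ Σ< n G
Σ-cong< zero    F≡G = refl
Σ-cong< (suc n) F≡G = cong₂ _+_ (F≡G 0 (s≤s z≤n)) (Σ-cong< n λ i i<n → F≡G (suc i) (s≤s i<n))

Σ-cong : ∀ n {F G : ℕ → ℚ} → (∀ i → F i ≡ G i) → Σ< n F ≡ Σ< n G
Σ-cong n F≡G = Σ-cong< n λ i _ → F≡G i

Σ-zero : ∀ n {F : ℕ → ℚ} → (∀ i → i ℕ.< n → F i ≡ 0ℚ) → Σ< n F ≡ 0ℚ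
Σ-zero zero    F≡0 = refl
Σ-zero (suc n) F≡0 =
  trans (cong₂ _+_ (F≡0 0 (s≤s z≤n)) (Σ-zero n λ i i<n → F≡0 (suc i) (s≤s i<n))) (ℚ.+-identityˡ 0ℚ)

Σ-+ : ∀ n (F G : ℕ → ℚ) → Σ< n (λ i → F i + G i) ≡ Σ< n F + Σ< n G
Σ-+ zero    F G = refl
Σ-+ (suc n) F G = trans (cong ((F 0 + G 0) +_) (Σ-+ n (F ∘ suc) (G ∘ suc)))
  (solve 4 (λ a b c d → (a :+ b) :+ (c :+ d) := (a :+ c) :+ (b :+ d)) refl
    (F 0) (G 0) (Σ< n (F ∘ suc)) (Σ< n (G ∘ suc)))
  where open ℚSolver.+-*-Solver

Σ-*ˡ : ∀ n c (F : ℕ → ℚ) → Σ< n (λ i → c * F i) ≡ c * Σ< n F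
Σ-*ˡ zero    c F = sym (ℚ.*-zeroʳ c)
Σ-*ˡ (suc n) c F = trans (cong (c * F 0 +_) (Σ-*ˡ n c (F ∘ suc))) (sym (ℚ.*-distribˡ-+ c _ _))

Σ-neg : ∀ n (F : ℕ → ℚ) → Σ< n (λ i → - F i) ≡ - Σ< n F
Σ-neg zero    F = refl
Σ-neg (suc n) F = trans (cong (- F 0 +_) (Σ-neg n (F ∘ suc))) (sym (ℚ.neg-distrib-+ (F 0) _))

Σ-last : ∀ n (F : ℕ → ℚ) → Σ< (suc n) F ≡ Σ< n F + F n
Σ-last zero    F = ℚ.+-comm (F 0) 0ℚ
Σ-last (suc n) F = trans (cong (F 0 +_) (Σ-last n (F ∘ suc))) (sym (ℚ.+-assoc (F 0) _ _))

Σ-extend : ∀ n m {F : ℕ → ℚ} → (∀ i → n ℕ.≤ i → F i ≡ 0ℚ) → Σ< (n ℕ.+ m) F ≡ Σ< n F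
Σ-extend zero    m F≡0 = Σ-zero m λ i _ → F≡0 i z≤n
Σ-extend (suc n) m {F} F≡0 = cong (F 0 +_) (Σ-extend n m λ i n≤i → F≡0 (suc i) (s≤s n≤i))

Σ-extend-≤ : ∀ {n m} → n ℕ.≤ m → {F : ℕ → ℚ} → (∀ i → n ℕ.≤ i → F i ≡ 0ℚ) → Σ< m F ≡ Σ< n F
Σ-extend-≤ {n} {m} n≤m {F} F≡0 =
  trans (cong (λ k → Σ< k F) (sym (ℕ.m+[n∸m]≡n n≤m))) (Σ-extend n (m ∸ n) F≡0)

Σ-comm : ∀ n m (F : ℕ → ℕ → ℚ) → Σ< n (λ i → Σ< m (F i)) ≡ Σ< m (λ j → Σ< n (λ i → F i j))
Σ-comm zero    m F = sym (Σ-zero m λ _ _ → refl)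
Σ-comm (suc n) m F = trans (cong (Σ< m (F 0) +_) (Σ-comm n m (F ∘ suc)))
  (sym (Σ-+ m (F 0) λ j → Σ< n λ i → F (suc i) j))

-- Summands take both indices as arguments, which confines the truncated subtraction to this
-- definition; the laws below hold for arbitrary `F`.
antidiagonal : ℕ → (ℕ → ℕ → ℚ) → ℚ
antidiagonal a F = Σ< (suc a) λ i → F i (a ∸ i)

antidiagonal-cong : ∀ a {F G : ℕ → ℕ → ℚ} → (∀ i j → F i j ≡ G i j) →
  antidiagonal a F ≡ antidiagonal a G
antidiagonal-cong a F≡G = Σ-cong (suc a) λ i → F≡G i (a ∸ i)

antidiagonal-+ : ∀ a (F G : ℕ → ℕ → ℚ) →
  antidiagonal a (λ i j → F i j + G i j) ≡ antidiagonal a F + antidiagonal a G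
antidiagonal-+ a F G = Σ-+ (suc a) (λ i → F i (a ∸ i)) (λ i → G i (a ∸ i))

antidiagonal-last : ∀ a (F : ℕ → ℕ → ℚ) →
  antidiagonal (suc a) F ≡ antidiagonal a (λ i j → F i (suc j)) + F (suc a) 0
antidiagonal-last zero    F =
  solve 2 (λ x y → x :+ (y :+ con 0ℚ) := (x :+ con 0ℚ) :+ y) refl (F 0 1) (F 1 0)
  where open ℚSolver.+-*-Solver
antidiagonal-last (suc a) F =
  trans (cong (F 0 (suc (suc a)) +_) (antidiagonal-last a (F ∘ suc)))
    (sym (ℚ.+-assoc (F 0 (suc (suc a))) (antidiagonal a (λ i j → F (suc i) (suc j))) (F (suc (suc a)) 0)))

antidiagonal-flip : ∀ a (F : ℕ → ℕ → ℚ) → antidiagonal a F ≡ antidiagonal a (λ i j → F j i)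
antidiagonal-flip zero    F = refl
antidiagonal-flip (suc a) F = trans (antidiagonal-last a F)
  (trans (ℚ.+-comm (antidiagonal a (λ i j → F i (suc j))) (F (suc a) 0))
    (cong (F (suc a) 0 +_) (antidiagonal-flip a λ i j → F i (suc j))))

-- Both sides run over all i + k + l = a. Splitting off the terms with i = 0 leaves the same claim
-- for `F ∘ suc`.
antidiagonal-assoc : ∀ a (F : ℕ → ℕ → ℕ → ℚ) →
  antidiagonal a (λ j l → antidiagonal j (λ i k → F i k l)) ≡
  antidiagonal a (λ i m → antidiagonal m (λ k l → F i k l))
antidiagonal-assoc zero    F = refl
antidiagonal-assoc (suc a) F = begin
  (x + 0ℚ) + antidiagonal a (λ j l → F 0 (suc j) l + G j l)
    ≡⟨ cong₂ _+_ (ℚ.+-identityʳ x) (antidiagonal-+ a (λ j l → F 0 (suc j) l) G) ⟩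
  x + (y + antidiagonal a G)
    ≡⟨ cong (λ z → x + (y + z)) (antidiagonal-assoc a (F ∘ suc)) ⟩
  x + (y + z)
    ≡⟨ sym (ℚ.+-assoc x y z) ⟩
  (x + y) + z ∎
  where
  open ≡-Reasoning
  x = F 0 0 (suc a)
  y = antidiagonal a (λ j l → F 0 (suc j) l)
  z = antidiagonal a (λ i m → antidiagonal m (λ k l → F (suc i) k l))
  G : ℕ → ℕ → ℚ
  G j l = antidiagonal j (λ i k → F (suc i) k l)

antidiagonal-comm : ∀ a b (F : ℕ → ℕ → ℕ → ℕ → ℚ) →
  antidiagonal a (λ i j → antidiagonal b (λ k l → F i j k l)) ≡
  antidiagonal b (λ k l → antidiagonal a (λ i j → F i j k l))
antidiagonal-comm a b F = Σ-comm (suc a) (suc b) λ i k → F i (a ∸ i) k (b ∸ k)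

-- The ring of series

infix 8 ⊝_

⊝_ : Series → Series
(⊝ f) α = - f α

-- The coefficient of x₀^a, as a series in the remaining variables. The Cauchy product is a
-- convolution of slices, so its laws follow by recursion on the exponent list.
slice : ℕ → Series → Series
slice a f α = f (a ∷ α)

⊛-cong : ∀ {f f′ g g′} → f ≈ f′ → g ≈ g′ → f ⊛ g ≈ f′ ⊛ g′
⊛-cong f≈ g≈ []      = cong₂ _*_ (f≈ []) (g≈ [])
⊛-cong f≈ g≈ (a ∷ α) = antidiagonal-cong a λ i j →
  ⊛-cong (λ β → f≈ (i ∷ β)) (λ β → g≈ (j ∷ β)) α

⊛-comm : ∀ f g → f ⊛ g ≈ g ⊛ f
⊛-comm f g []      = ℚ.*-comm (f []) (g [])
⊛-comm f g (a ∷ α) = trans (antidiagonal-cong a λ i j → ⊛-comm (slice i f) (slice j g) α)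
  (antidiagonal-flip a λ i j → (slice j g ⊛ slice i f) α)

⊛-zeroˡ : ∀ {f} → f ≈ 0ˢ → ∀ g → f ⊛ g ≈ 0ˢ
⊛-zeroˡ f≈0 g []      = trans (cong (_* g []) (f≈0 [])) (ℚ.*-zeroˡ (g []))
⊛-zeroˡ f≈0 g (a ∷ α) = Σ-zero (suc a) λ i _ → ⊛-zeroˡ (λ β → f≈0 (i ∷ β)) (slice (a ∸ i) g) α

⊛-distribʳ-⊕ : ∀ h f g → (f ⊕ g) ⊛ h ≈ f ⊛ h ⊕ g ⊛ h
⊛-distribʳ-⊕ h f g []      = ℚ.*-distribʳ-+ (h []) (f []) (g [])
⊛-distribʳ-⊕ h f g (a ∷ α) =
  trans (antidiagonal-cong a λ i j → ⊛-distribʳ-⊕ (slice j h) (slice i f) (slice i g) α)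
        (antidiagonal-+ a (λ i j → (slice i f ⊛ slice j h) α) (λ i j → (slice i g ⊛ slice j h) α))

⊛-distribˡ-⊕ : ∀ h f g → h ⊛ (f ⊕ g) ≈ h ⊛ f ⊕ h ⊛ g
⊛-distribˡ-⊕ h f g α = trans (⊛-comm h (f ⊕ g) α)
  (trans (⊛-distribʳ-⊕ h f g α) (cong₂ _+_ (⊛-comm f h α) (⊛-comm g h α)))

⊛-Σˡ : ∀ n (F : ℕ → Series) h → (λ α → Σ< n (λ i → F i α)) ⊛ h ≈ (λ α → Σ< n (λ i → (F i ⊛ h) α))
⊛-Σˡ zero    F h α = ⊛-zeroˡ (λ _ → refl) h α
⊛-Σˡ (suc n) F h α = trans (⊛-distribʳ-⊕ h (F 0) (λ γ → Σ< n (λ i → F (suc i) γ)) α)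
  (cong ((F 0 ⊛ h) α +_) (⊛-Σˡ n (F ∘ suc) h α))

⊛-Σʳ : ∀ n (F : ℕ → Series) h → h ⊛ (λ α → Σ< n (λ i → F i α)) ≈ (λ α → Σ< n (λ i → (h ⊛ F i) α))
⊛-Σʳ n F h α = trans (⊛-comm h (λ γ → Σ< n (λ i → F i γ)) α)
  (trans (⊛-Σˡ n F h α) (Σ-cong n λ i → ⊛-comm (F i) h α))

⊛-assoc : ∀ f g h → (f ⊛ g) ⊛ h ≈ f ⊛ (g ⊛ h)
⊛-assoc f g h []      = ℚ.*-assoc (f []) (g []) (h [])
⊛-assoc f g h (a ∷ α) = begin
  antidiagonal a (λ j l → (slice j (f ⊛ g) ⊛ slice l h) α)
    ≡⟨ antidiagonal-cong a (λ j l → ⊛-Σˡ (suc j) (λ i → slice i f ⊛ slice (j ∸ i) g) (slice l h) α) ⟩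
  antidiagonal a (λ j l → antidiagonal j (λ i k → ((slice i f ⊛ slice k g) ⊛ slice l h) α))
    ≡⟨ antidiagonal-assoc a (λ i k l → ((slice i f ⊛ slice k g) ⊛ slice l h) α) ⟩
  antidiagonal a (λ i m → antidiagonal m (λ k l → ((slice i f ⊛ slice k g) ⊛ slice l h) α))
    ≡⟨ antidiagonal-cong a (λ i m → trans
         (antidiagonal-cong m λ k l → ⊛-assoc (slice i f) (slice k g) (slice l h) α)
         (sym (⊛-Σʳ (suc m) (λ k → slice k g ⊛ slice (m ∸ k) h) (slice i f) α))) ⟩
  antidiagonal a (λ i m → (slice i f ⊛ slice m (g ⊛ h)) α) ∎
  where open ≡-Reasoning

constant-⊛ : ∀ c f α → (constant c ⊛ f) α ≡ c * f α
constant-⊛ c f []      = refl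
constant-⊛ c f (a ∷ α) = trans
  (cong₂ _+_ (constant-⊛ c (slice a f) α)
    (Σ-zero a λ i _ → ⊛-zeroˡ (λ _ → refl) (slice (a ∸ suc i) f) α))
  (ℚ.+-identityʳ _)

seriesRing : CommutativeRing _ _
seriesRing = record
  { Carrier = Series ; _≈_ = _≈_ ; _+_ = _⊕_ ; _*_ = _⊛_ ; -_ = ⊝_ ; 0# = 0ˢ ; 1# = constant 1ℚ
  ; isCommutativeRing = record
    { isRing = record
      { +-isAbelianGroup = record
        { isGroup = record
          { isMonoid = record
            { isSemigroup = record
              { isMagma = record
                { isEquivalence = record
                  { refl  = λ _ → refl
                  ; sym   = λ f≈g α → sym (f≈g α)
                  ; trans = λ f≈g g≈h α → trans (f≈g α) (g≈h α) }
                ; ∙-cong = λ f≈ g≈ α → cong₂ _+_ (f≈ α) (g≈ α) }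
              ; assoc = λ f g h α → ℚ.+-assoc (f α) (g α) (h α) }
            ; identity = (λ f α → ℚ.+-identityˡ (f α)) , (λ f α → ℚ.+-identityʳ (f α)) }
          ; inverse = (λ f α → ℚ.+-inverseˡ (f α)) , (λ f α → ℚ.+-inverseʳ (f α))
          ; ⁻¹-cong = λ f≈ α → cong -_ (f≈ α) }
        ; comm = λ f g α → ℚ.+-comm (f α) (g α) }
      ; *-cong = ⊛-cong
      ; *-assoc = ⊛-assoc
      ; *-identity = ⊛-identityˡ , λ f α → trans (⊛-comm f (constant 1ℚ) α) (⊛-identityˡ f α)
      ; distrib = ⊛-distribˡ-⊕ , ⊛-distribʳ-⊕ }
    ; *-comm = ⊛-comm } }
  where
  ⊛-identityˡ : ∀ f → constant 1ℚ ⊛ f ≈ f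
  ⊛-identityˡ f α = trans (constant-⊛ 1ℚ f α) (ℚ.*-identityˡ (f α))

module S = CommutativeRing seriesRing

-- Symmetric series

-- `Symmetric` quantifies over all bijections of ℕ, which gives nothing to recurse on. Permutations
-- of a finite exponent list and padding by a zero generate the same invariance and can be checked
-- by induction.
record Sym (f : Series) : Set where
  field
    perm : ∀ {α γ} → α ↭ γ → f α ≡ f γ
    pad  : ∀ α → f (0 ∷ α) ≡ f α

PermInvariant : Series → Set
PermInvariant f = ∀ {α γ} → α ↭ γ → f α ≡ f γ

slice-perm : ∀ {f} a → PermInvariant f → PermInvariant (slice a f)
slice-perm a inv α↭γ = inv (prep a α↭γ)

⊛-perm : ∀ {f g} → PermInvariant f → PermInvariant g → PermInvariant (f ⊛ g)
⊛-perm invᶠ invᵍ Perm.refl = refl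
⊛-perm invᶠ invᵍ (prep a α↭γ) = antidiagonal-cong a λ i j →
  ⊛-perm (slice-perm i invᶠ) (slice-perm j invᵍ) α↭γ
-- Transposing the two leading exponents interchanges the two outer convolutions, provided that the
-- same transposition is undone inside each factor.
⊛-perm {f} {g} invᶠ invᵍ (swap {xs = α} {ys = γ} a b α↭γ) = trans
  (antidiagonal-cong a λ i j → antidiagonal-cong b λ k l → trans
    (⊛-perm (slice-perm k (slice-perm i invᶠ)) (slice-perm l (slice-perm j invᵍ)) α↭γ)
    (⊛-cong (λ δ → invᶠ (swap i k ↭-refl)) (λ δ → invᵍ (swap j l ↭-refl)) γ))
  (antidiagonal-comm a b λ i j k l → (slice i (slice k f) ⊛ slice j (slice l g)) γ)
⊛-perm invᶠ invᵍ (Perm.trans α↭γ γ↭δ) = trans (⊛-perm invᶠ invᵍ α↭γ) (⊛-perm invᶠ invᵍ γ↭δ)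

⊛-sym : ∀ {f g} → Sym f → Sym g → Sym (f ⊛ g)
⊛-sym {f} {g} symᶠ symᵍ = record
  { perm = ⊛-perm (Sym.perm symᶠ) (Sym.perm symᵍ)
  ; pad  = λ α → trans (ℚ.+-identityʳ ((slice 0 f ⊛ slice 0 g) α)) (⊛-cong (Sym.pad symᶠ) (Sym.pad symᵍ) α) }

⊕-sym : ∀ {f g} → Sym f → Sym g → Sym (f ⊕ g)
⊕-sym symᶠ symᵍ = record
  { perm = λ α↭γ → cong₂ _+_ (Sym.perm symᶠ α↭γ) (Sym.perm symᵍ α↭γ)
  ; pad  = λ α → cong₂ _+_ (Sym.pad symᶠ α) (Sym.pad symᵍ α) }

degree-↭ : ∀ {α γ} → α ↭ γ → degree α ≡ degree γ
degree-↭ Perm.refl = refl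
degree-↭ (prep a α↭γ) = cong (a ℕ.+_) (degree-↭ α↭γ)
degree-↭ (swap {xs = α} {ys = γ} a b α↭γ) = begin
  a ℕ.+ (b ℕ.+ degree α) ≡⟨ cong (λ d → a ℕ.+ (b ℕ.+ d)) (degree-↭ α↭γ) ⟩
  a ℕ.+ (b ℕ.+ degree γ) ≡⟨ sym (ℕ.+-assoc a b (degree γ)) ⟩
  (a ℕ.+ b) ℕ.+ degree γ ≡⟨ cong (ℕ._+ degree γ) (ℕ.+-comm a b) ⟩
  (b ℕ.+ a) ℕ.+ degree γ ≡⟨ ℕ.+-assoc b a (degree γ) ⟩
  b ℕ.+ (a ℕ.+ degree γ) ∎
  where open ≡-Reasoning
degree-↭ (Perm.trans p q) = trans (degree-↭ p) (degree-↭ q)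

constant-sym : ∀ c → Sym (constant c)
constant-sym c = record
  { perm = λ α↭γ → cong (λ d → if does (d ℕ.≟ 0) then c else 0ℚ) (degree-↭ α↭γ)
  ; pad  = λ _ → refl }

elementary-step : ∀ k α → slice 1 (elementary (suc k)) α ≡ elementary k α
elementary-step k α with all? (ℕ._≤? 1) α
... | yes _ = refl
... | no _ = refl

elementary-two : ∀ k a α → slice (suc (suc a)) (elementary k) α ≡ 0ℚ
elementary-two k a α = refl

elementary-pad : ∀ k α → slice 0 (elementary k) α ≡ elementary k α
elementary-pad k α with all? (ℕ._≤? 1) α
... | yes _ = refl
... | no _ = refl

elementary-one-zero : ∀ α → slice 1 (elementary 0) α ≡ 0ℚ
elementary-one-zero α with all? (ℕ._≤? 1) α
... | yes _ = refl
... | no _ = refl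

elementary-sym : ∀ k → Sym (elementary k)
elementary-sym k = record
  { perm = λ α↭γ → cong (λ b → if b then 1ℚ else 0ℚ) (cong₂ _∧_
      (does-⇔ (mk⇔ (Perm.All-resp-↭ α↭γ) (Perm.All-resp-↭ (↭-sym α↭γ))) (all? (ℕ._≤? 1) _) (all? (ℕ._≤? 1) _))
      (cong (λ d → does (d ℕ.≟ k)) (degree-↭ α↭γ)))
  ; pad  = elementary-pad k }

exponent-++0 : ∀ α i → exponent (α ++ 0 ∷ []) i ≡ exponent α i
exponent-++0 []      zero    = refl
exponent-++0 []      (suc i) = refl
exponent-++0 (a ∷ α) zero    = refl
exponent-++0 (a ∷ α) (suc i) = exponent-++0 α i

lift-↔ : ℕ ↔ ℕ → ℕ ↔ ℕ
lift-↔ σ = mk↔ₛ′ to from to∘from from∘to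
  where
  to from : ℕ → ℕ
  to zero    = zero
  to (suc i) = suc (Inverse.to σ i)
  from zero    = zero
  from (suc i) = suc (Inverse.from σ i)
  to∘from : ∀ i → to (from i) ≡ i
  to∘from zero    = refl
  to∘from (suc i) = cong suc (Inverse.strictlyInverseˡ σ i)
  from∘to : ∀ i → from (to i) ≡ i
  from∘to zero    = refl
  from∘to (suc i) = cong suc (Inverse.strictlyInverseʳ σ i)

swap-↔ : ℕ ↔ ℕ
swap-↔ = mk↔ₛ′ to to to∘to to∘to
  where
  to : ℕ → ℕ
  to zero          = 1
  to (suc zero)    = 0
  to (suc (suc i)) = suc (suc i)
  to∘to : ∀ i → to (to i) ≡ i
  to∘to zero          = refl
  to∘to (suc zero)    = refl
  to∘to (suc (suc i)) = refl

↭⇒↔ : ∀ {α γ} → α ↭ γ → Σ (ℕ ↔ ℕ) λ σ → ∀ i → exponent γ (Inverse.to σ i) ≡ exponent α i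
↭⇒↔ Perm.refl = ↔-id ℕ , λ _ → refl
↭⇒↔ (prep {xs = α} {ys = γ} a α↭γ) with σ , h ← ↭⇒↔ α↭γ = lift-↔ σ , λ where
  zero    → refl
  (suc i) → h i
↭⇒↔ (swap a b α↭γ) with σ , h ← ↭⇒↔ α↭γ = swap-↔ ↔-∘ lift-↔ (lift-↔ σ) , λ where
  zero          → refl
  (suc zero)    → refl
  (suc (suc i)) → h i
↭⇒↔ (Perm.trans p q) with σ , h ← ↭⇒↔ p | τ , h′ ← ↭⇒↔ q =
  τ ↔-∘ σ , λ i → trans (h′ (Inverse.to σ i)) (h i)

symmetric⇒sym : ∀ {f} → Symmetric f → Sym f
-- A leading zero is moved to the end by a permutation; as a trailing zero it is discarded by the
-- identity bijection.
symmetric⇒sym {f} symᶠ = record { perm = perm ; pad = λ α → trans (perm (Perm.∷↭∷ʳ 0 α))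
    (sym (symᶠ (↔-id ℕ) α (α ++ 0 ∷ []) (exponent-++0 α))) }
  where
  perm : PermInvariant f
  perm {α} {γ} α↭γ with σ , h ← ↭⇒↔ α↭γ = symᶠ σ α γ h

delete : ℕ → Exponents → Exponents
delete j       []      = []
delete zero    (a ∷ α) = α
delete (suc j) (a ∷ α) = a ∷ delete j α

punchIn punchOut : ℕ → ℕ → ℕ
punchIn  zero    i       = suc i
punchIn  (suc j) zero    = zero
punchIn  (suc j) (suc i) = suc (punchIn j i)
punchOut zero    i       = ℕ.pred i
punchOut (suc j) zero    = zero
punchOut (suc j) (suc i) = suc (punchOut j i)

punchIn≢ : ∀ j i → punchIn j i ≢ j
punchIn≢ zero    i       ()
punchIn≢ (suc j) zero    ()
punchIn≢ (suc j) (suc i) eq = punchIn≢ j i (ℕ.suc-injective eq)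

punchOut-punchIn : ∀ j i → punchOut j (punchIn j i) ≡ i
punchOut-punchIn zero    i       = refl
punchOut-punchIn (suc j) zero    = refl
punchOut-punchIn (suc j) (suc i) = cong suc (punchOut-punchIn j i)

punchIn-punchOut : ∀ j i → i ≢ j → punchIn j (punchOut j i) ≡ i
punchIn-punchOut zero    zero    i≢j = ⊥-elim (i≢j refl)
punchIn-punchOut zero    (suc i) i≢j = refl
punchIn-punchOut (suc j) zero    i≢j = refl
punchIn-punchOut (suc j) (suc i) i≢j = cong suc (punchIn-punchOut j i (i≢j ∘ cong suc))

exponent-delete : ∀ j α i → exponent (delete j α) i ≡ exponent α (punchIn j i)
exponent-delete zero    []      i       = refl
exponent-delete zero    (a ∷ α) i       = refl
exponent-delete (suc j) []      i       = refl
exponent-delete (suc j) (a ∷ α) zero    = refl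
exponent-delete (suc j) (a ∷ α) (suc i) = exponent-delete j α i

slice-sym : ∀ {f} a → Sym f → Sym (slice a f)
slice-sym a symᶠ = record
  { perm = slice-perm a (Sym.perm symᶠ)
  ; pad  = λ α → trans (Sym.perm symᶠ (swap a 0 ↭-refl)) (Sym.pad symᶠ (a ∷ α)) }

delete-sym : ∀ {f} → Sym f → ∀ j α → f α ≡ f (exponent α j ∷ delete j α)
delete-sym symᶠ j       []      = sym (Sym.pad symᶠ [])
delete-sym symᶠ zero    (a ∷ α) = refl
delete-sym {f} symᶠ (suc j) (a ∷ α) =
  trans (delete-sym {slice a f} (slice-sym a symᶠ) j α) (Sym.perm symᶠ (swap _ _ ↭-refl))

sym-zeros : ∀ {f} → Sym f → ∀ α → (∀ i → exponent α i ≡ 0) → f [] ≡ f α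
sym-zeros symᶠ []      α≡0 = refl
sym-zeros symᶠ (a ∷ α) α≡0 with refl ← α≡0 0 =
  trans (sym-zeros symᶠ α (α≡0 ∘ suc)) (sym (Sym.pad symᶠ α))

-- Induction on `α`: its head is matched with the exponent of `γ` at position `to 0`, which symmetry
-- brings to the front. Removing both leaves `slice a f` and the bijection renumbered around the
-- deleted position.
sym-bijection : ∀ {f} → Sym f → ∀ α γ (to from : ℕ → ℕ) →
  (∀ i → to (from i) ≡ i) → (∀ i → from (to i) ≡ i) →
  (∀ i → exponent γ (to i) ≡ exponent α i) → f α ≡ f γ
sym-bijection symᶠ [] γ to from to∘from from∘to h = sym-zeros symᶠ γ λ i →
  trans (cong (exponent γ) (sym (to∘from i))) (h (from i))
sym-bijection {f} symᶠ (a ∷ α) γ to from to∘from from∘to h = begin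
  f (a ∷ α)                     ≡⟨ sym-bijection (slice-sym a symᶠ) α (delete j γ) to′ from′ to∘from′ from∘to′ h′ ⟩
  f (a ∷ delete j γ)            ≡⟨ cong (λ b → f (b ∷ delete j γ)) (sym (h 0)) ⟩
  f (exponent γ j ∷ delete j γ) ≡⟨ sym (delete-sym symᶠ j γ) ⟩
  f γ                           ∎
  where
  open ≡-Reasoning
  j = to 0
  to′ from′ : ℕ → ℕ
  to′ i = punchOut j (to (suc i))
  from′ i = ℕ.pred (from (punchIn j i))

  to-suc≢ : ∀ i → to (suc i) ≢ j
  to-suc≢ i eq with () ← trans (sym (from∘to (suc i))) (trans (cong from eq) (from∘to 0))

  suc-pred-from : ∀ i → suc (from′ i) ≡ from (punchIn j i)
  suc-pred-from i with from (punchIn j i) | to∘from (punchIn j i)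
  ... | zero  | eq = ⊥-elim (punchIn≢ j i (sym eq))
  ... | suc _ | _  = refl

  to∘from′ : ∀ i → to′ (from′ i) ≡ i
  to∘from′ i = trans (cong (punchOut j ∘ to) (suc-pred-from i))
    (trans (cong (punchOut j) (to∘from (punchIn j i))) (punchOut-punchIn j i))

  from∘to′ : ∀ i → from′ (to′ i) ≡ i
  from∘to′ i = cong ℕ.pred
    (trans (cong from (punchIn-punchOut j (to (suc i)) (to-suc≢ i))) (from∘to (suc i)))

  h′ : ∀ i → exponent (delete j γ) (to′ i) ≡ exponent α i
  h′ i = trans (exponent-delete j γ (to′ i))
    (trans (cong (exponent γ) (punchIn-punchOut j (to (suc i)) (to-suc≢ i))) (h (suc i)))

sym⇒symmetric : ∀ {f} → Sym f → Symmetric f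
sym⇒symmetric symᶠ σ α γ = sym-bijection symᶠ α γ (Inverse.to σ) (Inverse.from σ)
  (Inverse.strictlyInverseˡ σ) (Inverse.strictlyInverseʳ σ)

-- Evaluation of series of bounded degree

Bounded : ℕ → Series → Set
Bounded d f = ∀ α → d ℕ.< degree α → f α ≡ 0ℚ

-- Only pairs with degree γ + degree δ = degree α contribute to the coefficient at α. The condition
-- on degrees is an arbitrary predicate because the recursion shifts it by the exponent already
-- consumed.
⊛-vanish : ∀ {f g} (P : ℕ → Set) →
  (∀ γ δ → P (degree γ ℕ.+ degree δ) → f γ * g δ ≡ 0ℚ) → ∀ α → P (degree α) → (f ⊛ g) α ≡ 0ℚ
⊛-vanish P fg≡0 []      Pα = fg≡0 [] [] Pα
⊛-vanish {f} {g} P fg≡0 (a ∷ α) Pα = Σ-zero (suc a) λ i i<1+a →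
  ⊛-vanish {slice i f} {slice (a ∸ i) g} (λ d → P (a ℕ.+ d))
    (λ γ δ → fg≡0 (i ∷ γ) ((a ∸ i) ∷ δ) ∘ subst P (regroup i (degree γ) (degree δ) (ℕ.≤-pred i<1+a)))
    α Pα
  where
  regroup : ∀ i c d → i ℕ.≤ a → a ℕ.+ (c ℕ.+ d) ≡ (i ℕ.+ c) ℕ.+ ((a ∸ i) ℕ.+ d)
  regroup i c d i≤a = begin
    a ℕ.+ (c ℕ.+ d)               ≡⟨ cong (ℕ._+ (c ℕ.+ d)) (sym (ℕ.m+[n∸m]≡n i≤a)) ⟩
    (i ℕ.+ (a ∸ i)) ℕ.+ (c ℕ.+ d) ≡⟨ solve 4 (λ i j c d → (i :+ j) :+ (c :+ d) := (i :+ c) :+ (j :+ d)) refl i (a ∸ i) c d ⟩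
    (i ℕ.+ c) ℕ.+ ((a ∸ i) ℕ.+ d) ∎
    where
    open ≡-Reasoning
    open ℕSolver.+-*-Solver using (solve; _:=_; _:+_)

⊛-bounded : ∀ {f g d e} → Bounded d f → Bounded e g → Bounded (d ℕ.+ e) (f ⊛ g)
⊛-bounded {f} {g} {d} {e} f≡0 g≡0 = ⊛-vanish (d ℕ.+ e ℕ.<_) vanish
  where
  vanish : ∀ γ δ → d ℕ.+ e ℕ.< degree γ ℕ.+ degree δ → f γ * g δ ≡ 0ℚ
  vanish γ δ big with d ℕ.<? degree γ
  ... | yes d<γ = trans (cong (_* g δ) (f≡0 γ d<γ)) (ℚ.*-zeroˡ (g δ))
  ... | no  d≮γ = trans (cong (f γ *_) (g≡0 δ e<δ)) (ℚ.*-zeroʳ (f γ))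
    where
    e<δ : e ℕ.< degree δ
    e<δ = ℕ.+-cancelˡ-< d e (degree δ) (ℕ.<-≤-trans big (ℕ.+-monoˡ-≤ (degree δ) (ℕ.≮⇒≥ d≮γ)))

⊕-bounded : ∀ {f g d} → Bounded d f → Bounded d g → Bounded d (f ⊕ g)
⊕-bounded f≡0 g≡0 α d<α = trans (cong₂ _+_ (f≡0 α d<α) (g≡0 α d<α)) (ℚ.+-identityˡ 0ℚ)

bounded-≤ : ∀ {f d e} → d ℕ.≤ e → Bounded d f → Bounded e f
bounded-≤ d≤e f≡0 α e<α = f≡0 α (ℕ.≤-<-trans d≤e e<α)

bounded-slice : ∀ {f d} i → Bounded d f → Bounded d (slice i f)
bounded-slice i f≡0 α d<α = f≡0 (i ∷ α) (ℕ.<-≤-trans d<α (ℕ.m≤n+m (degree α) i))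

slice-beyond : ∀ {f d} i → d ℕ.< i → Bounded d f → slice i f ≈ 0ˢ
slice-beyond i d<i f≡0 α = f≡0 (i ∷ α) (ℕ.<-≤-trans d<i (ℕ.m≤m+n i (degree α)))

constant-bounded : ∀ c → Bounded 0 (constant c)
constant-bounded c α 0<α with degree α
constant-bounded c α (s≤s z≤n) | suc _ = refl

elementary-bounded : ∀ k → Bounded k (elementary k)
elementary-bounded k α k<α = trans
  (cong (λ b → if does (all? (ℕ._≤? 1) α) ∧ b then 1ℚ else 0ℚ)
    (dec-false (degree α ℕ.≟ k) (ℕ.>⇒≢ k<α)))
  (cong (λ b → if b then 1ℚ else 0ℚ) (∧-zeroʳ (does (all? (ℕ._≤? 1) α))))

∑-box-cong : ∀ N d {F G : Vec ℕ N → ℚ} → (∀ α → F α ≡ G α) → ∑-box N d F ≡ ∑-box N d G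
∑-box-cong zero    d F≡G = F≡G []
∑-box-cong (suc N) d F≡G = Σ-cong (suc d) λ i → ∑-box-cong N d λ α → F≡G (i ∷ α)

∑-box-+ : ∀ N d (F G : Vec ℕ N → ℚ) → ∑-box N d (λ α → F α + G α) ≡ ∑-box N d F + ∑-box N d G
∑-box-+ zero    d F G = refl
∑-box-+ (suc N) d F G = trans (Σ-cong (suc d) λ i → ∑-box-+ N d (F ∘ (i ∷_)) (G ∘ (i ∷_)))
  (Σ-+ (suc d) (λ i → ∑-box N d (F ∘ (i ∷_))) (λ i → ∑-box N d (G ∘ (i ∷_))))

∑-box-* : ∀ N d c (F : Vec ℕ N → ℚ) → ∑-box N d (λ α → c * F α) ≡ c * ∑-box N d F
∑-box-* zero    d c F = refl
∑-box-* (suc N) d c F = trans (Σ-cong (suc d) λ i → ∑-box-* N d c (F ∘ (i ∷_)))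
  (Σ-*ˡ (suc d) c (λ i → ∑-box N d (F ∘ (i ∷_))))

∑-box-zero : ∀ N d {F : Vec ℕ N → ℚ} → (∀ α → F α ≡ 0ℚ) → ∑-box N d F ≡ 0ℚ
∑-box-zero zero    d F≡0 = F≡0 []
∑-box-zero (suc N) d F≡0 = Σ-zero (suc d) λ i _ → ∑-box-zero N d λ α → F≡0 (i ∷ α)

eval : ∀ {N} → ℕ → Series → Vec ℚ N → ℚ
eval d f = evaluate d (f ∘ toList)

-- Grouping by the power of the leading variable makes evaluation recursive in the number of
-- variables, with the slices as coefficients.
eval-∷ : ∀ {N} d f x (xs : Vec ℚ N) →
  eval d f (x ∷ xs) ≡ Σ< (suc d) (λ i → x ^ i * eval d (slice i f) xs)
eval-∷ {N} d f x xs = Σ-cong (suc d) λ i → trans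
  (∑-box-cong N d λ α →
    solve 3 (λ a b c → a :* (b :* c) := b :* (a :* c)) refl (f (i ∷ toList α)) (x ^ i) (monomial xs α))
  (∑-box-* N d (x ^ i) (λ α → f (i ∷ toList α) * monomial xs α))
  where open ℚSolver.+-*-Solver

eval-cong : ∀ {N} d {f g} (xs : Vec ℚ N) → f ≈ g → eval d f xs ≡ eval d g xs
eval-cong {N} d xs f≈g = ∑-box-cong N d λ α → cong (_* monomial xs α) (f≈g (toList α))

eval-zero : ∀ {N} d {f} (xs : Vec ℚ N) → f ≈ 0ˢ → eval d f xs ≡ 0ℚ
eval-zero {N} d xs f≈0 = ∑-box-zero N d λ α →
  trans (cong (_* monomial xs α) (f≈0 (toList α))) (ℚ.*-zeroˡ (monomial xs α))

eval-⊕ : ∀ {N} d f g (xs : Vec ℚ N) → eval d (f ⊕ g) xs ≡ eval d f xs + eval d g xs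
eval-⊕ {N} d f g xs = trans
  (∑-box-cong N d λ α → ℚ.*-distribʳ-+ (monomial xs α) (f (toList α)) (g (toList α)))
  (∑-box-+ N d (λ α → f (toList α) * monomial xs α) (λ α → g (toList α) * monomial xs α))

eval-Σ : ∀ {N} d n (F : ℕ → Series) (xs : Vec ℚ N) →
  eval d (λ α → Σ< n (λ i → F i α)) xs ≡ Σ< n (λ i → eval d (F i) xs)
eval-Σ {N} d zero    F xs = eval-zero {N} d xs λ _ → refl
eval-Σ {N} d (suc n) F xs = trans (eval-⊕ {N} d (F 0) (λ α → Σ< n (λ i → F (suc i) α)) xs)
  (cong (eval d (F 0) xs +_) (eval-Σ {N} d n (F ∘ suc) xs))

eval-extend : ∀ {N d e f} → d ℕ.≤ e → Bounded d f → (xs : Vec ℚ N) → eval e f xs ≡ eval d f xs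
eval-extend d≤e f≡0 [] = refl
eval-extend {d = d} {e} {f} d≤e f≡0 (x ∷ xs) = begin
  eval e f (x ∷ xs)                                  ≡⟨ eval-∷ e f x xs ⟩
  Σ< (suc e) (λ i → x ^ i * eval e (slice i f) xs)   ≡⟨ Σ-extend-≤ (s≤s d≤e) beyond ⟩
  Σ< (suc d) (λ i → x ^ i * eval e (slice i f) xs)   ≡⟨ Σ-cong (suc d) (λ i → cong (x ^ i *_) (eval-extend d≤e (bounded-slice i f≡0) xs)) ⟩
  Σ< (suc d) (λ i → x ^ i * eval d (slice i f) xs)   ≡⟨ sym (eval-∷ d f x xs) ⟩
  eval d f (x ∷ xs)                                  ∎
  where
  open ≡-Reasoning
  beyond : ∀ i → suc d ℕ.≤ i → x ^ i * eval e (slice i f) xs ≡ 0ℚ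
  beyond i d<i = trans (cong (x ^ i *_) (eval-zero e xs (slice-beyond i d<i f≡0))) (ℚ.*-zeroʳ (x ^ i))

Σ-antidiagonal : ∀ D (F : ℕ → ℕ → ℚ) →
  Σ< (suc D) (λ a → antidiagonal a F) ≡ Σ< (suc D) (F 0) + Σ< D (λ a → antidiagonal a (F ∘ suc))
Σ-antidiagonal D F = trans
  (cong ((F 0 0 + 0ℚ) +_) (Σ-+ D (λ a → F 0 (suc a)) (λ a → antidiagonal a (F ∘ suc))))
  (solve 3 (λ x y z → (x :+ con 0ℚ) :+ (y :+ z) := (x :+ y) :+ z) refl
    (F 0 0) (Σ< D (λ a → F 0 (suc a))) (Σ< D (λ a → antidiagonal a (F ∘ suc))))
  where open ℚSolver.+-*-Solver

-- The triangle i + j ≤ d + e contains the rectangle i ≤ d, j ≤ e, and the terms outside the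
-- rectangle vanish. The induction removes the row i = 0.
cauchy-product : ∀ d e (u v : ℕ → ℚ) → (∀ i → d ℕ.< i → u i ≡ 0ℚ) → (∀ j → e ℕ.< j → v j ≡ 0ℚ) →
  Σ< (suc (d ℕ.+ e)) (λ a → antidiagonal a (λ i j → u i * v j)) ≡ Σ< (suc d) u * Σ< (suc e) v
cauchy-product zero e u v u≡0 v≡0 = begin
  Σ< (suc e) (λ a → antidiagonal a (λ i j → u i * v j))
    ≡⟨ Σ-antidiagonal e (λ i j → u i * v j) ⟩
  Σ< (suc e) (λ j → u 0 * v j) + Σ< e (λ a → antidiagonal a (λ i j → u (suc i) * v j))
    ≡⟨ cong₂ _+_ (Σ-*ˡ (suc e) (u 0) v) (Σ-zero e λ a _ → Σ-zero (suc a) λ i _ →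
         trans (cong (_* v (a ∸ i)) (u≡0 (suc i) (s≤s z≤n))) (ℚ.*-zeroˡ (v (a ∸ i)))) ⟩
  u 0 * Σ< (suc e) v + 0ℚ
    ≡⟨ solve 2 (λ x y → x :* y :+ con 0ℚ := (x :+ con 0ℚ) :* y) refl (u 0) (Σ< (suc e) v) ⟩
  Σ< 1 u * Σ< (suc e) v ∎
  where
  open ≡-Reasoning
  open ℚSolver.+-*-Solver using (solve; con; _:=_; _:+_; _:*_)
cauchy-product (suc d) e u v u≡0 v≡0 = begin
  Σ< (suc (suc d ℕ.+ e)) (λ a → antidiagonal a (λ i j → u i * v j))
    ≡⟨ Σ-antidiagonal (suc d ℕ.+ e) (λ i j → u i * v j) ⟩
  Σ< (suc (suc d ℕ.+ e)) (λ j → u 0 * v j) + Σ< (suc (d ℕ.+ e)) (λ a → antidiagonal a (λ i j → u (suc i) * v j))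
    ≡⟨ cong₂ _+_
         (trans (Σ-*ˡ (suc (suc d ℕ.+ e)) (u 0) v)
           (cong (u 0 *_) (Σ-extend-≤ (s≤s (ℕ.m≤n+m e (suc d))) v≡0)))
         (cauchy-product d e (u ∘ suc) v (λ i d<i → u≡0 (suc i) (s≤s d<i)) v≡0) ⟩
  u 0 * Σ< (suc e) v + Σ< (suc d) (u ∘ suc) * Σ< (suc e) v
    ≡⟨ sym (ℚ.*-distribʳ-+ (Σ< (suc e) v) (u 0) (Σ< (suc d) (u ∘ suc))) ⟩
  Σ< (suc (suc d)) u * Σ< (suc e) v ∎
  where open ≡-Reasoning

eval-⊛ : ∀ {N d e f g} → Bounded d f → Bounded e g → (xs : Vec ℚ N) →
  eval (d ℕ.+ e) (f ⊛ g) xs ≡ eval d f xs * eval e g xs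
eval-⊛ {f = f} {g} f≡0 g≡0 [] =
  solve 2 (λ x y → x :* y :* con 1ℚ := (x :* con 1ℚ) :* (y :* con 1ℚ)) refl (f []) (g [])
  where open ℚSolver.+-*-Solver
eval-⊛ {d = d} {e} {f} {g} f≡0 g≡0 (x ∷ xs) = begin
  eval D (f ⊛ g) (x ∷ xs)
    ≡⟨ eval-∷ D (f ⊛ g) x xs ⟩
  Σ< (suc D) (λ a → x ^ a * eval D (slice a (f ⊛ g)) xs)
    ≡⟨ Σ-cong (suc D) (λ a → trans
         (cong (x ^ a *_) (eval-Σ D (suc a) (λ i → slice i f ⊛ slice (a ∸ i) g) xs))
         (trans (sym (Σ-*ˡ (suc a) (x ^ a) (λ i → eval D (slice i f ⊛ slice (a ∸ i) g) xs)))
                (Σ-cong< (suc a) λ i i≤a → term a i (ℕ.≤-pred i≤a)))) ⟩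
  Σ< (suc D) (λ a → antidiagonal a (λ i j → u i * v j))
    ≡⟨ cauchy-product d e u v
         (λ i d<i → trans (cong (x ^ i *_) (eval-zero d xs (slice-beyond i d<i f≡0))) (ℚ.*-zeroʳ (x ^ i)))
         (λ i e<i → trans (cong (x ^ i *_) (eval-zero e xs (slice-beyond i e<i g≡0))) (ℚ.*-zeroʳ (x ^ i))) ⟩
  Σ< (suc d) u * Σ< (suc e) v
    ≡⟨ cong₂ _*_ (sym (eval-∷ d f x xs)) (sym (eval-∷ e g x xs)) ⟩
  eval d f (x ∷ xs) * eval e g (x ∷ xs) ∎
  where
  open ≡-Reasoning
  D = d ℕ.+ e
  u v : ℕ → ℚ
  u i = x ^ i * eval d (slice i f) xs
  v j = x ^ j * eval e (slice j g) xs
  term : ∀ a i → i ℕ.≤ a → x ^ a * eval D (slice i f ⊛ slice (a ∸ i) g) xs ≡ u i * v (a ∸ i)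
  term a i i≤a = trans
    (cong₂ _*_
      (trans (cong (x ^_) (sym (ℕ.m+[n∸m]≡n i≤a))) (^-homo-* x i (a ∸ i)))
      (eval-⊛ (bounded-slice i f≡0) (bounded-slice (a ∸ i) g≡0) xs))
    (solve 4 (λ p q r s → (p :* q) :* (r :* s) := (p :* r) :* (q :* s)) refl
      (x ^ i) (x ^ (a ∸ i)) (eval d (slice i f) xs) (eval e (slice (a ∸ i) g) xs))
    where open ℚSolver.+-*-Solver using (solve; _:=_; _:*_)

-- The degree bound is hidden, so that values of sums and products combine without adjusting bounds;
-- `evaluates-unique` shows that the value does not depend on it.
record EvaluatesTo {N} (xs : Vec ℚ N) (f : Series) (q : ℚ) : Set where
  constructor evaluates
  field
    bound   : ℕ
    bounded : Bounded bound f
    value   : eval bound f xs ≡ q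

evaluates-unique : ∀ {N} {xs : Vec ℚ N} {f q r} → EvaluatesTo xs f q → EvaluatesTo xs f r → q ≡ r
evaluates-unique {xs = xs} (evaluates d f≡0 refl) (evaluates e f≡0′ refl) =
  trans (sym (eval-extend (ℕ.m≤m⊔n d e) f≡0 xs)) (eval-extend (ℕ.m≤n⊔m d e) f≡0′ xs)

evaluates-resp : ∀ {N} {xs : Vec ℚ N} {f g q} → f ≈ g → EvaluatesTo xs f q → EvaluatesTo xs g q
evaluates-resp {xs = xs} f≈g (evaluates d f≡0 eq) = evaluates
  d (λ α d<α → trans (sym (f≈g α)) (f≡0 α d<α)) (trans (sym (eval-cong d xs f≈g)) eq)

evaluates-zero : ∀ {N} {xs : Vec ℚ N} → EvaluatesTo xs 0ˢ 0ℚ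
evaluates-zero {xs = xs} = evaluates 0 (λ _ _ → refl) (eval-zero 0 xs (λ _ → refl))

evaluates-⊕ : ∀ {N} {xs : Vec ℚ N} {f g q r} →
  EvaluatesTo xs f q → EvaluatesTo xs g r → EvaluatesTo xs (f ⊕ g) (q + r)
evaluates-⊕ {xs = xs} {f} {g} (evaluates d f≡0 refl) (evaluates e g≡0 refl) = evaluates (d ℕ.⊔ e)
  (⊕-bounded (bounded-≤ (ℕ.m≤m⊔n d e) f≡0) (bounded-≤ (ℕ.m≤n⊔m d e) g≡0))
  (trans (eval-⊕ (d ℕ.⊔ e) f g xs)
    (cong₂ _+_ (eval-extend (ℕ.m≤m⊔n d e) f≡0 xs) (eval-extend (ℕ.m≤n⊔m d e) g≡0 xs)))

evaluates-⊛ : ∀ {N} {xs : Vec ℚ N} {f g q r} →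
  EvaluatesTo xs f q → EvaluatesTo xs g r → EvaluatesTo xs (f ⊛ g) (q * r)
evaluates-⊛ {xs = xs} (evaluates d f≡0 refl) (evaluates e g≡0 refl) =
  evaluates (d ℕ.+ e) (⊛-bounded f≡0 g≡0) (eval-⊛ f≡0 g≡0 xs)

evaluates-Σ : ∀ {N} {xs : Vec ℚ N} n {F : ℕ → Series} {q : ℕ → ℚ} →
  (∀ i → EvaluatesTo xs (F i) (q i)) → EvaluatesTo xs (λ α → Σ< n (λ i → F i α)) (Σ< n q)
evaluates-Σ zero    ev = evaluates-zero
evaluates-Σ (suc n) ev = evaluates-⊕ (ev 0) (evaluates-Σ n (ev ∘ suc))

eval-constant : ∀ {N} c (xs : Vec ℚ N) → eval 0 (constant c) xs ≡ c
eval-constant c []       = ℚ.*-identityʳ c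
eval-constant c (x ∷ xs) = trans (eval-∷ 0 (constant c) x xs)
  (trans (ℚ.+-identityʳ (1ℚ * eval 0 (constant c) xs))
    (trans (ℚ.*-identityˡ (eval 0 (constant c) xs)) (eval-constant c xs)))

evaluates-constant : ∀ {N} {xs : Vec ℚ N} c → EvaluatesTo xs (constant c) c
evaluates-constant {xs = xs} c = evaluates 0 (constant-bounded c) (eval-constant c xs)

esym : ℕ → List ℚ → ℚ
esym zero    xs       = 1ℚ
esym (suc k) []       = 0ℚ
esym (suc k) (x ∷ xs) = esym (suc k) xs + x * esym k xs

eval-elementary : ∀ {N} k (xs : Vec ℚ N) → eval k (elementary k) xs ≡ esym k (toList xs)
eval-elementary zero    []       = refl
eval-elementary (suc k) []       = refl
eval-elementary zero    (x ∷ xs) = trans (eval-∷ 0 (elementary 0) x xs)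
  (trans (cong (λ q → 1ℚ * q + 0ℚ) (trans (eval-cong 0 xs (elementary-pad 0)) (eval-elementary 0 xs))) refl)
eval-elementary (suc k) (x ∷ xs) = begin
  eval (suc k) (elementary (suc k)) (x ∷ xs)
    ≡⟨ eval-∷ (suc k) (elementary (suc k)) x xs ⟩
  1ℚ * e₀ + (x * 1ℚ * e₁ + Σ< k (λ i → x ^ suc (suc i) * eval (suc k) (slice (suc (suc i)) (elementary (suc k))) xs))
    ≡⟨ cong (λ z → 1ℚ * e₀ + (x * 1ℚ * e₁ + z)) (Σ-zero k λ i _ →
         trans (cong (x ^ suc (suc i) *_) (eval-zero (suc k) xs (elementary-two (suc k) i))) (ℚ.*-zeroʳ (x ^ suc (suc i)))) ⟩
  1ℚ * e₀ + (x * 1ℚ * e₁ + 0ℚ)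
    ≡⟨ solve 3 (λ a b c → con 1ℚ :* a :+ (c :* con 1ℚ :* b :+ con 0ℚ) := a :+ c :* b) refl e₀ e₁ x ⟩
  e₀ + x * e₁
    ≡⟨ cong₂ (λ a b → a + x * b)
         (trans (eval-cong (suc k) xs (elementary-pad (suc k))) (eval-elementary (suc k) xs))
         (trans (eval-cong (suc k) xs (elementary-step k))
           (trans (eval-extend (ℕ.n≤1+n k) (elementary-bounded k) xs) (eval-elementary k xs))) ⟩
  esym (suc k) (toList (x ∷ xs)) ∎
  where
  open ≡-Reasoning
  open ℚSolver.+-*-Solver using (solve; con; _:=_; _:+_; _:*_)
  e₀ = eval (suc k) (slice 0 (elementary (suc k))) xs
  e₁ = eval (suc k) (slice 1 (elementary (suc k))) xs

evaluates-elementary : ∀ {N} {xs : Vec ℚ N} k → EvaluatesTo xs (elementary k) (esym k (toList xs))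
evaluates-elementary {xs = xs} k = evaluates k (elementary-bounded k) (eval-elementary k xs)

-- The fundamental theorem of symmetric functions

infixl 6 _⊞_
infixl 7 _⊠_

data Expr : Set where
  con  : ℚ → Expr
  elem : ℕ → Expr
  _⊞_  : Expr → Expr → Expr
  _⊠_  : Expr → Expr → Expr

⟦_⟧ : Expr → Series
⟦ con c ⟧  = constant c
⟦ elem k ⟧ = elementary k
⟦ s ⊞ t ⟧  = ⟦ s ⟧ ⊕ ⟦ t ⟧
⟦ s ⊠ t ⟧  = ⟦ s ⟧ ⊛ ⟦ t ⟧

⟦⟧-sym : ∀ t → Sym ⟦ t ⟧
⟦⟧-sym (con c)  = constant-sym c
⟦⟧-sym (elem k) = elementary-sym k
⟦⟧-sym (s ⊞ t)  = ⊕-sym (⟦⟧-sym s) (⟦⟧-sym t)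
⟦⟧-sym (s ⊠ t)  = ⊛-sym (⟦⟧-sym s) (⟦⟧-sym t)

value : ∀ {N} → Expr → Vec ℚ N → ℚ
value (con c)  xs = c
value (elem k) xs = esym k (toList xs)
value (s ⊞ t)  xs = value s xs + value t xs
value (s ⊠ t)  xs = value s xs * value t xs

⟦⟧-evaluates : ∀ {N} (xs : Vec ℚ N) t → EvaluatesTo xs ⟦ t ⟧ (value t xs)
⟦⟧-evaluates xs (con c)  = evaluates-constant c
⟦⟧-evaluates xs (elem k) = evaluates-elementary k
⟦⟧-evaluates xs (s ⊞ t)  = evaluates-⊕ (⟦⟧-evaluates xs s) (⟦⟧-evaluates xs t)
⟦⟧-evaluates xs (s ⊠ t)  = evaluates-⊛ (⟦⟧-evaluates xs s) (⟦⟧-evaluates xs t)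

toΛ : Expr → Λ
toΛ t = record
  { series    = ⟦ t ⟧
  ; bound     = EvaluatesTo.bound (⟦⟧-evaluates [] t)
  ; bounded   = EvaluatesTo.bounded (⟦⟧-evaluates [] t)
  ; symmetric = sym⇒symmetric (⟦⟧-sym t) }

⊛-vanish-length : ∀ {f g} α → (∀ γ → length γ ≡ length α → f γ ≡ 0ℚ) → (f ⊛ g) α ≡ 0ℚ
⊛-vanish-length {f} {g} []      f≡0 = trans (cong (_* g []) (f≡0 [] refl)) (ℚ.*-zeroˡ (g []))
⊛-vanish-length {f} {g} (a ∷ α) f≡0 = Σ-zero (suc a) λ i _ →
  ⊛-vanish-length {slice i f} {slice (a ∸ i) g} α λ γ len → f≡0 (i ∷ γ) (cong suc len)

elementary-short : ∀ k γ → length γ ℕ.< k → elementary k γ ≡ 0ℚ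
elementary-short (suc k) []                len       = refl
elementary-short k       (0 ∷ γ)           len       =
  trans (elementary-pad k γ) (elementary-short k γ (ℕ.<-trans (ℕ.n<1+n _) len))
elementary-short (suc k) (1 ∷ γ)           (s≤s len) =
  trans (elementary-step k γ) (elementary-short k γ len)
elementary-short k       (suc (suc a) ∷ γ) len       = elementary-two k a γ

-- In n variables, e_n is the product of the variables.
elementary-⊛-suc : ∀ g α → (elementary (length α) ⊛ g) (map suc α) ≡ g α
elementary-⊛-suc g []      = ℚ.*-identityˡ (g [])
elementary-⊛-suc g (a ∷ α) = begin
  (slice 0 (elementary k) ⊛ slice (suc a) g) α⁺ + ((slice 1 (elementary k) ⊛ slice a g) α⁺ + rest)
    ≡⟨ cong₂ _+_
         (⊛-vanish-length {slice 0 (elementary k)} {slice (suc a) g} α⁺ λ γ len →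
           trans (elementary-pad k γ)
             (elementary-short k γ (s≤s (ℕ.≤-reflexive (trans len (List.length-map suc α))))))
         (cong₂ _+_
           (trans (⊛-cong {g = slice a g} (elementary-step (length α)) (λ _ → refl) α⁺) (elementary-⊛-suc (slice a g) α))
           (Σ-zero a λ i _ → ⊛-zeroˡ {slice (suc (suc i)) (elementary k)} (elementary-two k i) (slice (a ∸ suc i) g) α⁺)) ⟩
  0ℚ + (g (a ∷ α) + 0ℚ)
    ≡⟨ trans (ℚ.+-identityˡ (g (a ∷ α) + 0ℚ)) (ℚ.+-identityʳ (g (a ∷ α))) ⟩
  g (a ∷ α) ∎
  where
  open ≡-Reasoning
  k = length (a ∷ α)
  α⁺ = map suc α
  rest = Σ< a (λ i → (slice (suc (suc i)) (elementary k) ⊛ slice (a ∸ suc i) g) α⁺)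

-- In n + 1 variables e_{n+1} is a multiple of x₀. Adding a multiple of it therefore preserves an
-- agreement already reached on monomials free of x₀.
elementary-⊛-pad : ∀ g α → (elementary (suc (length α)) ⊛ g) (0 ∷ α) ≡ 0ℚ
elementary-⊛-pad g α = trans (ℚ.+-identityʳ ((slice 0 (elementary (suc (length α))) ⊛ slice 0 g) α))
  (⊛-vanish-length {slice 0 (elementary (suc (length α)))} {slice 0 g} α λ γ len →
    trans (elementary-pad (suc (length α)) γ) (elementary-short (suc (length α)) γ (s≤s (ℕ.≤-reflexive len))))

zero-or-suc : ∀ α → (∃[ γ ] α ↭ 0 ∷ γ) ⊎ (∃[ γ ] α ≡ map suc γ)
zero-or-suc []          = inj₂ ([] , refl)
zero-or-suc (zero ∷ α)  = inj₁ (α , ↭-refl)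
zero-or-suc (suc a ∷ α) with zero-or-suc α
... | inj₁ (γ , α↭0γ) = inj₁ (suc a ∷ γ , ↭-trans (prep (suc a) α↭0γ) (swap (suc a) 0 ↭-refl))
... | inj₂ (γ , refl) = inj₂ (a ∷ γ , refl)

degree-map-suc : ∀ α → degree (map suc α) ≡ length α ℕ.+ degree α
degree-map-suc []      = refl
degree-map-suc (a ∷ α) = cong suc (trans (cong (a ℕ.+_) (degree-map-suc α))
  (solve 3 (λ a l d → a :+ (l :+ d) := l :+ (a :+ d)) refl a (length α) (degree α)))
  where open ℕSolver.+-*-Solver using (solve; _:=_; _:+_)

-- Agreement on lists of length n is equality in n variables, the others being set to zero, whereas
-- the degree bound concerns the full series of `t`.
Generated : ℕ → Series → ℕ → Set
Generated n f d = ∃[ t ] Bounded d ⟦ t ⟧ × (∀ α → length α ≡ n → f α ≡ ⟦ t ⟧ α)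

SymmetricIn : ℕ → Series → ℕ → Set
SymmetricIn n f d = PermInvariant f × (∀ α → length α ≡ n → d ℕ.< degree α → f α ≡ 0ℚ)

-- Subtracting an expression that agrees with f on x₀ = 0 leaves a multiple
-- of e_{n+1}, whose cofactor has smaller degree.
generate-suc : ∀ n → (∀ f d → SymmetricIn n f d → Generated n f d) →
  ∀ k f d → d ℕ.≤ k → SymmetricIn (suc n) f d → Generated (suc n) f d
generate-suc n generate k f d d≤k (inv , f≡0)
  with t , t-bounded , f₀≡t ← generate (slice 0 f) d
         (slice-perm 0 inv , λ α len → f≡0 (0 ∷ α) (cong suc len)) = extend k d≤k
  where
  symᵗ = ⟦⟧-sym t

  on-zero : ∀ {α γ} → α ↭ 0 ∷ γ → length α ≡ suc n → f α ≡ ⟦ t ⟧ α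
  on-zero {α} {γ} α↭0γ len = trans (inv α↭0γ)
    (trans (f₀≡t γ (ℕ.suc-injective (trans (sym (Perm.↭-length α↭0γ)) len)))
      (trans (sym (Sym.pad symᵗ γ)) (sym (Sym.perm symᵗ α↭0γ))))

  length-suc : ∀ γ → length (map suc γ) ≡ suc n → length γ ≡ suc n
  length-suc γ len = trans (sym (List.length-map suc γ)) len

  grow : suc n ℕ.≤ d → ∀ γ → length γ ≡ suc n → d ∸ suc n ℕ.< degree γ → d ℕ.< degree (map suc γ)
  grow n<d γ len big = subst₂ ℕ._<_ (ℕ.m+[n∸m]≡n n<d)
    (sym (trans (degree-map-suc γ) (cong (ℕ._+ degree γ) len))) (ℕ.+-monoʳ-< (suc n) big)

  extend : ∀ k → d ℕ.≤ k → Generated (suc n) f d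
  extend k d≤k with suc n ℕ.≤? d
  -- A monomial containing all n + 1 variables has degree at least n + 1 > d, where both sides
  -- vanish.
  ... | no n≥d = t , t-bounded , agree
    where
    agree : ∀ α → length α ≡ suc n → f α ≡ ⟦ t ⟧ α
    agree α len with zero-or-suc α
    ... | inj₁ (γ , α↭0γ) = on-zero α↭0γ len
    ... | inj₂ (γ , refl) = trans (f≡0 (map suc γ) len big) (sym (t-bounded (map suc γ) big))
      where
      big : d ℕ.< degree (map suc γ)
      big = ℕ.<-≤-trans (ℕ.≰⇒> n≥d) (ℕ.≤-trans
        (ℕ.≤-reflexive (sym (length-suc γ len)))
        (ℕ.≤-trans (ℕ.m≤m+n (length γ) (degree γ)) (ℕ.≤-reflexive (sym (degree-map-suc γ)))))
  extend zero    d≤k | yes n<d with () ← ℕ.≤-trans n<d d≤k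
  -- On monomials containing all the variables, division of `f ⊖ ⟦ t ⟧` by x₀ ⋯ x_n is
  -- precomposition with `map suc`. The quotient has degree at most d - (n + 1), and `k` bounds the
  -- number of such divisions.
  extend (suc k) d≤k | yes n<d
    with s , s-bounded , h≡s ← generate-suc n generate k ((f ⊖ ⟦ t ⟧) ∘ map suc) (d ∸ suc n)
           (ℕ.≤-trans (ℕ.∸-monoˡ-≤ (suc n) d≤k) (ℕ.m∸n≤m k n))
           ((λ α↭γ → cong₂ _-_ (inv (Perm.map⁺ suc α↭γ)) (Sym.perm symᵗ (Perm.map⁺ suc α↭γ))) ,
           (λ γ len big → let big′ = grow n<d γ len big in
             trans (cong₂ _-_ (f≡0 (map suc γ) (trans (List.length-map suc γ) len) big′) (t-bounded (map suc γ) big′))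
               refl))
    = t ⊞ (elem (suc n) ⊠ s) , bounded , agree
    where
    bounded : Bounded d (⟦ t ⟧ ⊕ elementary (suc n) ⊛ ⟦ s ⟧)
    bounded = ⊕-bounded {⟦ t ⟧} {elementary (suc n) ⊛ ⟦ s ⟧} t-bounded
      (subst (λ e → Bounded e (elementary (suc n) ⊛ ⟦ s ⟧)) (ℕ.m+[n∸m]≡n n<d)
        (⊛-bounded {elementary (suc n)} {⟦ s ⟧} (elementary-bounded (suc n)) s-bounded))

    symᵉ : Sym (elementary (suc n) ⊛ ⟦ s ⟧)
    symᵉ = ⊛-sym (elementary-sym (suc n)) (⟦⟧-sym s)

    agree : ∀ α → length α ≡ suc n → f α ≡ ⟦ t ⟧ α + (elementary (suc n) ⊛ ⟦ s ⟧) α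
    agree α len with zero-or-suc α
    ... | inj₁ (γ , α↭0γ) = trans (on-zero α↭0γ len)
      (trans (sym (ℚ.+-identityʳ (⟦ t ⟧ α))) (cong (⟦ t ⟧ α +_) (sym
        (trans (Sym.perm symᵉ α↭0γ)
          (subst (λ m → (elementary m ⊛ ⟦ s ⟧) (0 ∷ γ) ≡ 0ℚ) (trans (sym (Perm.↭-length α↭0γ)) len)
            (elementary-⊛-pad ⟦ s ⟧ γ))))))
    ... | inj₂ (γ , refl) = trans
      (solve 2 (λ x y → x := y :+ (x :- y)) refl (f (map suc γ)) (⟦ t ⟧ (map suc γ)))
      (cong (⟦ t ⟧ (map suc γ) +_) (trans (h≡s γ (length-suc γ len))
        (sym (subst (λ m → (elementary m ⊛ ⟦ s ⟧) (map suc γ) ≡ ⟦ s ⟧ γ) (length-suc γ len)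
          (elementary-⊛-suc ⟦ s ⟧ γ)))))
      where open ℚSolver.+-*-Solver using (solve; _:=_; _:+_; _:-_)

elementary-generate : ∀ n f d → SymmetricIn n f d → Generated n f d
elementary-generate zero    f d _  =
  con (f []) , bounded-≤ {constant (f [])} z≤n (constant-bounded (f [])) , λ { [] refl → refl }
elementary-generate (suc n) f d = generate-suc n (elementary-generate n) d f d ℕ.≤-refl

compress : ∀ α → ∃[ γ ] length γ ℕ.≤ degree α × (∀ {f} → Sym f → f α ≡ f γ)
compress []          = [] , z≤n , λ _ → refl
compress (zero ∷ α)  with γ , len , f≡ ← compress α =
  γ , len , λ symᶠ → trans (Sym.pad symᶠ α) (f≡ symᶠ)
compress (suc a ∷ α) with γ , len , f≡ ← compress α =
  suc a ∷ γ , s≤s (ℕ.≤-trans len (ℕ.m≤n+m (degree α) a)) , λ symᶠ → f≡ (slice-sym (suc a) symᶠ)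

sym-replicate : ∀ {f} → Sym f → ∀ m γ → f γ ≡ f (replicate m 0 ++ γ)
sym-replicate symᶠ zero    γ = refl
sym-replicate symᶠ (suc m) γ = trans (sym-replicate symᶠ m γ) (sym (Sym.pad symᶠ (replicate m 0 ++ γ)))

resize : ∀ d α → degree α ℕ.≤ d → ∃[ γ ] length γ ≡ d × (∀ {f} → Sym f → f α ≡ f γ)
resize d α α≤d with γ , len , f≡ ← compress α =
  replicate m 0 ++ γ ,
  trans (List.length-++ (replicate m 0)) (trans (cong (ℕ._+ length γ) (List.length-replicate m)) (ℕ.m∸n+n≡m (ℕ.≤-trans len α≤d))) ,
  λ symᶠ → trans (f≡ symᶠ) (sym-replicate symᶠ m γ)
  where m = d ∸ length γ

-- As many variables as the degree bound suffice: every monomial within the bound can be moved into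
-- them by symmetry, and beyond the bound both series vanish.
fundamental : ∀ (f : Λ) → ∃[ t ] Λ.series f ≈ ⟦ t ⟧
fundamental f
  with t , t-bounded , f≡t ← elementary-generate (Λ.bound f) (Λ.series f) (Λ.bound f)
         (Sym.perm (symmetric⇒sym (Λ.symmetric f)) , λ α _ → Λ.bounded f α) = t , agree
  where
  d = Λ.bound f
  agree : Λ.series f ≈ ⟦ t ⟧
  agree α with d ℕ.<? degree α
  ... | yes d<α = trans (Λ.bounded f α d<α) (sym (t-bounded α d<α))
  ... | no  d≮α with γ , len , f≡ ← resize d α (ℕ.≮⇒≥ d≮α) =
    trans (f≡ (symmetric⇒sym (Λ.symmetric f))) (trans (f≡t γ len) (sym (f≡ (⟦⟧-sym t))))

-- Congruences in the localization of ℤ at p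

toℚᵘ-/ : ∀ i n .{{_ : NonZero n}} → ℚ.toℚᵘ (i / n) ℚᵘ.≃ (i ℚᵘ./ n)
toℚᵘ-/ i (suc n) = ℚ.toℚᵘ-fromℚᵘ (ℚᵘ.mkℚᵘ i n)

fromℕ-+ : ∀ a b → fromℕ (a ℕ.+ b) ≡ fromℕ a + fromℕ b
fromℕ-+ a b = ℚ.toℚᵘ-injective (ℚᵘ.≃-trans (toℚᵘ-/ (ℤ.+ (a ℕ.+ b)) 1) (ℚᵘ.≃-trans
  (ℚᵘ.*≡* (cong (ℤ._* ℤ.1ℤ) (trans (ℤ.pos-+ a b)
    (sym (cong₂ ℤ._+_ (ℤ.*-identityʳ (ℤ.+ a)) (ℤ.*-identityʳ (ℤ.+ b)))))))
  (ℚᵘ.≃-sym (ℚᵘ.≃-trans (ℚ.toℚᵘ-homo-+ (fromℕ a) (fromℕ b))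
    (ℚᵘ.+-cong (toℚᵘ-/ (ℤ.+ a) 1) (toℚᵘ-/ (ℤ.+ b) 1))))))

fromℕ-* : ∀ a b → fromℕ (a ℕ.* b) ≡ fromℕ a * fromℕ b
fromℕ-* a b = ℚ.toℚᵘ-injective (ℚᵘ.≃-trans (toℚᵘ-/ (ℤ.+ (a ℕ.* b)) 1) (ℚᵘ.≃-trans
  (ℚᵘ.*≡* (cong (ℤ._* ℤ.1ℤ) (ℤ.pos-* a b)))
  (ℚᵘ.≃-sym (ℚᵘ.≃-trans (ℚ.toℚᵘ-homo-* (fromℕ a) (fromℕ b))
    (ℚᵘ.*-cong (toℚᵘ-/ (ℤ.+ a) 1) (toℚᵘ-/ (ℤ.+ b) 1))))))

fromℕ-^ : ∀ a n → fromℕ (a ℕ.^ n) ≡ fromℕ a ^ n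
fromℕ-^ a zero    = refl
fromℕ-^ a (suc n) = trans (fromℕ-* a (a ℕ.^ n)) (cong (fromℕ a *_) (fromℕ-^ a n))

fromℕ-suc : ∀ a → fromℕ (suc a) ≡ 1ℚ + fromℕ a
fromℕ-suc a = fromℕ-+ 1 a

fromℕ-*-/ : ∀ i n .{{_ : NonZero n}} → fromℕ n * (i / n) ≡ i / 1
fromℕ-*-/ i n@(suc _) = ℚ.toℚᵘ-injective (ℚᵘ.≃-trans (ℚ.toℚᵘ-homo-* (fromℕ n) (i / n)) (ℚᵘ.≃-trans
  (ℚᵘ.*-cong (toℚᵘ-/ (ℤ.+ n) 1) (toℚᵘ-/ i n)) (ℚᵘ.≃-trans
  (ℚᵘ.*≡* (trans (ℤ.*-identityʳ (ℤ.+ n ℤ.* i)) (trans (ℤ.*-comm (ℤ.+ n) i)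
    (cong (i ℤ.*_) (sym (cong ℤ.+_ (ℕ.*-identityˡ n)))))))
  (ℚᵘ.≃-sym (toℚᵘ-/ i 1)))))

↧ₙ-/ : ∀ i n .{{_ : NonZero n}} → ↧ₙ (i / n) ∣ n
↧ₙ-/ i n = divides ℤ.∣ ℤ.gcd i (ℤ.+ n) ∣ (trans (sym (cong ℤ.∣_∣ (ℚ.↧-/ i n)))
  (trans (ℤ.abs-* (↧ (i / n)) (ℤ.gcd i (ℤ.+ n))) (ℕ.*-comm (↧ₙ (i / n)) ℤ.∣ ℤ.gcd i (ℤ.+ n) ∣)))

↧ₙ-+ : ∀ x y → ↧ₙ (x + y) ∣ ↧ₙ x ℕ.* ↧ₙ y
↧ₙ-+ x@(ℚ.mkℚ _ _ _) y@(ℚ.mkℚ _ _ _) = ↧ₙ-/ (↥ x ℤ.* ↧ y ℤ.+ ↥ y ℤ.* ↧ x) (↧ₙ x ℕ.* ↧ₙ y)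

↧ₙ-* : ∀ x y → ↧ₙ (x * y) ∣ ↧ₙ x ℕ.* ↧ₙ y
↧ₙ-* x@(ℚ.mkℚ _ _ _) y@(ℚ.mkℚ _ _ _) = ↧ₙ-/ (↥ x ℤ.* ↥ y) (↧ₙ x ℕ.* ↧ₙ y)

record Mod (p n : ℕ) (q : ℚ) : Set where
  constructor mod
  field
    quotient : ℚ
    integral : quotient ∈ℤ₍ p ₎
    equality : q ≡ fromℕ p ^ n * quotient

fromMod : ∀ {p n q} → Mod p n q → q ≡0[mod p ^ n ]
fromMod (mod r r∈ eq) = r , r∈ , eq

toMod : ∀ {p n q} → q ≡0[mod p ^ n ] → Mod p n q
toMod (r , r∈ , eq) = mod r r∈ eq

module Localization {p : ℕ} (p-prime : Prime p) where

  ∤-* : ∀ {a b} → ¬ p ∣ a → ¬ p ∣ b → ¬ p ∣ a ℕ.* b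
  ∤-* {a} {b} p∤a p∤b p∣ab with euclidsLemma a b p-prime p∣ab
  ... | inj₁ p∣a = p∤a p∣a
  ... | inj₂ p∣b = p∤b p∣b

  ∤-< : ∀ {k} → 0 ℕ.< k → k ℕ.< p → ¬ p ∣ k
  ∤-< {suc k} _ k<p p∣k = ℕ.<⇒≱ k<p (ℕ.∣⇒≤ p∣k)

  integral-+ : ∀ {x y} → x ∈ℤ₍ p ₎ → y ∈ℤ₍ p ₎ → (x + y) ∈ℤ₍ p ₎
  integral-+ {x} {y} x∈ y∈ p∣ = ∤-* {↧ₙ x} {↧ₙ y} x∈ y∈ (ℕ.∣-trans p∣ (↧ₙ-+ x y))

  integral-* : ∀ {x y} → x ∈ℤ₍ p ₎ → y ∈ℤ₍ p ₎ → (x * y) ∈ℤ₍ p ₎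
  integral-* {x} {y} x∈ y∈ p∣ = ∤-* {↧ₙ x} {↧ₙ y} x∈ y∈ (ℕ.∣-trans p∣ (↧ₙ-* x y))

  integral-neg : ∀ {x} → x ∈ℤ₍ p ₎ → (- x) ∈ℤ₍ p ₎
  integral-neg {x} x∈ p∣ = x∈ (subst (p ∣_) (ℤ.+-injective (ℚ.↧-neg x)) p∣)

  integral-/ : ∀ i n .{{_ : NonZero n}} → ¬ p ∣ n → (i / n) ∈ℤ₍ p ₎
  integral-/ i n p∤n p∣ = p∤n (ℕ.∣-trans p∣ (↧ₙ-/ i n))

  p∤1 : ¬ p ∣ 1
  p∤1 p∣1 = ℕ.<⇒≱ (ℕ.nonTrivial⇒n>1 p {{prime⇒nonTrivial p-prime}}) (ℕ.∣⇒≤ p∣1)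

  integral-fromℕ : ∀ k → fromℕ k ∈ℤ₍ p ₎
  integral-fromℕ k = integral-/ (ℤ.+ k) 1 p∤1

  integral-^ : ∀ {x} n → x ∈ℤ₍ p ₎ → (x ^ n) ∈ℤ₍ p ₎
  integral-^ zero    x∈ = integral-fromℕ 1
  integral-^ {x} (suc n) x∈ = integral-* {x} {x ^ n} x∈ (integral-^ n x∈)

  mod-integral : ∀ {n q} → Mod p n q → q ∈ℤ₍ p ₎
  mod-integral {n} (mod r r∈ refl) = integral-* {fromℕ p ^ n} {r} (integral-^ n (integral-fromℕ p)) r∈

  integral-mod : ∀ {q} → q ∈ℤ₍ p ₎ → Mod p 0 q
  integral-mod {q} q∈ = mod q q∈ (sym (ℚ.*-identityˡ q))

  mod-zero : ∀ {n} → Mod p n 0ℚ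
  mod-zero {n} = mod 0ℚ (integral-fromℕ 0) (sym (ℚ.*-zeroʳ (fromℕ p ^ n)))

  mod-resp : ∀ {n x y} → x ≡ y → Mod p n x → Mod p n y
  mod-resp refl x≡0 = x≡0

  mod-+ : ∀ {n x y} → Mod p n x → Mod p n y → Mod p n (x + y)
  mod-+ {n} (mod r r∈ refl) (mod s s∈ refl) =
    mod (r + s) (integral-+ {r} {s} r∈ s∈) (sym (ℚ.*-distribˡ-+ (fromℕ p ^ n) r s))

  mod-neg : ∀ {n x} → Mod p n x → Mod p n (- x)
  mod-neg {n} (mod r r∈ refl) = mod (- r) (integral-neg {r} r∈) (ℚ.neg-distribʳ-* (fromℕ p ^ n) r)

  mod-- : ∀ {n x y} → Mod p n x → Mod p n y → Mod p n (x - y)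
  mod-- x≡0 y≡0 = mod-+ x≡0 (mod-neg y≡0)

  mod-* : ∀ {m n x y} → Mod p m x → Mod p n y → Mod p (m ℕ.+ n) (x * y)
  mod-* {m} {n} (mod r r∈ refl) (mod s s∈ refl) = mod (r * s) (integral-* {r} {s} r∈ s∈)
    (trans (solve 4 (λ a b c d → (a :* b) :* (c :* d) := (a :* c) :* (b :* d)) refl
        (fromℕ p ^ m) r (fromℕ p ^ n) s)
      (cong (_* (r * s)) (sym (^-homo-* (fromℕ p) m n))))
    where open ℚSolver.+-*-Solver using (solve; _:=_; _:*_)

  mod-scale : ∀ {n} c {x} → c ∈ℤ₍ p ₎ → Mod p n x → Mod p n (c * x)
  mod-scale c c∈ x≡0 = mod-* (integral-mod {c} c∈) x≡0

  mod-p^ : ∀ n → Mod p n (fromℕ p ^ n)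
  mod-p^ n = mod 1ℚ (integral-fromℕ 1) (sym (ℚ.*-identityʳ (fromℕ p ^ n)))

  mod-p : Mod p 1 (fromℕ p)
  mod-p = mod-resp (ℚ.*-identityʳ (fromℕ p)) (mod-p^ 1)

  mod-≤ : ∀ {m n x} → m ℕ.≤ n → Mod p n x → Mod p m x
  mod-≤ {m} {n} m≤n (mod r r∈ refl) = mod (fromℕ p ^ (n ∸ m) * r)
    (integral-* {fromℕ p ^ (n ∸ m)} {r} (integral-^ (n ∸ m) (integral-fromℕ p)) r∈)
    (trans (cong (_* r) (trans (cong (fromℕ p ^_) (sym (ℕ.m+[n∸m]≡n m≤n))) (^-homo-* (fromℕ p) m (n ∸ m))))
      (ℚ.*-assoc (fromℕ p ^ m) (fromℕ p ^ (n ∸ m)) r))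

  mod-Σ : ∀ {n} k {F : ℕ → ℚ} → (∀ i → i ℕ.< k → Mod p n (F i)) → Mod p n (Σ< k F)
  mod-Σ zero    F≡0 = mod-zero
  mod-Σ (suc k) F≡0 = mod-+ (F≡0 0 (s≤s z≤n)) (mod-Σ k λ i i<k → F≡0 (suc i) (s≤s i<k))

  mod-cancel : ∀ {n x} k → ¬ p ∣ k → Mod p n (fromℕ k * x) → Mod p n x
  mod-cancel zero p∤k kx≡0 = ⊥-elim (p∤k (p ℕ.∣0))
  mod-cancel {n} {x} k@(suc _) p∤k kx≡0 = mod-resp
    (trans (sym (ℚ.*-assoc (ℤ.1ℤ / k) (fromℕ k) x))
      (trans (cong (_* x) (trans (ℚ.*-comm (ℤ.1ℤ / k) (fromℕ k)) (fromℕ-*-/ ℤ.1ℤ k))) (ℚ.*-identityˡ x)))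
    (mod-scale (ℤ.1ℤ / k) (integral-/ ℤ.1ℤ k p∤k) kx≡0)

  -- The bridge to the conjecture, which speaks of numerators. Cross-multiplying a/b = p (c/d) gives
  -- a d = c b p, and p does not divide d.
  mod⇒∣↥ : ∀ {q} → Mod p 1 q → p ∣ ℤ.∣ ↥ q ∣
  mod⇒∣↥ {q@(ℚ.mkℚ a b-1 _)} (mod r@(ℚ.mkℚ c d-1 _) r∈ eq) =
    [ id , ⊥-elim ∘ r∈ ]′ (euclidsLemma ℤ.∣ a ∣ (suc d-1) p-prime (divides (ℤ.∣ c ∣ ℕ.* suc b-1) cross))
    where
    ad≡pcb : a ℤ.* ℤ.+ (1 ℕ.* suc d-1) ≡ (ℤ.+ p ℤ.* c) ℤ.* ℤ.+ suc b-1
    ad≡pcb = ℚᵘ.drop-*≡* (ℚᵘ.≃-trans (ℚ.toℚᵘ-cong (trans eq (cong (_* r) (ℚ.*-identityʳ (fromℕ p)))))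
      (ℚᵘ.≃-trans (ℚ.toℚᵘ-homo-* (fromℕ p) r) (ℚᵘ.*-cong (toℚᵘ-/ (ℤ.+ p) 1) (ℚᵘ.≃-refl {ℚ.toℚᵘ r}))))
    cross : ℤ.∣ a ∣ ℕ.* suc d-1 ≡ ℤ.∣ c ∣ ℕ.* suc b-1 ℕ.* p
    cross = begin
      ℤ.∣ a ∣ ℕ.* suc d-1                  ≡⟨ cong (ℤ.∣ a ∣ ℕ.*_) (sym (ℕ.*-identityˡ (suc d-1))) ⟩
      ℤ.∣ a ∣ ℕ.* (1 ℕ.* suc d-1)          ≡⟨ sym (ℤ.abs-* a (ℤ.+ (1 ℕ.* suc d-1))) ⟩
      ℤ.∣ a ℤ.* ℤ.+ (1 ℕ.* suc d-1) ∣      ≡⟨ cong ℤ.∣_∣ ad≡pcb ⟩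
      ℤ.∣ (ℤ.+ p ℤ.* c) ℤ.* ℤ.+ suc b-1 ∣  ≡⟨ ℤ.abs-* (ℤ.+ p ℤ.* c) (ℤ.+ suc b-1) ⟩
      ℤ.∣ ℤ.+ p ℤ.* c ∣ ℕ.* suc b-1        ≡⟨ cong (ℕ._* suc b-1) (ℤ.abs-* (ℤ.+ p) c) ⟩
      p ℕ.* ℤ.∣ c ∣ ℕ.* suc b-1            ≡⟨ solve 3 (λ x y z → x :* y :* z := y :* z :* x) refl p ℤ.∣ c ∣ (suc b-1) ⟩
      ℤ.∣ c ∣ ℕ.* suc b-1 ℕ.* p            ∎
      where
      open ≡-Reasoning
      open ℕSolver.+-*-Solver using (solve; _:=_; _:*_)

-- Elementary symmetric polynomials of finite sequences

seq : ℕ → (ℕ → ℚ) → List ℚ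
seq N F = toList (tabulate {n = N} (F ∘ toℕ))

∏ : List ℚ → ℚ
∏ = foldr _*_ 1ℚ

seq-cong : ∀ N {F G : ℕ → ℚ} → (∀ i → i ℕ.< N → F i ≡ G i) → seq N F ≡ seq N G
seq-cong zero    F≡G = refl
seq-cong (suc N) F≡G = cong₂ _∷_ (F≡G 0 (s≤s z≤n)) (seq-cong N λ i i<N → F≡G (suc i) (s≤s i<N))

seq-∷ʳ : ∀ N F → seq (suc N) F ≡ seq N F ++ F N ∷ []
seq-∷ʳ zero    F = refl
seq-∷ʳ (suc N) F = cong (F 0 ∷_) (seq-∷ʳ N (F ∘ suc))

seq-reverse : ∀ N F → seq N F ↭ seq N (λ i → F (N ∸ suc i))
seq-reverse zero    F = ↭-refl
seq-reverse (suc N) F = ↭-trans (Perm.↭-reflexive (seq-∷ʳ N F))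
  (↭-trans (↭-sym (Perm.∷↭∷ʳ (F N) (seq N F))) (prep (F N) (seq-reverse N F)))

∏-↭ : ∀ {xs ys} → xs ↭ ys → ∏ xs ≡ ∏ ys
∏-↭ Perm.refl = refl
∏-↭ (prep x xs↭ys) = cong (x *_) (∏-↭ xs↭ys)
∏-↭ (swap {xs = xs} {ys} x y xs↭ys) = trans (cong (λ z → x * (y * z)) (∏-↭ xs↭ys))
  (solve 3 (λ x y z → x :* (y :* z) := y :* (x :* z)) refl x y (∏ ys))
  where open ℚSolver.+-*-Solver using (solve; _:=_; _:*_)
∏-↭ (Perm.trans p q) = trans (∏-↭ p) (∏-↭ q)

∏-seq-* : ∀ N F G → ∏ (seq N (λ i → F i * G i)) ≡ ∏ (seq N F) * ∏ (seq N G)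
∏-seq-* zero    F G = refl
∏-seq-* (suc N) F G = trans (cong (F 0 * G 0 *_) (∏-seq-* N (F ∘ suc) (G ∘ suc)))
  (solve 4 (λ a b c d → (a :* b) :* (c :* d) := (a :* c) :* (b :* d)) refl
    (F 0) (G 0) (∏ (seq N (F ∘ suc))) (∏ (seq N (G ∘ suc))))
  where open ℚSolver.+-*-Solver using (solve; _:=_; _:*_)

∏-const : ∀ N c → ∏ (seq N (λ _ → c)) ≡ c ^ N
∏-const zero    c = refl
∏-const (suc N) c = cong (c *_) (∏-const N c)

∏-last : ∀ N F → ∏ (seq (suc N) F) ≡ ∏ (seq N F) * F N
∏-last zero    F = ℚ.*-comm (F 0) 1ℚ
∏-last (suc N) F = trans (cong (F 0 *_) (∏-last N (F ∘ suc))) (sym (ℚ.*-assoc (F 0) (∏ (seq N (F ∘ suc))) (F (suc N))))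

esym-↭ : ∀ k {xs ys} → xs ↭ ys → esym k xs ≡ esym k ys
esym-↭ k Perm.refl = refl
esym-↭ zero (prep x xs↭ys) = refl
esym-↭ (suc k) (prep x xs↭ys) = cong₂ (λ a b → a + x * b) (esym-↭ (suc k) xs↭ys) (esym-↭ k xs↭ys)
esym-↭ zero (swap x y xs↭ys) = refl
esym-↭ (suc zero) (swap {xs = xs} {ys} x y xs↭ys) = trans
  (cong (λ a → (a + y * 1ℚ) + x * 1ℚ) (esym-↭ 1 xs↭ys))
  (solve 3 (λ a x y → (a :+ y) :+ x := (a :+ x) :+ y) refl (esym 1 ys) (x * 1ℚ) (y * 1ℚ))
  where open ℚSolver.+-*-Solver using (solve; _:=_; _:+_)
esym-↭ (suc (suc k)) (swap {xs = xs} {ys} x y xs↭ys) = trans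
  (cong₂ (λ a b → a + x * b)
    (cong₂ (λ a b → a + y * b) (esym-↭ (suc (suc k)) xs↭ys) (esym-↭ (suc k) xs↭ys))
    (cong₂ (λ a b → a + y * b) (esym-↭ (suc k) xs↭ys) (esym-↭ k xs↭ys)))
  (solve 5 (λ a b c x y → (a :+ y :* b) :+ x :* (b :+ y :* c) := (a :+ x :* b) :+ y :* (b :+ x :* c)) refl
    (esym (suc (suc k)) ys) (esym (suc k) ys) (esym k ys) x y)
  where open ℚSolver.+-*-Solver using (solve; _:=_; _:+_; _:*_)
esym-↭ k (Perm.trans p q) = trans (esym-↭ k p) (esym-↭ k q)

esym-beyond : ∀ N F k → N ℕ.< k → esym k (seq N F) ≡ 0ℚ
esym-beyond zero    F (suc k) N<k       = refl
esym-beyond (suc N) F (suc k) (s≤s N<k) = trans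
  (cong₂ (λ a b → a + F 0 * b) (esym-beyond N (F ∘ suc) (suc k) (ℕ.m<n⇒m<1+n N<k)) (esym-beyond N (F ∘ suc) k N<k))
  (trans (ℚ.+-identityˡ (F 0 * 0ℚ)) (ℚ.*-zeroʳ (F 0)))

esym-full : ∀ N F → esym N (seq N F) ≡ ∏ (seq N F)
esym-full zero    F = refl
esym-full (suc N) F = trans
  (cong₂ (λ a b → a + F 0 * b) (esym-beyond N (F ∘ suc) (suc N) (ℕ.n<1+n N)) (esym-full N (F ∘ suc)))
  (ℚ.+-identityˡ (F 0 * ∏ (seq N (F ∘ suc))))

-- For an m-element set S of indices, the product of all `A i` times the product of `X i` over S is
-- c^m times the product of `A i` over the complement of S. With c = p this carries questions about
-- p/1, ..., p/(p-1) over to the integers 1, ..., p - 1.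
esym-complement : ∀ N (A X : ℕ → ℚ) c → (∀ i → i ℕ.< N → A i * X i ≡ c) → ∀ m r → m ℕ.+ r ≡ N →
  ∏ (seq N A) * esym m (seq N X) ≡ c ^ m * esym r (seq N A)
esym-complement N A X c AX≡c zero r refl =
  trans (ℚ.*-identityʳ (∏ (seq r A))) (trans (sym (esym-full r A)) (sym (ℚ.*-identityˡ (esym r (seq r A)))))
esym-complement (suc N) A X c AX≡c (suc m) r m+r≡N = begin
  (A 0 * Π) * (e (suc m) + X 0 * e m)
    ≡⟨ solve 5 (λ a x p e e′ → (a :* p) :* (e′ :+ x :* e) := a :* (p :* e′) :+ (a :* x) :* (p :* e)) refl
         (A 0) (X 0) Π (e m) (e (suc m)) ⟩
  A 0 * (Π * e (suc m)) + (A 0 * X 0) * (Π * e m)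
    ≡⟨ cong (A 0 * (Π * e (suc m)) +_) (cong₂ _*_ (AX≡c 0 (s≤s z≤n))
         (esym-complement N (A ∘ suc) (X ∘ suc) c (λ i i<N → AX≡c (suc i) (s≤s i<N)) m r (ℕ.suc-injective m+r≡N))) ⟩
  A 0 * (Π * e (suc m)) + c * (c ^ m * esym r (seq N (A ∘ suc)))
    ≡⟨ finish r m+r≡N ⟩
  c ^ suc m * esym r (seq (suc N) A) ∎
  where
  open ≡-Reasoning
  open ℚSolver.+-*-Solver using (solve; con; _:=_; _:+_; _:*_)
  Π = ∏ (seq N (A ∘ suc))
  e : ℕ → ℚ
  e k = esym k (seq N (X ∘ suc))
  finish : ∀ r → suc m ℕ.+ r ≡ suc N →
    A 0 * (Π * e (suc m)) + c * (c ^ m * esym r (seq N (A ∘ suc))) ≡ c ^ suc m * esym r (seq (suc N) A)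
  finish zero eq = trans
    (cong (λ z → A 0 * (Π * z) + c * (c ^ m * 1ℚ))
      (esym-beyond N (X ∘ suc) (suc m) (s≤s (ℕ.≤-reflexive (sym (trans (sym (ℕ.+-identityʳ m)) (ℕ.suc-injective eq)))))))
    (solve 4 (λ a p c d → a :* (p :* con 0ℚ) :+ c :* (d :* con 1ℚ) := (c :* d) :* con 1ℚ) refl (A 0) Π c (c ^ m))
  finish (suc r) eq = trans
    (cong (λ z → A 0 * z + c * (c ^ m * esym (suc r) (seq N (A ∘ suc))))
      (esym-complement N (A ∘ suc) (X ∘ suc) c (λ i i<N → AX≡c (suc i) (s≤s i<N)) (suc m) r
        (ℕ.suc-injective (trans (cong suc (sym (ℕ.+-suc m r))) eq))))
    (solve 5 (λ a c d u v → a :* ((c :* d) :* u) :+ c :* (d :* v) := (c :* d) :* (v :+ a :* u)) refl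
      (A 0) c (c ^ m) (esym r (seq N (A ∘ suc))) (esym (suc r) (seq N (A ∘ suc))))

Σ-esym : ∀ N M F → N ℕ.< M → Σ< M (λ k → esym k (seq N F)) ≡ ∏ (seq N (λ i → 1ℚ + F i))
Σ-esym zero    (suc M) F _ = cong (1ℚ +_) (Σ-zero M λ _ _ → refl)
Σ-esym (suc N) (suc M) F (s≤s N<M) = begin
  1ℚ + Σ< M (λ k → e (suc k) + F 0 * e k)
    ≡⟨ cong (1ℚ +_) (trans (Σ-+ M (e ∘ suc) (λ k → F 0 * e k)) (cong (Σ< M (e ∘ suc) +_) (Σ-*ˡ M (F 0) e))) ⟩
  1ℚ + (Σ< M (e ∘ suc) + F 0 * Σ< M e)
    ≡⟨ sym (ℚ.+-assoc 1ℚ (Σ< M (e ∘ suc)) (F 0 * Σ< M e)) ⟩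
  Σ< (suc M) e + F 0 * Σ< M e
    ≡⟨ cong₂ (λ a b → a + F 0 * b) (Σ-esym N (suc M) (F ∘ suc) (ℕ.m<n⇒m<1+n N<M)) (Σ-esym N M (F ∘ suc) N<M) ⟩
  Π + F 0 * Π
    ≡⟨ solve 2 (λ p x → p :+ x :* p := (con 1ℚ :+ x) :* p) refl Π (F 0) ⟩
  (1ℚ + F 0) * Π ∎
  where
  open ≡-Reasoning
  open ℚSolver.+-*-Solver using (solve; con; _:=_; _:+_; _:*_)
  e : ℕ → ℚ
  e k = esym k (seq N (F ∘ suc))
  Π = ∏ (seq N (λ i → 1ℚ + F (suc i)))

sign : ℕ → ℚ
sign n = (- 1ℚ) ^ n

-- As functions of k and of the list, both sides satisfy the recursion
-- Q_{k+1}(x ∷ xs) = (1 - x) Q_{k+1}(xs) - x Q_k(xs).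
esym-reflect : ∀ N M {F G : ℕ → ℚ} → (∀ i → i ℕ.< N → (1ℚ - F i) * G i ≡ - F i) → N ℕ.< M → ∀ k →
  Σ< M (λ j → fromℕ (j C k) * (sign j * esym j (seq N F))) ≡ ∏ (seq N (λ i → 1ℚ - F i)) * esym k (seq N G)
esym-reflect zero (suc M) {F} h _ k = trans
  (cong (fromℕ (0 C k) * 1ℚ +_) (Σ-zero M λ j _ →
    trans (cong (fromℕ (suc j C k) *_) (ℚ.*-zeroʳ (sign (suc j)))) (ℚ.*-zeroʳ (fromℕ (suc j C k)))))
  (base k)
  where
  base : ∀ k → fromℕ (0 C k) * 1ℚ + 0ℚ ≡ 1ℚ * esym k []
  base zero    = refl
  base (suc k) = refl
esym-reflect (suc N) (suc M) {F} {G} h (s≤s N<M) k = begin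
  T 0 + Σ< M (λ j → fromℕ (suc j C k) * (sign (suc j) * (e (suc j) + F 0 * e j)))
    ≡⟨ cong (T 0 +_) (trans
         (Σ-cong M λ j → solve 5 (λ c s a x b → c :* (s :* (a :+ x :* b)) := c :* (s :* a) :+ x :* (c :* (s :* b))) refl
           (fromℕ (suc j C k)) (sign (suc j)) (e (suc j)) (F 0) (e j))
         (trans (Σ-+ M (T ∘ suc) (λ j → F 0 * U j)) (cong (Σ< M (T ∘ suc) +_) (Σ-*ˡ M (F 0) U)))) ⟩
  T 0 + (Σ< M (T ∘ suc) + F 0 * Σ< M U)
    ≡⟨ sym (ℚ.+-assoc (T 0) (Σ< M (T ∘ suc)) (F 0 * Σ< M U)) ⟩
  Σ< (suc M) T + F 0 * Σ< M U
    ≡⟨ cong (_+ F 0 * Σ< M U) (esym-reflect N (suc M) h′ (ℕ.m<n⇒m<1+n N<M) k) ⟩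
  Π * g k + F 0 * Σ< M U
    ≡⟨ finish k ⟩
  ((1ℚ - F 0) * Π) * esym k (seq (suc N) G) ∎
  where
  open ≡-Reasoning
  open ℚSolver.+-*-Solver using (solve; con; _:=_; _:+_; _:*_; _:-_; :-_)
  e g : ℕ → ℚ
  e j = esym j (seq N (F ∘ suc))
  g j = esym j (seq N (G ∘ suc))
  Π = ∏ (seq N (λ i → 1ℚ - F (suc i)))
  T U : ℕ → ℚ
  T j = fromℕ (j C k) * (sign j * e j)
  U j = fromℕ (suc j C k) * (sign (suc j) * e j)
  h′ : ∀ i → i ℕ.< N → (1ℚ - F (suc i)) * G (suc i) ≡ - F (suc i)
  h′ i i<N = h (suc i) (s≤s i<N)
  V : ℕ → ℕ → ℚ
  V k j = fromℕ (j C k) * (sign j * e j)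
  V-sum : ∀ k → Σ< M (V k) ≡ Π * g k
  V-sum = esym-reflect N M h′ N<M
  finish : ∀ k → Π * g k + F 0 * Σ< M (λ j → fromℕ (suc j C k) * (sign (suc j) * e j)) ≡
    ((1ℚ - F 0) * Π) * esym k (seq (suc N) G)
  finish zero = trans
    (cong (λ z → Π * 1ℚ + F 0 * z) (trans
      (Σ-cong M λ j → solve 2 (λ s e → con 1ℚ :* ((con (- 1ℚ) :* s) :* e) := :- (con 1ℚ :* (s :* e))) refl (sign j) (e j))
      (trans (Σ-neg M (V 0)) (cong -_ (V-sum 0)))))
    (solve 2 (λ p x → p :* con 1ℚ :+ x :* (:- (p :* con 1ℚ)) := ((con 1ℚ :- x) :* p) :* con 1ℚ) refl Π (F 0))
  finish (suc k) = begin
    Π * g (suc k) + F 0 * Σ< M (λ j → fromℕ (suc j C suc k) * (sign (suc j) * e j))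
      ≡⟨ cong (λ z → Π * g (suc k) + F 0 * z) (trans
           (Σ-cong M λ j → trans
             (cong (_* (sign (suc j) * e j))
               (trans (cong fromℕ (sym (nCk+nC[k+1]≡[n+1]C[k+1] j k))) (fromℕ-+ (j C k) (j C suc k))))
             (solve 4 (λ a b s e → (a :+ b) :* ((con (- 1ℚ) :* s) :* e) := :- (a :* (s :* e) :+ b :* (s :* e))) refl
               (fromℕ (j C k)) (fromℕ (j C suc k)) (sign j) (e j)))
           (trans (Σ-neg M (λ j → V k j + V (suc k) j)) (cong -_ (trans (Σ-+ M (V k) (V (suc k)))
             (cong₂ _+_ (V-sum k) (V-sum (suc k))))))) ⟩
    Π * g (suc k) + F 0 * (- (Π * g k + Π * g (suc k)))
      ≡⟨ solve 4 (λ p x a b → p :* b :+ x :* (:- (p :* a :+ p :* b)) := ((con 1ℚ :- x) :* p) :* b :+ p :* ((:- x) :* a)) refl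
           Π (F 0) (g k) (g (suc k)) ⟩
    ((1ℚ - F 0) * Π) * g (suc k) + Π * ((- F 0) * g k)
      ≡⟨ cong (λ z → ((1ℚ - F 0) * Π) * g (suc k) + Π * (z * g k)) (sym (h 0 (s≤s z≤n))) ⟩
    ((1ℚ - F 0) * Π) * g (suc k) + Π * (((1ℚ - F 0) * G 0) * g k)
      ≡⟨ solve 5 (λ z p b y a → (z :* p) :* b :+ p :* ((z :* y) :* a) := (z :* p) :* (b :+ y :* a)) refl
           (1ℚ - F 0) Π (g (suc k)) (G 0) (g k) ⟩
    ((1ℚ - F 0) * Π) * (g (suc k) + G 0 * g k) ∎

-- Induction on the number of variables. A new variable x contributes the terms (-1)^i x^{i+1}
-- e′_{r-i}, which telescope to x e_r because e′_j = e_j + x e_{j-1}.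
newton : ∀ N F r → let P = λ j → Σ< N (λ i → F i ^ j) in
  fromℕ (suc r) * esym (suc r) (seq N F) ≡ antidiagonal r (λ i j → sign i * P (suc i) * esym j (seq N F))
newton zero    F r = trans (ℚ.*-zeroʳ (fromℕ (suc r))) (sym (Σ-zero (suc r) λ i _ →
  trans (cong (_* esym (r ∸ i) []) (ℚ.*-zeroʳ (sign i))) (ℚ.*-zeroˡ (esym (r ∸ i) []))))
newton (suc N) F r = sym (begin
  antidiagonal r (λ i j → sign i * (x ^ suc i + P (suc i)) * e′ j)
    ≡⟨ antidiagonal-cong r (λ i j → solve 4 (λ s x p e → s :* (x :+ p) :* e := s :* x :* e :+ s :* p :* e) refl
         (sign i) (x ^ suc i) (P (suc i)) (e′ j)) ⟩
  antidiagonal r (λ i j → sign i * x ^ suc i * e′ j + sign i * P (suc i) * e′ j)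
    ≡⟨ antidiagonal-+ r (λ i j → sign i * x ^ suc i * e′ j) (λ i j → sign i * P (suc i) * e′ j) ⟩
  antidiagonal r (λ i j → sign i * x ^ suc i * e′ j) + antidiagonal r (λ i j → sign i * P (suc i) * e′ j)
    ≡⟨ cong (_+ antidiagonal r (λ i j → sign i * P (suc i) * e′ j)) (telescope r) ⟩
  x * e r + antidiagonal r (λ i j → sign i * P (suc i) * e′ j)
    ≡⟨ finish r ⟩
  fromℕ (suc r) * e′ (suc r) ∎)
  where
  open ≡-Reasoning
  open ℚSolver.+-*-Solver using (solve; con; _:=_; _:+_; _:*_; _:-_; :-_)
  x = F 0
  P e e′ : ℕ → ℚ
  P j = Σ< N (λ i → F (suc i) ^ j)
  e j = esym j (seq N (F ∘ suc))
  e′ j = esym j (seq (suc N) F)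
  H : ℕ → ℕ → ℚ
  H i j = sign i * P (suc i) * e j
  IH : ∀ r → antidiagonal r H ≡ fromℕ (suc r) * e (suc r)
  IH r = sym (newton N (F ∘ suc) r)

  telescope : ∀ r → antidiagonal r (λ i j → sign i * x ^ suc i * e′ j) ≡ x * e r
  telescope zero    = solve 1 (λ x → con 1ℚ :* (x :* con 1ℚ) :* con 1ℚ :+ con 0ℚ := x :* con 1ℚ) refl x
  telescope (suc r) = begin
    1ℚ * (x * 1ℚ) * (e (suc r) + x * e r) + antidiagonal r (λ i j → sign (suc i) * x ^ suc (suc i) * e′ j)
      ≡⟨ cong (1ℚ * (x * 1ℚ) * (e (suc r) + x * e r) +_) (trans
           (Σ-cong (suc r) λ i → solve 4 (λ s x y e → (con (- 1ℚ) :* s) :* (x :* y) :* e := (:- x) :* (s :* y :* e)) refl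
             (sign i) x (x ^ suc i) (e′ (r ∸ i)))
           (trans (Σ-*ˡ (suc r) (- x) (λ i → sign i * x ^ suc i * e′ (r ∸ i))) (cong ((- x) *_) (telescope r)))) ⟩
    1ℚ * (x * 1ℚ) * (e (suc r) + x * e r) + (- x) * (x * e r)
      ≡⟨ solve 3 (λ x a b → con 1ℚ :* (x :* con 1ℚ) :* (a :+ x :* b) :+ (:- x) :* (x :* b) := x :* a) refl x (e (suc r)) (e r) ⟩
    x * e (suc r) ∎

  finish : ∀ r → x * e r + antidiagonal r (λ i j → sign i * P (suc i) * e′ j) ≡ fromℕ (suc r) * e′ (suc r)
  finish zero = trans (cong (x * 1ℚ +_) (IH 0))
    (solve 2 (λ x a → x :* con 1ℚ :+ con 1ℚ :* a := con 1ℚ :* (a :+ x :* con 1ℚ)) refl x (e 1))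
  finish (suc r) = begin
    x * e (suc r) + antidiagonal (suc r) (λ i j → sign i * P (suc i) * e′ j)
      ≡⟨ cong (x * e (suc r) +_) (antidiagonal-last r (λ i j → sign i * P (suc i) * e′ j)) ⟩
    x * e (suc r) + (antidiagonal r (λ i j → sign i * P (suc i) * (e (suc j) + x * e j)) + H (suc r) 0)
      ≡⟨ cong (λ z → x * e (suc r) + (z + H (suc r) 0)) (trans
           (antidiagonal-cong r λ i j → solve 4 (λ s a x b → s :* (a :+ x :* b) := s :* a :+ x :* (s :* b)) refl
             (sign i * P (suc i)) (e (suc j)) x (e j))
           (trans (antidiagonal-+ r (λ i j → H i (suc j)) (λ i j → x * H i j))
             (cong (antidiagonal r (λ i j → H i (suc j)) +_) (trans (Σ-*ˡ (suc r) x (λ i → H i (r ∸ i))) (cong (x *_) (IH r)))))) ⟩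
    x * e (suc r) + ((antidiagonal r (λ i j → H i (suc j)) + x * (fromℕ (suc r) * e (suc r))) + H (suc r) 0)
      ≡⟨ solve 5 (λ x a b c d → x :* a :+ ((b :+ x :* (c :* a)) :+ d) := (b :+ d) :+ (con 1ℚ :+ c) :* (x :* a)) refl
           x (e (suc r)) (antidiagonal r (λ i j → H i (suc j))) (fromℕ (suc r)) (H (suc r) 0) ⟩
    (antidiagonal r (λ i j → H i (suc j)) + H (suc r) 0) + (1ℚ + fromℕ (suc r)) * (x * e (suc r))
      ≡⟨ cong₂ _+_ (trans (sym (antidiagonal-last r H)) (IH (suc r))) (cong (_* (x * e (suc r))) (sym (fromℕ-suc (suc r)))) ⟩
    fromℕ (suc (suc r)) * e (suc (suc r)) + fromℕ (suc (suc r)) * (x * e (suc r))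
      ≡⟨ sym (ℚ.*-distribˡ-+ (fromℕ (suc (suc r))) (e (suc (suc r))) (x * e (suc r))) ⟩
    fromℕ (suc (suc r)) * e′ (suc (suc r)) ∎

-- Bernoulli numbers and power sums

lookup-∷ʳ : ∀ {n} (xs : Vec ℚ n) v (b : ℕ → ℚ) → (∀ k → lookup xs k ≡ b (toℕ k)) → v ≡ b n →
  ∀ k → lookup (xs ∷ʳ v) k ≡ b (toℕ k)
lookup-∷ʳ []       v b xs≡b v≡b Fin.zero    = v≡b
lookup-∷ʳ (x ∷ xs) v b xs≡b v≡b Fin.zero    = xs≡b Fin.zero
lookup-∷ʳ (x ∷ xs) v b xs≡b v≡b (Fin.suc k) = lookup-∷ʳ xs v (b ∘ suc) (xs≡b ∘ Fin.suc) v≡b k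

lookup-bernoulliTable : ∀ n k → lookup (bernoulliTable n) k ≡ bernoulli (toℕ k)
lookup-bernoulliTable (suc n) =
  lookup-∷ʳ (bernoulliTable n) _ bernoulli (lookup-bernoulliTable n) (sym (Vec.last-∷ʳ _ (bernoulliTable n)))

kronecker : ℕ → ℚ
kronecker n = if does (n ℕ.≟ 0) then 1ℚ else 0ℚ

bernoulli-unfold : ∀ n →
  bernoulli n ≡ (ℤ.1ℤ / suc n) * (kronecker n - Σ< n (λ k → fromℕ (suc n C k) * bernoulli k))
bernoulli-unfold n = trans (Vec.last-∷ʳ _ (bernoulliTable n))
  (cong (λ z → (ℤ.1ℤ / suc n) * (kronecker n - z))
    (sum-cong-≗ λ k → cong (fromℕ (suc n C toℕ k) *_) (lookup-bernoulliTable n k)))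

bernoulli-recursion : ∀ n →
  fromℕ (suc n) * bernoulli n ≡ kronecker n - Σ< n (λ k → fromℕ (suc n C k) * bernoulli k)
bernoulli-recursion n = trans (cong (fromℕ (suc n) *_) (bernoulli-unfold n))
  (trans (sym (ℚ.*-assoc (fromℕ (suc n)) (ℤ.1ℤ / suc n) z))
    (trans (cong (_* z) (fromℕ-*-/ ℤ.1ℤ (suc n))) (ℚ.*-identityˡ z)))
  where z = kronecker n - Σ< n (λ k → fromℕ (suc n C k) * bernoulli k)

binomial-theorem : ∀ n x → Σ< (suc n) (λ j → fromℕ (n C j) * x ^ j) ≡ (1ℚ + x) ^ n
binomial-theorem zero    x = refl
binomial-theorem (suc n) x = begin
  1ℚ * 1ℚ + Σ< (suc n) (λ j → fromℕ (suc n C suc j) * (x * x ^ j))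
    ≡⟨ cong (1ℚ * 1ℚ +_) (trans
         (Σ-cong (suc n) λ j → trans
           (cong (_* (x * x ^ j)) (trans (cong fromℕ (sym (nCk+nC[k+1]≡[n+1]C[k+1] n j))) (fromℕ-+ (n C j) (n C suc j))))
           (solve 4 (λ a b x y → (a :+ b) :* (x :* y) := x :* (a :* y) :+ b :* (x :* y)) refl
             (fromℕ (n C j)) (fromℕ (n C suc j)) x (x ^ j)))
         (trans (Σ-+ (suc n) (λ j → x * T j) (T ∘ suc))
           (cong (_+ Σ< (suc n) (T ∘ suc)) (trans (Σ-*ˡ (suc n) x T) (cong (x *_) (binomial-theorem n x)))))) ⟩
  1ℚ * 1ℚ + (x * (1ℚ + x) ^ n + Σ< (suc n) (T ∘ suc))
    ≡⟨ solve 3 (λ a b c → a :+ (b :+ c) := b :+ (a :+ c)) refl (1ℚ * 1ℚ) (x * (1ℚ + x) ^ n) (Σ< (suc n) (T ∘ suc)) ⟩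
  x * (1ℚ + x) ^ n + Σ< (suc (suc n)) T
    ≡⟨ cong (x * (1ℚ + x) ^ n +_) (trans (Σ-last (suc n) T) (trans
         (cong₂ _+_ (binomial-theorem n x)
           (trans (cong (λ c → fromℕ c * x ^ suc n) (k>n⇒nCk≡0 (ℕ.n<1+n n))) (ℚ.*-zeroˡ (x ^ suc n))))
         (ℚ.+-identityʳ ((1ℚ + x) ^ n)))) ⟩
  x * (1ℚ + x) ^ n + (1ℚ + x) ^ n
    ≡⟨ solve 2 (λ x y → x :* y :+ y := (con 1ℚ :+ x) :* y) refl x ((1ℚ + x) ^ n) ⟩
  (1ℚ + x) ^ suc n ∎
  where
  open ≡-Reasoning
  open ℚSolver.+-*-Solver using (solve; con; _:=_; _:+_; _:*_)
  T : ℕ → ℚ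
  T j = fromℕ (n C j) * x ^ j

-- The term i = 0 contributes 0 ^ 0 = 1 to the zeroth power sum.
powerSum : ℕ → ℕ → ℚ
powerSum n r = Σ< n (λ i → fromℕ i ^ r)

-- The telescoping sum of (i+1)^{r+1} - i^{r+1}, each difference being expanded by the binomial
-- theorem.
powerSum-recursion : ∀ r n → Σ< (suc r) (λ j → fromℕ (suc r C j) * powerSum n j) ≡ fromℕ n ^ suc r
powerSum-recursion r zero = trans
  (Σ-zero (suc r) λ j _ → ℚ.*-zeroʳ (fromℕ (suc r C j))) (sym (ℚ.*-zeroˡ (0ℚ ^ r)))
powerSum-recursion r (suc n) = begin
  Σ< (suc r) (λ j → c j * powerSum (suc n) j)
    ≡⟨ Σ-cong (suc r) (λ j → trans (cong (c j *_) (Σ-last n (λ i → fromℕ i ^ j)))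
         (ℚ.*-distribˡ-+ (c j) (powerSum n j) (x ^ j))) ⟩
  Σ< (suc r) (λ j → c j * powerSum n j + c j * x ^ j)
    ≡⟨ trans (Σ-+ (suc r) (λ j → c j * powerSum n j) (λ j → c j * x ^ j))
         (cong (_+ Σ< (suc r) (λ j → c j * x ^ j)) (powerSum-recursion r n)) ⟩
  x ^ suc r + Σ< (suc r) (λ j → c j * x ^ j)
    ≡⟨ solve 2 (λ a b → a :+ b := b :+ con 1ℚ :* a) refl (x ^ suc r) (Σ< (suc r) (λ j → c j * x ^ j)) ⟩
  Σ< (suc r) (λ j → c j * x ^ j) + 1ℚ * x ^ suc r
    ≡⟨ cong (λ z → Σ< (suc r) (λ j → c j * x ^ j) + fromℕ z * x ^ suc r) (sym (nCn≡1 (suc r))) ⟩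
  Σ< (suc r) (λ j → c j * x ^ j) + c (suc r) * x ^ suc r
    ≡⟨ sym (Σ-last (suc r) (λ j → c j * x ^ j)) ⟩
  Σ< (suc (suc r)) (λ j → c j * x ^ j)
    ≡⟨ binomial-theorem (suc r) x ⟩
  (1ℚ + x) ^ suc r
    ≡⟨ cong (_^ suc r) (sym (fromℕ-suc n)) ⟩
  fromℕ (suc n) ^ suc r ∎
  where
  open ≡-Reasoning
  open ℚSolver.+-*-Solver using (solve; con; _:=_; _:+_; _:*_)
  x = fromℕ n
  c : ℕ → ℚ
  c j = fromℕ (suc r C j)

[1+n]Cn≡1+n : ∀ n → suc n C n ≡ suc n
[1+n]Cn≡1+n n = trans (nCk≡nC[n∸k] (ℕ.n≤1+n n)) (trans (cong (suc n C_) (trans (ℕ.+-∸-assoc 1 {n} ℕ.≤-refl) (cong suc (ℕ.n∸n≡0 n)))) (nC1≡n (suc n)))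

-- Divisibility is asserted of the successor because n will be p - 1: a prime p > 2 rules out the
-- left alternative.
parity : ∀ n → (2 ∣ suc n) ⊎ (sign n ≡ 1ℚ)
parity zero          = inj₂ refl
parity (suc zero)    = inj₁ (divides 1 refl)
parity (suc (suc n)) with parity n
... | inj₁ (divides q eq) = inj₁ (divides (suc q) (cong (suc ∘ suc) eq))
... | inj₂ eq             = inj₂ (trans
  (solve 1 (λ s → con (- 1ℚ) :* (con (- 1ℚ) :* s) := s) refl (sign n)) eq)
  where open ℚSolver.+-*-Solver using (solve; con; _:=_; _:*_)

module PowerSums {p : ℕ} (p-prime : Prime p) where
  open Localization p-prime

  -- The recursion for B_r divides only by r + 1 < p. The bound `n` on `r` makes a recursion over
  -- all smaller indices structural.
  bernoulli-integral : ∀ n r → r ℕ.≤ n → suc r ℕ.< p → bernoulli r ∈ℤ₍ p ₎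
  bernoulli-integral n r r≤n r<p = mod-integral (mod-resp (sym (bernoulli-unfold r))
    (mod-scale (ℤ.1ℤ / suc r) (integral-/ ℤ.1ℤ (suc r) (∤-< (s≤s z≤n) r<p))
      (mod-- (integral-mod {kronecker r} (kronecker-integral r))
        (mod-Σ r λ k k<r → mod-scale (fromℕ (suc r C k)) (integral-fromℕ (suc r C k))
          (integral-mod {bernoulli k} (earlier n r≤n k k<r))))))
    where
    kronecker-integral : ∀ r → kronecker r ∈ℤ₍ p ₎
    kronecker-integral zero    = integral-fromℕ 1
    kronecker-integral (suc r) = integral-fromℕ 0
    earlier : ∀ n → r ℕ.≤ n → ∀ k → k ℕ.< r → bernoulli k ∈ℤ₍ p ₎
    earlier zero    z≤n k ()
    earlier (suc n) r≤n k k<r = bernoulli-integral n k (ℕ.≤-pred (ℕ.<-≤-trans k<r r≤n)) (ℕ.<-trans (s≤s k<r) r<p)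

  -- Power sums and Bernoulli numbers satisfy the same recursion, up to
  -- p ^ (r + 1).
  powerSum-bernoulli : ∀ n r → r ℕ.≤ n → suc r ℕ.< p → Mod p 2 (powerSum p r - fromℕ p * bernoulli r)
  powerSum-bernoulli n r r≤n r<p = mod-cancel (suc r) (∤-< (s≤s z≤n) r<p)
    (mod-resp (sym recursion) (mod-- (initial r)
      (mod-Σ r λ k k<r → mod-scale (fromℕ (suc r C k)) (integral-fromℕ (suc r C k)) (earlier n r≤n k k<r))))
    where
    D : ℕ → ℚ
    D r = powerSum p r - fromℕ p * bernoulli r

    -- For r = 0 the two terms cancel exactly; for r ≥ 1 the power p^{r+1} is already a multiple of
    -- p².
    initial : ∀ r → Mod p 2 (fromℕ p ^ suc r - fromℕ p * kronecker r)
    initial zero    = mod-resp (sym (ℚ.+-inverseʳ (fromℕ p * 1ℚ))) mod-zero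
    initial (suc r) = mod-- (mod-≤ (s≤s (s≤s z≤n)) (mod-p^ (suc (suc r)))) (mod-resp (sym (ℚ.*-zeroʳ (fromℕ p))) mod-zero)

    earlier : ∀ n → r ℕ.≤ n → ∀ k → k ℕ.< r → Mod p 2 (D k)
    earlier zero    z≤n k ()
    earlier (suc n) r≤n k k<r = powerSum-bernoulli n k (ℕ.≤-pred (ℕ.<-≤-trans k<r r≤n)) (ℕ.<-trans (s≤s k<r) r<p)

    c : ℕ → ℚ
    c k = fromℕ (suc r C k)

    recursion : fromℕ (suc r) * D r ≡ (fromℕ p ^ suc r - fromℕ p * kronecker r) - Σ< r (λ k → c k * D k)
    recursion = begin
      fromℕ (suc r) * D r
        ≡⟨ solve 4 (λ n s p b → n :* (s :- p :* b) := n :* s :- p :* (n :* b)) refl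
             (fromℕ (suc r)) (powerSum p r) (fromℕ p) (bernoulli r) ⟩
      fromℕ (suc r) * powerSum p r - fromℕ p * (fromℕ (suc r) * bernoulli r)
        ≡⟨ cong (λ z → fromℕ (suc r) * powerSum p r - fromℕ p * z) (bernoulli-recursion r) ⟩
      fromℕ (suc r) * powerSum p r - fromℕ p * (kronecker r - B)
        ≡⟨ solve 5 (λ a s p k b → a :- p :* (k :- b) := ((s :+ a) :- p :* k) :- (s :- p :* b)) refl
             (fromℕ (suc r) * powerSum p r) S (fromℕ p) (kronecker r) B ⟩
      ((S + fromℕ (suc r) * powerSum p r) - fromℕ p * kronecker r) - (S - fromℕ p * B)
        ≡⟨ cong₂ (λ u v → (u - fromℕ p * kronecker r) - v)
             (trans (cong (λ z → S + fromℕ z * powerSum p r) (sym ([1+n]Cn≡1+n r)))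
               (trans (sym (Σ-last r (λ k → c k * powerSum p k))) (powerSum-recursion r p)))
             differences ⟩
      (fromℕ p ^ suc r - fromℕ p * kronecker r) - Σ< r (λ k → c k * D k) ∎
      where
      open ≡-Reasoning
      open ℚSolver.+-*-Solver using (solve; _:=_; _:+_; _:*_; _:-_; :-_)
      S = Σ< r (λ k → c k * powerSum p k)
      B = Σ< r (λ k → c k * bernoulli k)
      differences : S - fromℕ p * B ≡ Σ< r (λ k → c k * D k)
      differences = sym (trans
        (Σ-cong r λ k → solve 4 (λ c s p b → c :* (s :- p :* b) := c :* s :+ (:- p) :* (c :* b)) refl
          (c k) (powerSum p k) (fromℕ p) (bernoulli k))
        (trans (Σ-+ r (λ k → c k * powerSum p k) (λ k → (- fromℕ p) * (c k * bernoulli k)))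
          (cong (S +_) (trans (Σ-*ˡ r (- fromℕ p) (λ k → c k * bernoulli k)) (sym (ℚ.neg-distribˡ-* (fromℕ p) B))))))

-- Elementary symmetric polynomials at (p/1, …, p/(p-1))

Σ-split : ∀ a b (F : ℕ → ℚ) → Σ< (a ℕ.+ b) F ≡ Σ< a F + Σ< b (λ i → F (a ℕ.+ i))
Σ-split zero    b F = sym (ℚ.+-identityˡ (Σ< b F))
Σ-split (suc a) b F = trans (cong (F 0 +_) (Σ-split a b (F ∘ suc)))
  (sym (ℚ.+-assoc (F 0) (Σ< a (F ∘ suc)) (Σ< b (λ i → F (suc a ℕ.+ i)))))

fromℕ-cancel : ∀ k {x y} → k ≢ 0 → fromℕ k * x ≡ fromℕ k * y → x ≡ y
fromℕ-cancel zero k≢0 eq = ⊥-elim (k≢0 refl)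
fromℕ-cancel k@(suc _) {x} {y} _ eq = trans (sym (inverse x)) (trans (cong ((ℤ.1ℤ / k) *_) eq) (inverse y))
  where
  inverse : ∀ z → (ℤ.1ℤ / k) * (fromℕ k * z) ≡ z
  inverse z = trans (sym (ℚ.*-assoc (ℤ.1ℤ / k) (fromℕ k) z))
    (trans (cong (_* z) (trans (ℚ.*-comm (ℤ.1ℤ / k) (fromℕ k)) (fromℕ-*-/ ℤ.1ℤ k))) (ℚ.*-identityˡ z))

module HarmonicPoint {N : ℕ} (p-prime : Prime (suc N)) (2<p : 2 ℕ.< suc N) where
  open Localization p-prime
  open PowerSums p-prime

  p = suc N
  π = fromℕ p

  A X : ℕ → ℚ
  A i = fromℕ (suc i)
  X i = ℤ.+ p / suc i

  e E P : ℕ → ℚ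
  e r = esym r (seq N A)
  E m = esym m (seq N X)
  P j = Σ< N (λ i → A i ^ j)

  W : ℚ
  W = ∏ (seq N A)

  A*X : ∀ i → A i * X i ≡ π
  A*X i = fromℕ-*-/ (ℤ.+ p) (suc i)

  mod-X : ∀ i → i ℕ.< N → Mod p 1 (X i)
  mod-X i i<N = mod-cancel (suc i) (∤-< (s≤s z≤n) (s≤s i<N)) (mod-resp (sym (A*X i)) mod-p)

  mod-esym : ∀ {c} k n {F} → (∀ i → i ℕ.< n → Mod p c (F i)) → Mod p (k ℕ.* c) (esym k (seq n F))
  mod-esym zero    n       F≡0 = integral-mod {1ℚ} (integral-fromℕ 1)
  mod-esym (suc k) zero    F≡0 = mod-zero
  mod-esym (suc k) (suc n) F≡0 =
    mod-+ (mod-esym (suc k) n λ i i<n → F≡0 (suc i) (s≤s i<n))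
          (mod-* (F≡0 0 (s≤s z≤n)) (mod-esym k n λ i i<n → F≡0 (suc i) (s≤s i<n)))

  mod-E : ∀ m → Mod p m (E m)
  mod-E m = subst (λ k → Mod p k (E m)) (ℕ.*-identityʳ m) (mod-esym m N mod-X)

  integral-esym : ∀ k n F → (∀ i → F i ∈ℤ₍ p ₎) → Mod p 0 (esym k (seq n F))
  integral-esym k n F F∈ = mod-≤ z≤n (mod-esym k n λ i _ → integral-mod {F i} (F∈ i))

  integral-sign : ∀ n → sign n ∈ℤ₍ p ₎
  integral-sign n = integral-^ { - 1ℚ} n (integral-neg {1ℚ} (integral-fromℕ 1))

  P-bernoulli : ∀ j → suc j ℕ.< N → Mod p 2 (P (suc j) - π * bernoulli (suc j))
  P-bernoulli j j<N = mod-resp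
    -- The exponent is positive, so the term i = 0 of `powerSum` drops out and 1, ..., p - 1 remain.
    (cong (_- π * bernoulli (suc j)) (trans (cong (_+ P (suc j)) (ℚ.*-zeroˡ (0ℚ ^ j))) (ℚ.+-identityˡ (P (suc j)))))
    (powerSum-bernoulli (suc j) (suc j) ℕ.≤-refl (s≤s j<N))

  mod-P : ∀ j → suc j ℕ.< N → Mod p 1 (P (suc j))
  mod-P j j<N = mod-resp
    (solve 2 (λ x y → (x :- y) :+ y := x) refl (P (suc j)) (π * bernoulli (suc j)))
    (mod-+ (mod-≤ (s≤s z≤n) (P-bernoulli j j<N))
      (mod-* mod-p (integral-mod {bernoulli (suc j)} (bernoulli-integral (suc j) (suc j) ℕ.≤-refl (s≤s j<N)))))
    where open ℚSolver.+-*-Solver using (solve; _:=_; _:+_; _:-_)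

  -- Each term of Newton's identity contains a power sum of positive exponent below p - 1, hence a
  -- factor p, and r + 1 is a unit at p.
  mod-e : ∀ r → suc r ℕ.< N → Mod p 1 (e (suc r))
  mod-e r r<N = mod-cancel (suc r) (∤-< (s≤s z≤n) (ℕ.m<n⇒m<1+n r<N)) (mod-resp (sym (newton N A r))
    (mod-Σ (suc r) λ i i≤r → mod-*
      (mod-scale (sign i) (integral-sign i) (mod-P i (ℕ.≤-<-trans i≤r r<N)))
      (integral-esym (r ∸ i) N A λ i → integral-fromℕ (suc i))))

  -- All terms of Newton's identity but the last are products of a power sum and some e_j with j ≥
  -- 1. Both factors are multiples of p, so only the last term survives modulo p².
  e-powerSum : ∀ r → suc r ℕ.< N → Mod p 2 (fromℕ (suc r) * e (suc r) - sign r * P (suc r))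
  e-powerSum r r<N = mod-resp (cong (_- sign r * P (suc r)) (sym (newton N A r))) (cases r r<N)
    where
    H : ℕ → ℕ → ℚ
    H i j = sign i * P (suc i) * e j
    cases : ∀ r → suc r ℕ.< N → Mod p 2 (antidiagonal r H - sign r * P (suc r))
    cases zero    r<N = mod-resp
      (solve 1 (λ x → con 0ℚ := (x :* con 1ℚ :+ con 0ℚ) :- x) refl (sign 0 * P 1)) mod-zero
      where open ℚSolver.+-*-Solver using (solve; con; _:=_; _:+_; _:*_; _:-_)
    cases (suc r) r<N = mod-resp
      (sym (trans (cong (_- sign (suc r) * P (suc (suc r))) (antidiagonal-last r H))
        (solve 2 (λ x y → (x :+ y :* con 1ℚ) :- y := x) refl
          (antidiagonal r (λ i j → H i (suc j))) (sign (suc r) * P (suc (suc r))))))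
      (mod-Σ (suc r) λ i i≤r → mod-*
        (mod-scale (sign i) (integral-sign i) (mod-P i (ℕ.<-trans (s≤s i≤r) r<N)))
        (mod-e (r ∸ i) (ℕ.≤-<-trans (s≤s (ℕ.m∸n≤m r i)) (ℕ.<-trans (ℕ.n<1+n (suc r)) r<N))))
      where open ℚSolver.+-*-Solver using (solve; con; _:=_; _:+_; _:*_; _:-_)

  -- Evaluating ∏ (T + i) at T = 1 gives p!, and all coefficients except the
  -- first and the last are divisible by p.
  wilson : ∀ n → suc n ≡ N → Mod p 1 (1ℚ + W)
  wilson n n<N = mod-resp
    (solve 3 (λ a b c → (con 1ℚ :+ (a :+ b)) :- a := con 1ℚ :+ b) refl
      (Σ< n (λ k → e (suc k))) W 0ℚ)
    (mod-- (mod-resp total (mod-resp (sym (Σ-esym N (suc N) A (ℕ.n<1+n N))) product))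
      (mod-Σ n λ k k<n → mod-e k (subst (suc k ℕ.<_) n<N (s≤s k<n))))
    where
    open ℚSolver.+-*-Solver using (solve; con; _:=_; _:+_; _:*_; _:-_)
    total : Σ< (suc N) e ≡ 1ℚ + (Σ< n (λ k → e (suc k)) + W)
    total = cong (1ℚ +_) (trans (cong (λ m → Σ< m (e ∘ suc)) (sym n<N)) (trans (Σ-last n (e ∘ suc))
      (cong (Σ< n (e ∘ suc) +_) (trans (cong e n<N) (esym-full N A)))))
    1+A : ℕ → ℚ
    1+A i = 1ℚ + A i
    product : Mod p 1 (∏ (seq N 1+A))
    product = mod-resp (cong (λ m → ∏ (seq m 1+A)) n<N) (mod-resp (sym (∏-last n 1+A))
      (mod-* (mod-resp (esym-full n 1+A) (integral-esym n n 1+A λ i → integral-+ {1ℚ} {A i} (integral-fromℕ 1) (integral-fromℕ (suc i))))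
        (mod-resp (trans (cong fromℕ (cong suc (sym n<N))) (fromℕ-suc (suc n))) mod-p)))

  factorial : ∀ n → n ℕ.< p → ∃[ k ] ∏ (seq n A) ≡ fromℕ k × ¬ (p ∣ k)
  factorial zero    _   = 1 , refl , p∤1
  factorial (suc n) n<p with k , eq , p∤k ← factorial n (ℕ.<-trans (ℕ.n<1+n n) n<p) =
    k ℕ.* suc n ,
    trans (∏-last n A) (trans (cong (_* A n) eq) (sym (fromℕ-* k (suc n)))) ,
    ∤-* {k} {suc n} p∤k (∤-< (s≤s z≤n) n<p)

  cancel-W : ∀ {n x} → Mod p n (W * x) → Mod p n x
  cancel-W {n} {x} Wx≡0 with k , eq , p∤k ← factorial N (ℕ.n<1+n N) =
    mod-cancel k p∤k (mod-resp (cong (_* x) eq) Wx≡0)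

  cancel-W-≡ : ∀ {x y} → W * x ≡ W * y → x ≡ y
  cancel-W-≡ {x} {y} eq with k , W≡k , p∤k ← factorial N (ℕ.n<1+n N) =
    fromℕ-cancel k (λ { refl → p∤k (p ℕ.∣0) }) (subst (λ w → w * x ≡ w * y) W≡k eq)

  complement : ∀ m r → m ℕ.+ r ≡ N → W * E m ≡ π ^ m * e r
  complement = esym-complement N A X π (λ i _ → A*X i)

  -- This is why e_k gets H-degree k + 1: the k variables supply p^k, and the complementary
  -- symmetric function of 1, ..., p - 1, which has positive degree below p - 1, supplies one more
  -- factor p.
  mod-E-suc : ∀ m r → suc m ℕ.+ suc r ≡ N → Mod p (suc (suc m)) (E (suc m))
  mod-E-suc m r m+r≡N = cancel-W (mod-resp (sym (complement (suc m) (suc r) m+r≡N))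
    (subst (λ k → Mod p k (π ^ suc m * e (suc r))) (ℕ.+-comm (suc m) 1)
      (mod-* (mod-p^ (suc m)) (mod-e r (subst (suc r ℕ.<_) m+r≡N (s≤s (ℕ.m≤n+m (suc r) m)))))))

  sign-N : sign N ≡ 1ℚ
  sign-N with parity N
  ... | inj₂ eq  = eq
  ... | inj₁ 2∣p with prime⇒irreducible p-prime 2∣p
  ...   | inj₁ ()
  ...   | inj₂ 2≡p = ⊥-elim (ℕ.<⇒≢ 2<p 2≡p)

  -- Let M = m + 1 and R = p - 1 - M. By complementation R W E_M = p^M (R e_R), which is -p^{M+1}
  -- B_R modulo p^{M+2}. Since W ≡ -1 and R ≡ -(M + 1) modulo p, the factor R W is M + 1 modulo p,
  -- and the error is absorbed by E_M, a multiple of p^{M+1}.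
  harmonic-bernoulli : ∀ m r → suc m ℕ.+ suc r ≡ N → sign (suc m) ≡ 1ℚ →
    Mod p (suc (suc (suc m))) (- fromℕ (suc (suc m)) * E (suc m) - π ^ suc (suc m) * bernoulli (suc r))
  harmonic-bernoulli m r m+r≡N even = mod-resp (sym identity)
    (mod-+ (mod-neg (subst (λ k → Mod p k (π ^ M * (Q - D))) (ℕ.+-comm M 2)
        (mod-* (mod-p^ M) (mod-- (e-powerSum r r<N) (P-bernoulli r r<N)))))
      (mod-* (mod-- (mod-- (mod-* mod-p (integral-mod {w} (mod-integral w≡0))) mod-p)
          (mod-scale a (integral-fromℕ (suc M)) w≡0))
        (mod-E-suc m r m+r≡N)))
    where
    open ≡-Reasoning
    open ℚSolver.+-*-Solver using (solve; con; _:=_; _:+_; _:*_; _:-_; :-_)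
    M = suc m
    R = suc r
    r<N : R ℕ.< N
    r<N = subst (R ℕ.<_) m+r≡N (s≤s (ℕ.m≤n+m R m))
    a = fromℕ (suc M)
    ρ = fromℕ R
    s = sign r
    B = bernoulli R
    w = 1ℚ + W
    Q = ρ * e R - s * P R
    D = P R - π * B
    w≡0 : Mod p 1 w
    w≡0 = wilson (m ℕ.+ suc r) m+r≡N
    π≡ρ+a : π ≡ ρ + a
    π≡ρ+a = trans (cong fromℕ (trans (cong suc (sym m+r≡N)) (ℕ.+-comm (suc M) R))) (fromℕ-+ R (suc M))
    -- M and N = M + R are even, so R is even and r = R - 1 is odd.
    s≡-1 : s ≡ - 1ℚ
    s≡-1 = begin
      s                     ≡⟨ solve 1 (λ s → s := :- (con 1ℚ :* (con (- 1ℚ) :* s))) refl s ⟩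
      - (1ℚ * sign R)       ≡⟨ cong (λ z → - (z * sign R)) (sym even) ⟩
      - (sign M * sign R)   ≡⟨ cong -_ (sym (^-homo-* (- 1ℚ) M R)) ⟩
      - sign (M ℕ.+ R)      ≡⟨ cong (-_ ∘ sign) m+r≡N ⟩
      - sign N              ≡⟨ cong -_ sign-N ⟩
      - 1ℚ                  ∎
    Q-D : Q - D ≡ ρ * e R + π * B
    Q-D = trans (cong (λ z → (ρ * e R - z * P R) - D) s≡-1)
      (solve 4 (λ x y z b → (x :- con (- 1ℚ) :* y) :- (y :- z :* b) := x :+ z :* b) refl (ρ * e R) (P R) π B)
    -- The coefficient of `E M` on the right is ρ W - a, rewritten with ρ = π - a and W = w - 1 so
    -- that each summand is visibly divisible by p.
    identity : - a * E M - π ^ suc M * B ≡ - (π ^ M * (Q - D)) + (π * w - π - a * w) * E M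
    identity = sym (begin
      - (π ^ M * (Q - D)) + (π * w - π - a * w) * E M
        ≡⟨ cong₂ (λ x y → - (π ^ M * x) + (y * w - y - a * w) * E M) Q-D π≡ρ+a ⟩
      - (π ^ M * (ρ * e R + π * B)) + ((ρ + a) * w - (ρ + a) - a * w) * E M
        ≡⟨ solve 8 (λ pm rho er pi b a W E →
             (:- (pm :* (rho :* er :+ pi :* b))) :+ ((rho :+ a) :* (con 1ℚ :+ W) :- (rho :+ a) :- a :* (con 1ℚ :+ W)) :* E
             := rho :* (W :* E :- pm :* er) :+ ((:- a) :* E :- (pi :* pm) :* b)) refl
             (π ^ M) ρ (e R) π B a W (E M) ⟩
      ρ * (W * E M - π ^ M * e R) + (- a * E M - π ^ suc M * B)
        ≡⟨ cong (λ z → ρ * (z - π ^ M * e R) + (- a * E M - π ^ suc M * B)) (complement M R m+r≡N) ⟩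
      ρ * (π ^ M * e R - π ^ M * e R) + (- a * E M - π ^ suc M * B)
        ≡⟨ solve 3 (λ x y z → x :* (y :- y) :+ z := z) refl ρ (π ^ M * e R) (- a * E M - π ^ suc M * B) ⟩
      - a * E M - π ^ suc M * B ∎)

  Xʳ : ℕ → ℚ
  Xʳ i = X (N ∸ suc i)

  complement-suc : ∀ i → i ℕ.< N → fromℕ (suc (N ∸ suc i)) ≡ π - A i
  complement-suc i i<N = begin
    b              ≡⟨ solve 2 (λ a b → b := (a :+ b) :- a) refl (A i) b ⟩
    (A i + b) - A i ≡⟨ cong (_- A i) (trans (sym (fromℕ-+ (suc i) (suc (N ∸ suc i))))
      (cong fromℕ (trans (ℕ.+-suc (suc i) (N ∸ suc i)) (cong suc (ℕ.m+[n∸m]≡n i<N))))) ⟩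
    π - A i        ∎
    where
    open ≡-Reasoning
    open ℚSolver.+-*-Solver using (solve; _:=_; _:+_; _:-_)
    b = fromℕ (suc (N ∸ suc i))

  reflect-X : ∀ i → i ℕ.< N → (1ℚ - X i) * Xʳ i ≡ - X i
  reflect-X i i<N = fromℕ-cancel (suc i) (λ ()) (begin
    A i * ((1ℚ - X i) * Xʳ i)   ≡⟨ solve 3 (λ a x y → a :* ((con 1ℚ :- x) :* y) := (a :- a :* x) :* y) refl (A i) (X i) (Xʳ i) ⟩
    (A i - A i * X i) * Xʳ i    ≡⟨ cong (λ z → (A i - z) * Xʳ i) (A*X i) ⟩
    (A i - π) * Xʳ i            ≡⟨ solve 3 (λ a p y → (a :- p) :* y := :- ((p :- a) :* y)) refl (A i) π (Xʳ i) ⟩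
    - ((π - A i) * Xʳ i)        ≡⟨ cong (λ z → - (z * Xʳ i)) (sym (complement-suc i i<N)) ⟩
    - (A (N ∸ suc i) * Xʳ i)    ≡⟨ cong -_ (A*X (N ∸ suc i)) ⟩
    - π                         ≡⟨ cong -_ (sym (A*X i)) ⟩
    - (A i * X i)               ≡⟨ ℚ.neg-distribʳ-* (A i) (X i) ⟩
    A i * - X i                 ∎)
    where
    open ≡-Reasoning
    open ℚSolver.+-*-Solver using (solve; con; _:=_; _:*_; _:-_; :-_)

  -- Multiplied by (p - 1)!, the factors become a - p for a = 1, ..., p - 1. Up to a sign each,
  -- these are the same integers in reverse order, and the number p - 1 of signs is even.
  ∏-1-X : ∏ (seq N (λ i → 1ℚ - X i)) ≡ 1ℚ
  ∏-1-X = cancel-W-≡ (begin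
    W * ∏ (seq N (λ i → 1ℚ - X i))
      ≡⟨ sym (∏-seq-* N A (λ i → 1ℚ - X i)) ⟩
    ∏ (seq N (λ i → A i * (1ℚ - X i)))
      ≡⟨ cong ∏ (seq-cong N λ i i<N → trans
           (solve 2 (λ a x → a :* (con 1ℚ :- x) := con (- 1ℚ) :* (a :* x :- a)) refl (A i) (X i))
           (cong (- 1ℚ *_) (trans (cong (_- A i) (A*X i)) (sym (complement-suc i i<N))))) ⟩
    ∏ (seq N (λ i → - 1ℚ * A (N ∸ suc i)))
      ≡⟨ ∏-seq-* N (λ _ → - 1ℚ) (λ i → A (N ∸ suc i)) ⟩
    ∏ (seq N (λ _ → - 1ℚ)) * ∏ (seq N (λ i → A (N ∸ suc i)))
      ≡⟨ cong₂ _*_ (trans (∏-const N (- 1ℚ)) sign-N) (sym (∏-↭ (seq-reverse N A))) ⟩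
    1ℚ * W
      ≡⟨ ℚ.*-comm 1ℚ W ⟩
    W * 1ℚ ∎)
    where
    open ≡-Reasoning
    open ℚSolver.+-*-Solver using (solve; con; _:=_; _:*_; _:-_)

  -- An exact identity in ℚ: without truncation, e_k + ∑ (-1)^{j+1} C(j,k) e_j is zero at the
  -- harmonic point, since reflection only permutes the points p/i.
  reflection : ∀ M → N ℕ.< M → ∀ k → Σ< M (λ j → fromℕ (j C k) * (sign j * E j)) ≡ E k
  reflection M N<M k = begin
    Σ< M (λ j → fromℕ (j C k) * (sign j * E j))           ≡⟨ esym-reflect N M reflect-X N<M k ⟩
    ∏ (seq N (λ i → 1ℚ - X i)) * esym k (seq N Xʳ)        ≡⟨ cong₂ _*_ ∏-1-X (sym (esym-↭ k (seq-reverse N X))) ⟩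
    1ℚ * E k                                              ≡⟨ ℚ.*-identityˡ (E k) ⟩
    E k                                                   ∎
    where open ≡-Reasoning

  -- By the exact identity, the truncated relation equals the omitted tail j ≥ k + n, and there
  -- `E j` is divisible by p^j.
  mod-β : ∀ n k → Mod p n (E k + Σ< n (λ i → sign (suc (k ℕ.+ i)) * fromℕ ((k ℕ.+ i) C k) * E (k ℕ.+ i)))
  mod-β n k = mod-resp (sym identity) (mod-Σ (suc N) λ j _ →
    mod-scale (fromℕ ((k ℕ.+ n ℕ.+ j) C k)) (integral-fromℕ ((k ℕ.+ n ℕ.+ j) C k)) (mod-scale (sign (k ℕ.+ n ℕ.+ j)) (integral-sign (k ℕ.+ n ℕ.+ j))
      (mod-≤ (ℕ.≤-trans (ℕ.m≤n+m n k) (ℕ.m≤m+n (k ℕ.+ n) j)) (mod-E (k ℕ.+ n ℕ.+ j)))))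
    where
    open ≡-Reasoning
    open ℚSolver.+-*-Solver using (solve; con; _:=_; _:+_; _:*_; _:-_; :-_)
    T : ℕ → ℚ
    T j = fromℕ (j C k) * (sign j * E j)
    tail = Σ< (suc N) (λ j → T (k ℕ.+ n ℕ.+ j))
    body = Σ< n (λ i → T (k ℕ.+ i))
    identity : E k + Σ< n (λ i → sign (suc (k ℕ.+ i)) * fromℕ ((k ℕ.+ i) C k) * E (k ℕ.+ i)) ≡ tail
    identity = begin
      E k + Σ< n (λ i → sign (suc (k ℕ.+ i)) * fromℕ ((k ℕ.+ i) C k) * E (k ℕ.+ i))
        ≡⟨ cong (E k +_) (trans
             (Σ-cong n λ i → solve 3 (λ s c x → (con (- 1ℚ) :* s) :* c :* x := :- (c :* (s :* x))) refl
               (sign (k ℕ.+ i)) (fromℕ ((k ℕ.+ i) C k)) (E (k ℕ.+ i)))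
             (Σ-neg n (λ i → T (k ℕ.+ i)))) ⟩
      E k - body
        -- This length exceeds N and splits into three ranges: j < k, where the binomials vanish,
        -- then `body`, then `tail`.
        ≡⟨ cong (_- body) (sym (reflection (k ℕ.+ n ℕ.+ suc N) (ℕ.m≤n+m (suc N) (k ℕ.+ n)) k)) ⟩
      Σ< (k ℕ.+ n ℕ.+ suc N) T - body
        ≡⟨ cong (_- body) (trans (Σ-split (k ℕ.+ n) (suc N) T) (cong (_+ tail) (trans (Σ-split k n T)
             (cong (_+ body) (Σ-zero k λ j j<k → trans (cong (λ c → fromℕ c * (sign j * E j)) (k>n⇒nCk≡0 j<k)) (ℚ.*-zeroˡ (sign j * E j))))))) ⟩
      ((0ℚ + body) + tail) - body
        ≡⟨ solve 2 (λ b t → ((con 0ℚ :+ b) :+ t) :- b := t) refl body tail ⟩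
      tail ∎

-- Elements of the ideal satisfy the congruence

eventually-map : ∀ {P Q : ℕ → Set} → (∀ {p} → Prime p → P p → Q p) → ForAllLargePrimes P → ForAllLargePrimes Q
eventually-map P⇒Q (N , P-large) = N , λ p N<p p-prime → P⇒Q p-prime (P-large p N<p p-prime)

eventually-map₂ : ∀ {P Q R : ℕ → Set} → (∀ {p} → Prime p → P p → Q p → R p) →
  ForAllLargePrimes P → ForAllLargePrimes Q → ForAllLargePrimes R
eventually-map₂ PQ⇒R (M , P-large) (N , Q-large) = M ℕ.⊔ N , λ p large p-prime → PQ⇒R p-prime
  (P-large p (ℕ.≤-<-trans (ℕ.m≤m⊔n M N) large) p-prime)
  (Q-large p (ℕ.≤-<-trans (ℕ.m≤n⊔m M N) large) p-prime)

record ValueMod (n : ℕ) (f : Series) (p : ℕ) : Set where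
  constructor valueMod
  field
    {val}     : ℚ
    evaluated : EvaluatesTo (harmonicPoint p) f val
    congruent : Mod p n val

module _ {p : ℕ} (p-prime : Prime p) where
  open Localization p-prime

  valueMod-⊕ : ∀ {n f g} → ValueMod n f p → ValueMod n g p → ValueMod n (f ⊕ g) p
  valueMod-⊕ (valueMod ev q≡0) (valueMod ev′ r≡0) = valueMod (evaluates-⊕ ev ev′) (mod-+ q≡0 r≡0)

  valueMod-⊛ : ∀ {m n f g} → ValueMod m f p → ValueMod n g p → ValueMod (m ℕ.+ n) (f ⊛ g) p
  valueMod-⊛ (valueMod ev q≡0) (valueMod ev′ r≡0) = valueMod (evaluates-⊛ ev ev′) (mod-* q≡0 r≡0)

  valueMod-resp : ∀ {n f g} → f ≈ g → ValueMod n f p → ValueMod n g p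
  valueMod-resp f≈g (valueMod ev q≡0) = valueMod (evaluates-resp f≈g ev) q≡0

  valueMod-≤ : ∀ {m n f} → m ℕ.≤ n → ValueMod n f p → ValueMod m f p
  valueMod-≤ m≤n (valueMod ev q≡0) = valueMod ev (mod-≤ m≤n q≡0)

  valueMod-zero : ∀ {n} → ValueMod n 0ˢ p
  valueMod-zero = valueMod evaluates-zero mod-zero

eventually-⊕ : ∀ {n f g} → ForAllLargePrimes (ValueMod n f) → ForAllLargePrimes (ValueMod n g) →
  ForAllLargePrimes (ValueMod n (f ⊕ g))
eventually-⊕ = eventually-map₂ λ p-prime → valueMod-⊕ p-prime

eventually-⊛ : ∀ {m n f g} → ForAllLargePrimes (ValueMod m f) → ForAllLargePrimes (ValueMod n g) →
  ForAllLargePrimes (ValueMod (m ℕ.+ n) (f ⊛ g))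
eventually-⊛ = eventually-map₂ λ p-prime → valueMod-⊛ p-prime

eventually-zero : ∀ {n} → ForAllLargePrimes (ValueMod n 0ˢ)
eventually-zero = 0 , λ p _ p-prime → valueMod-zero p-prime

eventually-∑ˢ : ∀ {n} K {F : Fin K → Series} → (∀ k → ForAllLargePrimes (ValueMod n (F k))) →
  ForAllLargePrimes (ValueMod n (∑ˢ K F))
eventually-∑ˢ zero    ev = eventually-zero
eventually-∑ˢ (suc K) ev = eventually-⊕ (ev Fin.zero) (eventually-∑ˢ K (ev ∘ Fin.suc))

eventually-constant : ∀ c → ForAllLargePrimes (ValueMod 0 (constant c))
eventually-constant c = ↧ₙ c , λ p large p-prime → let open Localization p-prime in
  valueMod (evaluates-constant c) (integral-mod {c} (∤-< {↧ₙ c} (s≤s z≤n) large))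

eventually-elementary : ∀ k → ForAllLargePrimes (ValueMod (suc k ℕ.+ 1) (elementary (suc k)))
-- For p > k + 2 the complementary degree p - 1 - (k + 1) is positive, as the additional factor p
-- requires.
eventually-elementary k = suc (suc k) , λ where
  (suc N) (s≤s k<N) p-prime → let
      open HarmonicPoint p-prime (s≤s (ℕ.≤-trans (s≤s (s≤s z≤n)) k<N)) using (mod-E-suc)
      r = N ∸ suc (suc k)
    in valueMod (evaluates-elementary (suc k))
      (subst (λ j → Mod (suc N) j (esym (suc k) (toList (harmonicPoint (suc N))))) (ℕ.+-comm 1 (suc k))
        (mod-E-suc k r (trans (ℕ.+-suc (suc k) r) (ℕ.m+[n∸m]≡n k<N))))

eventually-homogeneous : ∀ {m f} → Homogeneous m f → ForAllLargePrimes (ValueMod m f)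
eventually-homogeneous (scalar c)     = eventually-constant c
eventually-homogeneous (gen k)        = eventually-elementary k
eventually-homogeneous zero           = eventually-zero
eventually-homogeneous (add f g)      = eventually-⊕ (eventually-homogeneous f) (eventually-homogeneous g)
eventually-homogeneous (mul f g)      = eventually-⊛ (eventually-homogeneous f) (eventually-homogeneous g)
eventually-homogeneous (resp f≈g f)   =
  eventually-map (λ p-prime → valueMod-resp p-prime f≈g) (eventually-homogeneous f)

elementary-zero : constant 1ℚ ≈ elementary 0
elementary-zero []                = refl
elementary-zero (zero ∷ α)        = trans (elementary-zero α) (sym (elementary-pad 0 α))
elementary-zero (suc zero ∷ α)    = sym (elementary-one-zero α)
elementary-zero (suc (suc a) ∷ α) = refl

eventually-integral : ∀ t → ForAllLargePrimes (ValueMod 0 ⟦ t ⟧)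
eventually-integral (con c)        = eventually-constant c
eventually-integral (elem zero)    =
  eventually-map (λ p-prime → valueMod-resp p-prime elementary-zero) (eventually-constant 1ℚ)
eventually-integral (elem (suc k)) = eventually-map (λ p-prime → valueMod-≤ p-prime z≤n) (eventually-elementary k)
eventually-integral (s ⊞ t)        = eventually-⊕ (eventually-integral s) (eventually-integral t)
eventually-integral (s ⊠ t)        = eventually-⊛ (eventually-integral s) (eventually-integral t)

-- The condition v(f) ≥ n only says that low components are not non-zero. Equality of series is not
-- decided here, but equality of each coefficient is, and that recovers their vanishing.
≈0-stable : ∀ {f} → ¬ ¬ (f ≈ 0ˢ) → f ≈ 0ˢ
≈0-stable {f} ¬¬f≈0 α = decidable-stable (f α ℚ.≟ 0ℚ) λ fα≢0 → ¬¬f≈0 λ f≈0 → fα≢0 (f≈0 α)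

eventually-𝓘 : ∀ {n f} → f ∈𝓘 n → ForAllLargePrimes (ValueMod n f)
eventually-𝓘 {n} {f} (D , v≥n) =
  eventually-map (λ p-prime → valueMod-resp p-prime λ α → sym (decomposes α)) (eventually-∑ˢ (suc top) λ k → part (toℕ k))
  where
  open HDecomposition D
  part : ∀ m → ForAllLargePrimes (ValueMod n (component m))
  part m with n ℕ.≤? m
  ... | yes n≤m = eventually-map (λ p-prime → valueMod-≤ p-prime n≤m) (eventually-homogeneous (homogeneous m))
  ... | no  n≰m = eventually-map
    (λ p-prime → valueMod-resp p-prime λ α → sym (≈0-stable (n≰m ∘ v≥n m) α)) eventually-zero

eventually-β : ∀ n k → ForAllLargePrimes (ValueMod n (β n k))
eventually-β n k = 2 , λ where
  (suc N) 2<p p-prime → valueMod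
    (evaluates-⊕ (evaluates-elementary k) (evaluates-Σ n λ i → evaluates-⊛
      (evaluates-constant (sign (suc (k ℕ.+ i)) * fromℕ ((k ℕ.+ i) C k))) (evaluates-elementary (k ℕ.+ i))))
    (HarmonicPoint.mod-β p-prime 2<p n k)

eventually-I : ∀ {n} f → f ∈I[ n ] → ForAllLargePrimes (ValueMod n (Λ.series f))
eventually-I {n} f (K , g , rest∈𝓘) = eventually-map
  (λ p-prime → valueMod-resp p-prime λ α →
    solve 2 (λ x y → (x :- y) :+ y := x) refl (Λ.series f α) (∑ˢ K (λ k → Λ.series (g k) ⊛ β n (toℕ k)) α))
  (eventually-⊕ (eventually-𝓘 rest∈𝓘) (eventually-∑ˢ K λ k → eventually-⊛ (integral k) (eventually-β n (toℕ k))))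
  where
  open ℚSolver.+-*-Solver using (solve; _:=_; _:+_; _:-_)
  -- An expression of `g k` in the e_j contains finitely many rational constants, so its values are
  -- p-integral for all large p.
  integral : ∀ k → ForAllLargePrimes (ValueMod 0 (Λ.series (g k)))
  integral k with t , gₖ≈t ← fundamental (g k) =
    eventually-map (λ p-prime → valueMod-resp p-prime λ α → sym (gₖ≈t α)) (eventually-integral t)

Λ-evaluates : ∀ {N} (f : Λ) (xs : Vec ℚ N) → EvaluatesTo xs (Λ.series f) (f ⟨ xs ⟩)
Λ-evaluates f xs = evaluates (Λ.bound f) (Λ.bounded f) refl

sufficient : ∀ f n → f ∈I[ n ] → ForAllLargePrimes (λ p → f ⟨ harmonicPoint p ⟩ ≡0[mod p ^ n ])
sufficient f n f∈I = eventually-map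
  (λ {p} p-prime (valueMod ev q≡0) → fromMod (Localization.mod-resp p-prime
    (evaluates-unique ev (Λ-evaluates f (harmonicPoint p))) q≡0))
  (eventually-I f f∈I)

-- The ideal in terms of expressions

-- Membership in 𝓘 n by rules, so that closure under multiplication is an induction; `filtered⇒𝓘`
-- assembles the decomposition at the end.
data Filtered (n : ℕ) : Series → Set where
  above : ∀ {m f} → n ℕ.≤ m → Homogeneous m f → Filtered n f
  add         : ∀ {f g} → Filtered n f → Filtered n g → Filtered n (f ⊕ g)
  resp    : ∀ {f g} → f ≈ g → Filtered n f → Filtered n g

Σ-single : ∀ n k → k ℕ.< n → (F : ℕ → ℚ) → (∀ i → i ≢ k → F i ≡ 0ℚ) → Σ< n F ≡ F k
Σ-single (suc n) zero    _         F F≡0 = trans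
  (cong (F 0 +_) (Σ-zero n λ i _ → F≡0 (suc i) λ ())) (ℚ.+-identityʳ (F 0))
Σ-single (suc n) (suc k) (s≤s k<n) F F≡0 = trans
  (cong₂ _+_ (F≡0 0 λ ()) (Σ-single n k k<n (F ∘ suc) λ i i≢k → F≡0 (suc i) (i≢k ∘ ℕ.suc-injective)))
  (ℚ.+-identityˡ (F (suc k)))

homogeneous⇒𝓘 : ∀ {n m f} → n ℕ.≤ m → Homogeneous m f → f ∈𝓘 n
homogeneous⇒𝓘 {n} {m} {f} n≤m f-homogeneous = record
  { component   = part
  ; homogeneous = part-homogeneous
  ; top         = m
  ; finite      = λ i m<i → part≢ i (ℕ.>⇒≢ m<i)
  ; decomposes  = λ α → sym (trans
      (Σ-single (suc m) m (ℕ.n<1+n m) (λ i → part i α) (λ i i≢m → part≢ i i≢m α)) (part≡ m refl α)) } ,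
  λ i part≢0 → subst (n ℕ.≤_) (sym (decidable-stable (i ℕ.≟ m) (part≢0 ∘ part≢ i))) n≤m
  where
  part : ℕ → Series
  part i = if does (i ℕ.≟ m) then f else 0ˢ
  part≡ : ∀ i → i ≡ m → part i ≈ f
  part≡ i i≡m α = cong (λ b → (if b then f else 0ˢ) α) (dec-true (i ℕ.≟ m) i≡m)
  part≢ : ∀ i → i ≢ m → part i ≈ 0ˢ
  part≢ i i≢m α = cong (λ b → (if b then f else 0ˢ) α) (dec-false (i ℕ.≟ m) i≢m)
  part-homogeneous : ∀ i → Homogeneous i (part i)
  part-homogeneous i with i ℕ.≟ m
  ... | yes refl = resp (λ α → sym (part≡ m refl α)) f-homogeneous
  ... | no  i≢m  = resp (λ α → sym (part≢ i i≢m α)) zero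

𝓘-⊕ : ∀ {n f g} → f ∈𝓘 n → g ∈𝓘 n → f ⊕ g ∈𝓘 n
𝓘-⊕ {n} (D , n≤D) (E , n≤E) = record
  { component   = λ i → D.component i ⊕ E.component i
  ; homogeneous = λ i → add (D.homogeneous i) (E.homogeneous i)
  ; top         = top
  ; finite      = λ i top<i α → cong₂ _+_
      (D.finite i (ℕ.≤-<-trans (ℕ.m≤m⊔n D.top E.top) top<i) α)
      (E.finite i (ℕ.≤-<-trans (ℕ.m≤n⊔m D.top E.top) top<i) α)
  ; decomposes  = λ α → sym (trans (Σ-+ (suc top) (λ i → D.component i α) (λ i → E.component i α))
      (cong₂ _+_
        (trans (Σ-extend-≤ (s≤s (ℕ.m≤m⊔n D.top E.top)) (λ i D<i → D.finite i D<i α)) (sym (D.decomposes α)))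
        (trans (Σ-extend-≤ (s≤s (ℕ.m≤n⊔m D.top E.top)) (λ i E<i → E.finite i E<i α)) (sym (E.decomposes α))))) } ,
  λ i ≢0 → decidable-stable (n ℕ.≤? i) λ n≰i → ≢0 λ α → cong₂ _+_
    (≈0-stable (n≰i ∘ n≤D i) α) (≈0-stable (n≰i ∘ n≤E i) α)
  where
  module D = HDecomposition D
  module E = HDecomposition E
  top = D.top ℕ.⊔ E.top

𝓘-resp : ∀ {n f g} → f ≈ g → f ∈𝓘 n → g ∈𝓘 n
𝓘-resp f≈g (D , n≤D) = record
  { component = component ; homogeneous = homogeneous ; top = top ; finite = finite
  ; decomposes = λ α → trans (sym (f≈g α)) (decomposes α) } , n≤D
  where open HDecomposition D

filtered⇒𝓘 : ∀ {n f} → Filtered n f → f ∈𝓘 n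
filtered⇒𝓘 (above n≤m h) = homogeneous⇒𝓘 n≤m h
filtered⇒𝓘 (add F G)     = 𝓘-⊕ (filtered⇒𝓘 F) (filtered⇒𝓘 G)
filtered⇒𝓘 (resp f≈g F)  = 𝓘-resp f≈g (filtered⇒𝓘 F)

filtered-zero : ∀ {n} → Filtered n 0ˢ
filtered-zero {n} = above ℕ.≤-refl zero

filtered-⊛ʰ : ∀ {n m f g} → Homogeneous m g → Filtered n f → Filtered n (g ⊛ f)
filtered-⊛ʰ {m = m} h (above {k} n≤k f) = above (ℕ.≤-trans n≤k (ℕ.m≤n+m k m)) (mul h f)
filtered-⊛ʰ h (add {f} {g} F G) =
  resp (S.sym (⊛-distribˡ-⊕ _ f g)) (add (filtered-⊛ʰ h F) (filtered-⊛ʰ h G))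
filtered-⊛ʰ h (resp f≈g F) = resp (⊛-cong (λ _ → refl) f≈g) (filtered-⊛ʰ h F)

filtered-⊛ : ∀ {n f} t → Filtered n f → Filtered n (⟦ t ⟧ ⊛ f)
filtered-⊛ (con c)        F = filtered-⊛ʰ (scalar c) F
filtered-⊛ (elem zero)    F = resp (⊛-cong elementary-zero (λ _ → refl)) (filtered-⊛ʰ (scalar 1ℚ) F)
filtered-⊛ (elem (suc k)) F = filtered-⊛ʰ (gen k) F
filtered-⊛ {f = f} (s ⊞ t) F = resp (S.sym (⊛-distribʳ-⊕ f ⟦ s ⟧ ⟦ t ⟧)) (add (filtered-⊛ s F) (filtered-⊛ t F))
filtered-⊛ {f = f} (s ⊠ t) F = resp (S.sym (⊛-assoc ⟦ s ⟧ ⟦ t ⟧ f)) (filtered-⊛ s (filtered-⊛ t F))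

-- Membership in I^{[n]} by rules. The bound `k < n` lets `ideal⇒combination` collect every element
-- into a combination of n generators.
data Ideal (n : ℕ) : Series → Set where
  filtered  : ∀ {f} → Filtered n f → Ideal n f
  generator : ∀ t k → k ℕ.< n → Ideal n (⟦ t ⟧ ⊛ β n k)
  add       : ∀ {f g} → Ideal n f → Ideal n g → Ideal n (f ⊕ g)
  resp  : ∀ {f g} → f ≈ g → Ideal n f → Ideal n g

combination : ℕ → (ℕ → Expr) → Series
combination n G α = Σ< n (λ k → (⟦ G k ⟧ ⊛ β n k) α)

combination-⊞ : ∀ n G H α → combination n (λ k → G k ⊞ H k) α ≡ combination n G α + combination n H α
combination-⊞ n G H α = trans (Σ-cong n λ k → ⊛-distribʳ-⊕ (β n k) ⟦ G k ⟧ ⟦ H k ⟧ α)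
  (Σ-+ n (λ k → (⟦ G k ⟧ ⊛ β n k) α) (λ k → (⟦ H k ⟧ ⊛ β n k) α))

combination-single : ∀ n t k → k ℕ.< n → ∃[ G ] combination n G ≈ ⟦ t ⟧ ⊛ β n k
combination-single n t k k<n = G , λ α → trans
  (Σ-single n k k<n (λ i → (⟦ G i ⟧ ⊛ β n i) α) λ i i≢k → trans
    (cong (λ b → (⟦ if b then t else con 0ℚ ⟧ ⊛ β n i) α) (dec-false (i ℕ.≟ k) i≢k))
    (trans (constant-⊛ 0ℚ (β n i) α) (ℚ.*-zeroˡ (β n i α))))
  (cong (λ b → (⟦ if b then t else con 0ℚ ⟧ ⊛ β n k) α) (dec-true (k ℕ.≟ k) refl))
  where
  G : ℕ → Expr
  G i = if does (i ℕ.≟ k) then t else con 0ℚ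

combination-zero : ∀ n → combination n (λ _ → con 0ℚ) ≈ 0ˢ
combination-zero n α = Σ-zero n λ k _ → trans (constant-⊛ 0ℚ (β n k) α) (ℚ.*-zeroˡ (β n k α))

Combination : ℕ → Series → Set
Combination n f = ∃[ G ] Filtered n (f ⊖ combination n G)

filtered⇒combination : ∀ {n f} → Filtered n f → Combination n f
filtered⇒combination {n} {f} F = (λ _ → con 0ℚ) , resp {f = f} {f ⊖ combination n (λ _ → con 0ℚ)}
  (λ α → sym (trans (cong (λ z → f α - z) (combination-zero n α)) (ℚ.+-identityʳ (f α)))) F

generator⇒combination : ∀ {n} t k → k ℕ.< n → Combination n (⟦ t ⟧ ⊛ β n k)
generator⇒combination {n} t k k<n = f-G (combination-single n t k k<n)
  where
  f = ⟦ t ⟧ ⊛ β n k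
  f-G : (∃[ G ] combination n G ≈ f) → Combination n f
  f-G (G , eq) = G , resp {f = 0ˢ} {f ⊖ combination n G}
    (λ α → sym (trans (cong (λ z → f α - z) (eq α)) (ℚ.+-inverseʳ (f α)))) filtered-zero

⊕-combination : ∀ {n} f g → Combination n f → Combination n g → Combination n (f ⊕ g)
⊕-combination {n} f g (G , F) (H , F′) = (λ k → G k ⊞ H k) ,
  resp {f = (f ⊖ combination n G) ⊕ (g ⊖ combination n H)} {(f ⊕ g) ⊖ combination n (λ k → G k ⊞ H k)}
    (λ α → trans
      (solve 4 (λ a b c d → (a :- c) :+ (b :- d) := (a :+ b) :- (c :+ d)) refl
        (f α) (g α) (combination n G α) (combination n H α))
      (cong (λ z → (f α + g α) - z) (sym (combination-⊞ n G H α))))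
    (add F F′)
  where open ℚSolver.+-*-Solver using (solve; _:=_; _:+_; _:-_)

resp-combination : ∀ {n} f g → f ≈ g → Combination n f → Combination n g
resp-combination {n} f g f≈g (G , F) =
  G , resp {f = f ⊖ combination n G} {g ⊖ combination n G} (λ α → cong (_- combination n G α) (f≈g α)) F

ideal⇒combination : ∀ {n f} → Ideal n f → Combination n f
ideal⇒combination (filtered F)          = filtered⇒combination F
ideal⇒combination (generator t k k<n)   = generator⇒combination t k k<n
ideal⇒combination (add {f} {g} I J)     = ⊕-combination f g (ideal⇒combination I) (ideal⇒combination J)
ideal⇒combination (resp {f} {g} f≈g I)  = resp-combination f g f≈g (ideal⇒combination I)

ideal⇒I : ∀ {n} f → Ideal n (Λ.series f) → f ∈I[ n ]
ideal⇒I {n} f I = n , (λ k → toΛ (proj₁ GF (toℕ k))) , filtered⇒𝓘 (proj₂ GF)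
  where GF = ideal⇒combination I

ideal-⊛ : ∀ {n f} t → Ideal n f → Ideal n (⟦ t ⟧ ⊛ f)
ideal-⊛ t (filtered F) = filtered (filtered-⊛ t F)
ideal-⊛ {n} t (generator s k k<n) = resp (⊛-assoc ⟦ t ⟧ ⟦ s ⟧ (β n k)) (generator (t ⊠ s) k k<n)
ideal-⊛ t (add {f} {g} I J) = resp (S.sym (⊛-distribˡ-⊕ ⟦ t ⟧ f g)) (add (ideal-⊛ t I) (ideal-⊛ t J))
ideal-⊛ t (resp f≈g I) = resp (⊛-cong {⟦ t ⟧} (λ _ → refl) f≈g) (ideal-⊛ t I)

eventually-filtered : ∀ {n f} → Filtered n f → ForAllLargePrimes (ValueMod n f)
eventually-filtered (above n≤m h) = eventually-map (λ p-prime → valueMod-≤ p-prime n≤m) (eventually-homogeneous h)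
eventually-filtered (add F G)           = eventually-⊕ (eventually-filtered F) (eventually-filtered G)
eventually-filtered (resp f≈g F)    = eventually-map (λ p-prime → valueMod-resp p-prime f≈g) (eventually-filtered F)

eventually-ideal : ∀ {n f} → Ideal n f → ForAllLargePrimes (ValueMod n f)
eventually-ideal (filtered F)            = eventually-filtered F
eventually-ideal {n} (generator t k k<n) = eventually-⊛ (eventually-integral t) (eventually-β n k)
eventually-ideal (add I J)               = eventually-⊕ (eventually-ideal I) (eventually-ideal J)
eventually-ideal (resp f≈g I)        = eventually-map (λ p-prime → valueMod-resp p-prime f≈g) (eventually-ideal I)

infix 4 _∼[_]_

_∼[_]_ : Expr → ℕ → Expr → Set
s ∼[ n ] t = Ideal n (⟦ s ⟧ ⊖ ⟦ t ⟧)

≈⇒∼ : ∀ {n} s t → ⟦ s ⟧ ≈ ⟦ t ⟧ → s ∼[ n ] t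
≈⇒∼ s t s≈t = filtered (resp
  (λ α → sym (trans (cong (_- ⟦ t ⟧ α) (s≈t α)) (ℚ.+-inverseʳ (⟦ t ⟧ α)))) filtered-zero)

∼-trans : ∀ {n} r s t → r ∼[ n ] s → s ∼[ n ] t → r ∼[ n ] t
∼-trans r s t I J = resp
  (λ α → solve 3 (λ x y z → (x :- y) :+ (y :- z) := x :- z) refl (⟦ r ⟧ α) (⟦ s ⟧ α) (⟦ t ⟧ α)) (add I J)
  where open ℚSolver.+-*-Solver using (solve; _:=_; _:+_; _:-_)

∼-⊞ : ∀ {n} s s′ t t′ → s ∼[ n ] s′ → t ∼[ n ] t′ → s ⊞ t ∼[ n ] s′ ⊞ t′
∼-⊞ s s′ t t′ I J = resp
  (λ α → solve 4 (λ x x′ y y′ → (x :- x′) :+ (y :- y′) := (x :+ y) :- (x′ :+ y′)) refl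
    (⟦ s ⟧ α) (⟦ s′ ⟧ α) (⟦ t ⟧ α) (⟦ t′ ⟧ α)) (add I J)
  where open ℚSolver.+-*-Solver using (solve; _:=_; _:+_; _:-_)

⊛-⊖ : ∀ h f g α → (h ⊛ (f ⊖ g)) α ≡ (h ⊛ f) α - (h ⊛ g) α
⊛-⊖ h f g α = trans
  (solve 2 (λ x y → x := (x :+ y) :- y) refl ((h ⊛ (f ⊖ g)) α) ((h ⊛ g) α))
  (cong (_- (h ⊛ g) α) (trans (sym (⊛-distribˡ-⊕ h (f ⊖ g) g α))
    (⊛-cong {h} (λ _ → refl) (λ γ → solve 2 (λ x y → (x :- y) :+ y := x) refl (f γ) (g γ)) α)))
  where open ℚSolver.+-*-Solver using (solve; _:=_; _:+_; _:-_)

-- Write s t - s′ t′ as s (t - t′) + t′ (s - s′).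
∼-⊠ : ∀ {n} s s′ t t′ → s ∼[ n ] s′ → t ∼[ n ] t′ → s ⊠ t ∼[ n ] s′ ⊠ t′
∼-⊠ s s′ t t′ I J = resp
  (λ α → trans
    (cong₂ _+_ (⊛-⊖ ⟦ s ⟧ ⟦ t ⟧ ⟦ t′ ⟧ α)
      (trans (⊛-⊖ ⟦ t′ ⟧ ⟦ s ⟧ ⟦ s′ ⟧ α) (cong₂ _-_ (⊛-comm ⟦ t′ ⟧ ⟦ s ⟧ α) (⊛-comm ⟦ t′ ⟧ ⟦ s′ ⟧ α))))
    (solve 3 (λ x y z → (x :- y) :+ (y :- z) := x :- z) refl
      ((⟦ s ⟧ ⊛ ⟦ t ⟧) α) ((⟦ s ⟧ ⊛ ⟦ t′ ⟧) α) ((⟦ s′ ⟧ ⊛ ⟦ t′ ⟧) α)))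
  (add (ideal-⊛ s J) (ideal-⊛ t′ I))
  where open ℚSolver.+-*-Solver using (solve; _:=_; _:+_; _:-_)

-- Reduction to polynomials in the even e_k

Terms : ℕ → Set
Terms m = List (ℚ × Vec ℕ m)

pow : Expr → ℕ → Expr
pow s zero    = con 1ℚ
pow s (suc a) = s ⊠ pow s a

monomialExpr : ∀ {m} → (ℕ → Expr) → Vec ℕ m → Expr
monomialExpr u []      = con 1ℚ
monomialExpr u (a ∷ α) = pow (u 0) a ⊠ monomialExpr (u ∘ suc) α

termsExpr : ∀ {m} → (ℕ → Expr) → Terms m → Expr
termsExpr u []            = con 0ℚ
termsExpr u ((c , α) ∷ L) = (con c ⊠ monomialExpr u α) ⊞ termsExpr u L

-- Every reading of a list of terms has this shape: its value at a point, the coefficients of its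
-- series and its collected coefficients differ only in `F`.
linear : ∀ {m} → (Vec ℕ m → ℚ) → Terms m → ℚ
linear F []            = 0ℚ
linear F ((c , α) ∷ L) = c * F α + linear F L

termsExpr-linear : ∀ {m} u (L : Terms m) γ → ⟦ termsExpr u L ⟧ γ ≡ linear (λ α → ⟦ monomialExpr u α ⟧ γ) L
termsExpr-linear u []            γ = constant-zero γ
  where
  constant-zero : constant 0ℚ ≈ 0ˢ
  constant-zero γ with does (degree γ ℕ.≟ 0)
  ... | true  = refl
  ... | false = refl
termsExpr-linear u ((c , α) ∷ L) γ =
  cong₂ _+_ (constant-⊛ c ⟦ monomialExpr u α ⟧ γ) (termsExpr-linear u L γ)

linear-++ : ∀ {m} (F : Vec ℕ m → ℚ) L K → linear F (L ++ K) ≡ linear F L + linear F K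
linear-++ F []            K = sym (ℚ.+-identityˡ (linear F K))
linear-++ F ((c , α) ∷ L) K = trans (cong (c * F α +_) (linear-++ F L K)) (sym (ℚ.+-assoc (c * F α) (linear F L) (linear F K)))

pow-+ : ∀ s a b → ⟦ pow s (a ℕ.+ b) ⟧ ≈ ⟦ pow s a ⟧ ⊛ ⟦ pow s b ⟧
pow-+ s zero    b = S.sym (S.*-identityˡ ⟦ pow s b ⟧)
pow-+ s (suc a) b = S.trans (⊛-cong {⟦ s ⟧} (λ _ → refl) (pow-+ s a b)) (S.sym (⊛-assoc ⟦ s ⟧ ⟦ pow s a ⟧ ⟦ pow s b ⟧))

⊛-interchange : ∀ f g h k → (f ⊛ g) ⊛ (h ⊛ k) ≈ (f ⊛ h) ⊛ (g ⊛ k)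
⊛-interchange f g h k = interchange f g h k
  where open import Algebra.Properties.CommutativeSemigroup S.*-commutativeSemigroup using (interchange)

monomialExpr-+ : ∀ {m} u (α γ : Vec ℕ m) →
  ⟦ monomialExpr u (Vec.zipWith ℕ._+_ α γ) ⟧ ≈ ⟦ monomialExpr u α ⟧ ⊛ ⟦ monomialExpr u γ ⟧
monomialExpr-+ u []      []      = S.sym (S.*-identityˡ (constant 1ℚ))
monomialExpr-+ u (a ∷ α) (c ∷ γ) = S.trans
  (⊛-cong (pow-+ (u 0) a c) (monomialExpr-+ (u ∘ suc) α γ))
  (⊛-interchange ⟦ pow (u 0) a ⟧ ⟦ pow (u 0) c ⟧ ⟦ monomialExpr (u ∘ suc) α ⟧ ⟦ monomialExpr (u ∘ suc) γ ⟧)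

scaleTerms : ∀ {m} → ℚ → Vec ℕ m → Terms m → Terms m
scaleTerms c α = map λ (d , γ) → c * d , Vec.zipWith ℕ._+_ α γ

scaleTerms-⟦⟧ : ∀ {m} u c (α : Vec ℕ m) L →
  ⟦ termsExpr u (scaleTerms c α L) ⟧ ≈ ⟦ con c ⊠ monomialExpr u α ⟧ ⊛ ⟦ termsExpr u L ⟧
scaleTerms-⟦⟧ u c α [] = S.sym (S.trans (⊛-comm ⟦ con c ⊠ monomialExpr u α ⟧ (constant 0ℚ))
  λ γ → trans (constant-⊛ 0ℚ ⟦ con c ⊠ monomialExpr u α ⟧ γ)
    (trans (ℚ.*-zeroˡ (⟦ con c ⊠ monomialExpr u α ⟧ γ)) (sym (termsExpr-linear {0} u [] γ))))
scaleTerms-⟦⟧ u c α ((d , γ) ∷ L) = S.trans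
  (λ δ → cong₂ _+_ (head δ) (scaleTerms-⟦⟧ u c α L δ))
  (S.sym (⊛-distribˡ-⊕ ⟦ con c ⊠ monomialExpr u α ⟧ ⟦ con d ⊠ monomialExpr u γ ⟧ ⟦ termsExpr u L ⟧))
  where
  head : constant (c * d) ⊛ ⟦ monomialExpr u (Vec.zipWith ℕ._+_ α γ) ⟧ ≈
    ⟦ con c ⊠ monomialExpr u α ⟧ ⊛ ⟦ con d ⊠ monomialExpr u γ ⟧
  head = S.trans
    (⊛-cong {constant (c * d)} (λ δ → trans (constant-* δ) (sym (constant-⊛ c (constant d) δ))) (monomialExpr-+ u α γ))
    (⊛-interchange (constant c) (constant d) ⟦ monomialExpr u α ⟧ ⟦ monomialExpr u γ ⟧)
    where
    constant-* : ∀ δ → constant (c * d) δ ≡ c * constant d δ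
    constant-* δ with does (degree δ ℕ.≟ 0)
    ... | true  = refl
    ... | false = sym (ℚ.*-zeroʳ c)

multiplyTerms : ∀ {m} → Terms m → Terms m → Terms m
multiplyTerms []            K = []
multiplyTerms ((c , α) ∷ L) K = scaleTerms c α K ++ multiplyTerms L K

++-⟦⟧ : ∀ {m} u (L K : Terms m) → ⟦ termsExpr u (L ++ K) ⟧ ≈ ⟦ termsExpr u L ⟧ ⊕ ⟦ termsExpr u K ⟧
++-⟦⟧ u L K γ = trans (termsExpr-linear u (L ++ K) γ) (trans (linear-++ (λ α → ⟦ monomialExpr u α ⟧ γ) L K)
  (sym (cong₂ _+_ (termsExpr-linear u L γ) (termsExpr-linear u K γ))))

multiplyTerms-⟦⟧ : ∀ {m} u (L K : Terms m) →
  ⟦ termsExpr u (multiplyTerms L K) ⟧ ≈ ⟦ termsExpr u L ⟧ ⊛ ⟦ termsExpr u K ⟧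
multiplyTerms-⟦⟧ u []            K = λ γ → trans (termsExpr-linear {0} u [] γ)
  (sym (trans (constant-⊛ 0ℚ ⟦ termsExpr u K ⟧ γ) (ℚ.*-zeroˡ (⟦ termsExpr u K ⟧ γ))))
multiplyTerms-⟦⟧ u ((c , α) ∷ L) K γ = trans (++-⟦⟧ u (scaleTerms c α K) (multiplyTerms L K) γ)
  (trans (cong₂ _+_ (scaleTerms-⟦⟧ u c α K γ) (multiplyTerms-⟦⟧ u L K γ))
    (sym (⊛-distribʳ-⊕ ⟦ termsExpr u K ⟧ ⟦ con c ⊠ monomialExpr u α ⟧ ⟦ termsExpr u L ⟧ γ)))

zeroVec : ∀ m → Vec ℕ m
zeroVec m = Vec.replicate m 0

monomialExpr-zero : ∀ m u → ⟦ monomialExpr u (zeroVec m) ⟧ ≈ constant 1ℚ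
monomialExpr-zero zero    u = S.refl
monomialExpr-zero (suc m) u = S.trans (S.*-identityˡ ⟦ monomialExpr (u ∘ suc) (zeroVec m) ⟧) (monomialExpr-zero m (u ∘ suc))

unitVec : ∀ {m i} → i ℕ.< m → Vec ℕ m
unitVec {suc m} {zero}  _         = 1 ∷ zeroVec m
unitVec {suc m} {suc i} (s≤s i<m) = 0 ∷ unitVec i<m

monomialExpr-unit : ∀ {m i} u (i<m : i ℕ.< m) → ⟦ monomialExpr u (unitVec i<m) ⟧ ≈ ⟦ u i ⟧
monomialExpr-unit {suc m} {zero}  u _         = S.trans
  (⊛-cong (S.*-identityʳ ⟦ u 0 ⟧) (monomialExpr-zero m (u ∘ suc))) (S.*-identityʳ ⟦ u 0 ⟧)
monomialExpr-unit {suc m} {suc i} u (s≤s i<m) = S.trans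
  (S.*-identityˡ ⟦ monomialExpr (u ∘ suc) (unitVec i<m) ⟧) (monomialExpr-unit (u ∘ suc) i<m)

term-⟦⟧ : ∀ {m} u c (α : Vec ℕ m) → ⟦ termsExpr u ((c , α) ∷ []) ⟧ ≈ ⟦ con c ⊠ monomialExpr u α ⟧
term-⟦⟧ u c α γ = trans (cong (⟦ con c ⊠ monomialExpr u α ⟧ γ +_) (termsExpr-linear {0} u [] γ))
  (ℚ.+-identityʳ (⟦ con c ⊠ monomialExpr u α ⟧ γ))

-- The value of this multiple of e_{2j+2} at (p/1, …, p/(p-1)) is congruent
-- to p^{2j+3} B_{p-2j-3} modulo p^{2j+4}.
evenGenerator : ℕ → Expr
evenGenerator j = con (- fromℕ (3 ℕ.+ 2 ℕ.* j)) ⊠ elem (2 ℕ.+ 2 ℕ.* j)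

evenExpr : ∀ {m} → Terms m → Expr
evenExpr = termsExpr evenGenerator

-- The n generators e_2, e_4, ..., e_{2n} suffice, since every e_k with k ≥ n and k ≥ 1 lies in 𝓘 n.
-- Thus n also serves as the number of variables in the conjecture.
Reducible : ℕ → Expr → Set
Reducible n s = Σ (Terms n) λ L → s ∼[ n ] evenExpr L

reducible-∼ : ∀ {n} s t → s ∼[ n ] t → Reducible n t → Reducible n s
reducible-∼ s t s∼t (L , t∼L) = L , ∼-trans s t (evenExpr L) s∼t t∼L

reducible-⊞ : ∀ {n} s t → Reducible n s → Reducible n t → Reducible n (s ⊞ t)
reducible-⊞ s t (L , s∼L) (K , t∼K) = L ++ K , ∼-trans (s ⊞ t) (evenExpr L ⊞ evenExpr K) (evenExpr (L ++ K))
  (∼-⊞ s (evenExpr L) t (evenExpr K) s∼L t∼K)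
  (≈⇒∼ (evenExpr L ⊞ evenExpr K) (evenExpr (L ++ K)) (S.sym (++-⟦⟧ evenGenerator L K)))

reducible-⊠ : ∀ {n} s t → Reducible n s → Reducible n t → Reducible n (s ⊠ t)
reducible-⊠ s t (L , s∼L) (K , t∼K) = multiplyTerms L K ,
  ∼-trans (s ⊠ t) (evenExpr L ⊠ evenExpr K) (evenExpr (multiplyTerms L K))
    (∼-⊠ s (evenExpr L) t (evenExpr K) s∼L t∼K)
    (≈⇒∼ (evenExpr L ⊠ evenExpr K) (evenExpr (multiplyTerms L K)) (S.sym (multiplyTerms-⟦⟧ evenGenerator L K)))

reducible-con : ∀ n c → Reducible n (con c)
reducible-con n c = (c , zeroVec n) ∷ [] , ≈⇒∼ (con c) (evenExpr ((c , zeroVec n) ∷ []))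
  (S.sym (S.trans (term-⟦⟧ evenGenerator c (zeroVec n))
    (S.trans (⊛-cong {constant c} (λ _ → refl) (monomialExpr-zero n evenGenerator)) (S.*-identityʳ (constant c)))))

reducible-filtered : ∀ {n} s → Filtered n ⟦ s ⟧ → Reducible n s
reducible-filtered s F = [] , filtered (resp
  (λ α → sym (trans (cong (λ z → ⟦ s ⟧ α - z) (termsExpr-linear {0} evenGenerator [] α)) (ℚ.+-identityʳ (⟦ s ⟧ α)))) F)

reducible-even : ∀ n j → j ℕ.< n → Reducible n (elem (2 ℕ.+ 2 ℕ.* j))
reducible-even n j j<n = (c , unitVec j<n) ∷ [] , ≈⇒∼ (elem k) (evenExpr ((c , unitVec j<n) ∷ []))
  (S.sym (S.trans (term-⟦⟧ evenGenerator c (unitVec j<n)) (S.trans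
    (⊛-cong {constant c} (λ _ → refl) (monomialExpr-unit evenGenerator j<n))
    λ α → trans (constant-⊛ c ⟦ evenGenerator j ⟧ α) (trans (cong (c *_) (constant-⊛ (- N) (elementary k) α)) (cancel (elementary k α))))))
  where
  k = 2 ℕ.+ 2 ℕ.* j
  N = fromℕ (3 ℕ.+ 2 ℕ.* j)
  r = ℤ.1ℤ / (3 ℕ.+ 2 ℕ.* j)
  c = - r
  cancel : ∀ x → c * (- N * x) ≡ x
  cancel x = trans (solve 3 (λ r n x → (:- r) :* ((:- n) :* x) := (n :* r) :* x) refl r N x)
    (trans (cong (_* x) (fromℕ-*-/ ℤ.1ℤ (3 ℕ.+ 2 ℕ.* j))) (ℚ.*-identityˡ x))
    where open ℚSolver.+-*-Solver using (solve; _:=_; _:*_; :-_)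

sumExpr : ℕ → (ℕ → Expr) → Expr
sumExpr zero    F = con 0ℚ
sumExpr (suc n) F = F 0 ⊞ sumExpr n (F ∘ suc)

sumExpr-⟦⟧ : ∀ n F α → ⟦ sumExpr n F ⟧ α ≡ Σ< n (λ i → ⟦ F i ⟧ α)
sumExpr-⟦⟧ zero    F α = termsExpr-linear {0} evenGenerator [] α
sumExpr-⟦⟧ (suc n) F α = cong (⟦ F 0 ⟧ α +_) (sumExpr-⟦⟧ n (F ∘ suc) α)

reducible-sum : ∀ {n} m F → (∀ i → Reducible n (F i)) → Reducible n (sumExpr m F)
reducible-sum zero    F red = reducible-con _ 0ℚ
reducible-sum (suc m) F red = reducible-⊞ (F 0) (sumExpr m (F ∘ suc)) (red 0) (reducible-sum m (F ∘ suc) (red ∘ suc))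

-- For odd k the generator β n k is 2 e_k plus a combination of later e_j.
odd-∼ : ∀ n k → k ℕ.< suc n → sign (suc k) ≡ 1ℚ →
  let c = λ i → sign (suc (k ℕ.+ suc i)) * fromℕ ((k ℕ.+ suc i) C k) in
  elem k ∼[ suc n ] con ℚ.-½ ⊠ sumExpr n (λ i → con (c i) ⊠ elem (k ℕ.+ suc i))
odd-∼ n k k<n odd = resp
  (λ α → trans (constant-⊛ ℚ.½ (β (suc n) k) α) (trans
    (cong₂ (λ x y → ℚ.½ * (elementary k α + (x + y)))
      (trans (constant-⊛ (sign (suc (k ℕ.+ 0)) * fromℕ ((k ℕ.+ 0) C k)) (elementary (k ℕ.+ 0)) α)
        (trans (cong (λ j → sign (suc j) * fromℕ (j C k) * elementary j α) (ℕ.+-identityʳ k))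
          (cong₂ (λ s c → s * fromℕ c * elementary k α) odd (nCn≡1 k))))
      (sym (sumExpr-⟦⟧ n later α)))
    (trans (solve 2 (λ e s → con ℚ.½ :* (e :+ (con 1ℚ :* con 1ℚ :* e :+ s)) := e :- con ℚ.-½ :* s) refl
        (elementary k α) (⟦ sumExpr n later ⟧ α))
      (cong (λ z → elementary k α - z) (sym (constant-⊛ ℚ.-½ ⟦ sumExpr n later ⟧ α))))))
  (generator (con ℚ.½) k k<n)
  where
  open ℚSolver.+-*-Solver using (solve; con; _:=_; _:+_; _:*_; _:-_)
  later : ℕ → Expr
  later i = Expr.con (sign (suc (k ℕ.+ suc i)) * fromℕ ((k ℕ.+ suc i) C k)) ⊠ elem (k ℕ.+ suc i)

data Parity : ℕ → Set where
  is-zero : Parity 0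
  is-even : ∀ j → Parity (2 ℕ.+ 2 ℕ.* j)
  is-odd  : ∀ k → sign (suc (suc k)) ≡ 1ℚ → Parity (suc k)

parity-view : ∀ k → Parity k
parity-view zero          = is-zero
parity-view (suc zero)    = is-odd 0 refl
parity-view (suc (suc k)) with parity-view k
... | is-zero      = is-even 0
... | is-even j    = subst Parity (cong (2 ℕ.+_) (ℕ.*-suc 2 j)) (is-even (suc j))
... | is-odd k odd = is-odd (suc (suc k)) (trans
  (solve 1 (λ s → con (- 1ℚ) :* (con (- 1ℚ) :* s) := s) refl (sign (suc (suc k)))) odd)
  where open ℚSolver.+-*-Solver using (solve; con; _:=_; _:*_)

elementary-filtered : ∀ {n} k → n ℕ.≤ suc k → Filtered n (elementary (suc k))
elementary-filtered k n≤k = above (ℕ.≤-trans n≤k (ℕ.m≤m+n (suc k) 1)) (gen k)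

-- For odd k, e_k is replaced by a combination of e_j with j > k, among which odd ones may reappear.
-- The distance `d` from k to n decreases each time, and from k ≥ n on e_k is in 𝓘 n.
reducible-elem : ∀ n d k → n ℕ.≤ k ℕ.+ d → Reducible n (elem k)
reducible-elem n d k n≤k+d with parity-view k
... | is-zero = reducible-∼ (elem 0) (con 1ℚ) (≈⇒∼ (elem 0) (con 1ℚ) (S.sym elementary-zero)) (reducible-con n 1ℚ)
... | is-even j with n ℕ.≤? 2 ℕ.+ 2 ℕ.* j
...   | yes n≤k = reducible-filtered (elem (2 ℕ.+ 2 ℕ.* j)) (elementary-filtered (suc (2 ℕ.* j)) n≤k)
...   | no  n≰k = reducible-even n j (ℕ.≤-<-trans (ℕ.≤-trans (ℕ.m≤n*m j 2) (ℕ.m≤n+m (2 ℕ.* j) 2)) (ℕ.≰⇒> n≰k))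
reducible-elem n d k n≤k+d | is-odd k′ odd with n ℕ.≤? suc k′
...   | yes n≤k = reducible-filtered (elem (suc k′)) (elementary-filtered k′ n≤k)
reducible-elem n zero _ n≤k+d | is-odd k′ odd | no n≰k =
  ⊥-elim (n≰k (subst (n ℕ.≤_) (ℕ.+-identityʳ (suc k′)) n≤k+d))
reducible-elem zero (suc d) _ _ | is-odd k′ odd | no n≰k = ⊥-elim (n≰k z≤n)
reducible-elem (suc n) (suc d) _ n≤k+d | is-odd k′ odd | no n≰k =
  reducible-∼ (elem (suc k′)) (con ℚ.-½ ⊠ later) (odd-∼ n (suc k′) (ℕ.≰⇒> n≰k) odd)
    (reducible-⊠ (con ℚ.-½) later (reducible-con (suc n) ℚ.-½) (reducible-sum n summand λ i →
      reducible-⊠ (con (c i)) (elem (suc k′ ℕ.+ suc i)) (reducible-con (suc n) (c i))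
        (reducible-elem (suc n) d (suc k′ ℕ.+ suc i) (bound i))))
  where
  c : ℕ → ℚ
  c i = sign (suc (suc k′ ℕ.+ suc i)) * fromℕ ((suc k′ ℕ.+ suc i) C suc k′)
  summand : ℕ → Expr
  summand i = con (c i) ⊠ elem (suc k′ ℕ.+ suc i)
  later = sumExpr n summand
  bound : ∀ i → suc n ℕ.≤ (suc k′ ℕ.+ suc i) ℕ.+ d
  bound i = ℕ.≤-trans n≤k+d (ℕ.≤-trans (ℕ.+-monoʳ-≤ (suc k′) (s≤s (ℕ.m≤n+m d i)))
    (ℕ.≤-reflexive (sym (ℕ.+-assoc (suc k′) (suc i) d))))

reducible : ∀ n t → Reducible n t
reducible n (con c)  = reducible-con n c
reducible n (elem k) = reducible-elem n n k (ℕ.m≤n+m n k)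
reducible n (s ⊞ t)  = reducible-⊞ s t (reducible n s) (reducible n t)
reducible n (s ⊠ t)  = reducible-⊠ s t (reducible n s) (reducible n t)

-- Values at Bernoulli numbers

-- The `weight` of the conjecture with its index function as a parameter, because recursion on the
-- vector shifts that function.
weightBy : ∀ {m} → (ℕ → ℕ) → Vec ℕ m → ℕ
weightBy g []      = 0
weightBy g (a ∷ α) = g 0 ℕ.* a ℕ.+ weightBy (g ∘ suc) α

weight-weightBy : ∀ {m} g (α : Vec ℕ m) →
  ListAction.sum (toList (tabulate {n = m} λ i → g (toℕ i) ℕ.* lookup α i)) ≡ weightBy g α
weight-weightBy g []      = refl
weight-weightBy g (a ∷ α) = cong (g 0 ℕ.* a ℕ.+_) (weight-weightBy (g ∘ suc) α)

index′ : ℕ → ℕ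
index′ j = 2 ℕ.* j ℕ.+ 3

-- The p-adic leading term: x ≡ p^w b modulo p^{w+1}. Here b is p-integral but may be divisible by
-- p; integrality is what makes the relation multiplicative.
record Approx (p w : ℕ) (x b : ℚ) : Set where
  constructor approx
  field
    leading : b ∈ℤ₍ p ₎
    error   : Mod p (suc w) (x - fromℕ p ^ w * b)

module _ {p : ℕ} (p-prime : Prime p) where
  open Localization p-prime

  approx⇒mod : ∀ {w x b} → Approx p w x b → Mod p w x
  approx⇒mod {w} {x} {b} (approx b∈ err) = mod-resp
    (solve 2 (λ x y → (x :- y) :+ y := x) refl x (fromℕ p ^ w * b))
    (mod-+ (mod-≤ (ℕ.n≤1+n w) err) (mod b b∈ refl))
    where open ℚSolver.+-*-Solver using (solve; _:=_; _:+_; _:-_)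

  approx-one : Approx p 0 1ℚ 1ℚ
  approx-one = approx (integral-fromℕ 1) (mod-resp {x = 0ℚ} refl mod-zero)

  approx-* : ∀ {v w x y b c} → Approx p v x b → Approx p w y c → Approx p (v ℕ.+ w) (x * y) (b * c)
  approx-* {v} {w} {x} {y} {b} {c} X@(approx b∈ errˣ) Y@(approx c∈ errʸ) = approx (integral-* {b} {c} b∈ c∈)
    (mod-resp identity (mod-+ (mod-* errˣ (approx⇒mod Y))
      (subst (λ k → Mod p k (fromℕ p ^ v * b * (y - fromℕ p ^ w * c))) (ℕ.+-suc v w) (mod-* (mod b b∈ refl) errʸ))))
    where
    open ℚSolver.+-*-Solver using (solve; _:=_; _:+_; _:*_; _:-_)
    identity : (x - fromℕ p ^ v * b) * y + fromℕ p ^ v * b * (y - fromℕ p ^ w * c) ≡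
      x * y - fromℕ p ^ (v ℕ.+ w) * (b * c)
    identity = trans
      (solve 6 (λ x y b c q r → (x :- q :* b) :* y :+ q :* b :* (y :- r :* c) := x :* y :- (q :* r) :* (b :* c)) refl
        x y b c (fromℕ p ^ v) (fromℕ p ^ w))
      (cong (λ z → x * y - z * (b * c)) (sym (^-homo-* (fromℕ p) v w)))

  approx-^ : ∀ {w x b} a → Approx p w x b → Approx p (w ℕ.* a) (x ^ a) (b ^ a)
  approx-^ {w} zero X = subst (λ k → Approx p k 1ℚ 1ℚ) (sym (ℕ.*-zeroʳ w)) approx-one
  approx-^ {w} {x} {b} (suc a) X =
    subst (λ k → Approx p k (x ^ suc a) (b ^ suc a)) (sym (ℕ.*-suc w a)) (approx-* X (approx-^ a X))

  approx-monomial : ∀ {m} (g : ℕ → ℕ) (x b : ℕ → ℚ) → (∀ j → j ℕ.< m → Approx p (g j) (x j) (b j)) →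
    (α : Vec ℕ m) → Approx p (weightBy g α)
      (monomial (tabulate {n = m} (x ∘ toℕ)) α) (monomial (tabulate {n = m} (b ∘ toℕ)) α)
  approx-monomial g x b X []      = approx-one
  approx-monomial g x b X (a ∷ α) = approx-* (approx-^ a (X 0 (s≤s z≤n)))
    (approx-monomial (g ∘ suc) (x ∘ suc) (b ∘ suc) (λ j j<m → X (suc j) (s≤s j<m)) α)

  mod-unshift : ∀ w {x} → Mod p (suc w) (fromℕ p ^ w * x) → Mod p 1 x
  mod-unshift w {x} (mod r r∈ eq) = mod r r∈ (fromℕ-cancel (p ℕ.^ w)
    (λ p^w≡0 → ℕ.<⇒≢ (ℕ.m^n>0 p {{prime⇒nonZero p-prime}} w) (sym p^w≡0))
    (trans (cong (_* x) (fromℕ-^ p w)) (trans eq (trans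
      (solve 3 (λ a b c → (a :* b) :* c := b :* ((a :* con 1ℚ) :* c)) refl (fromℕ p) (fromℕ p ^ w) r)
      (cong (_* (fromℕ p ^ 1 * r)) (sym (fromℕ-^ p w)))))))
    where open ℚSolver.+-*-Solver using (solve; con; _:=_; _:*_)

sign-even : ∀ j → sign (2 ℕ.* j) ≡ 1ℚ
sign-even zero    = refl
sign-even (suc j) = trans (cong sign (ℕ.*-suc 2 j)) (trans
  (solve 1 (λ s → con (- 1ℚ) :* (con (- 1ℚ) :* s) := s) refl (sign (2 ℕ.* j))) (sign-even j))
  where open ℚSolver.+-*-Solver using (solve; con; _:=_; _:*_)

evenGenerator-approx : ∀ {p} → Prime p → ∀ j → index′ j ℕ.< p →
  Approx p (index′ j) (value (evenGenerator j) (harmonicPoint p)) (bernoulli (p ∸ index′ j))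
evenGenerator-approx {suc N} p-prime j j<p = subst₂
  (λ k b → Approx (suc N) k (value (evenGenerator j) (harmonicPoint (suc N))) (bernoulli b))
  index≡ B-index
  (approx (bernoulli-integral (suc r) (suc r) ℕ.≤-refl (s≤s r<N))
    (harmonic-bernoulli (1 ℕ.+ 2 ℕ.* j) r m+r≡N
      (trans (solve 1 (λ s → con (- 1ℚ) :* (con (- 1ℚ) :* s) := s) refl (sign (2 ℕ.* j))) (sign-even j))))
  where
  open ℚSolver.+-*-Solver using (solve; con; _:=_; _:*_)
  index≡ : 3 ℕ.+ 2 ℕ.* j ≡ index′ j
  index≡ = ℕ.+-comm 3 (2 ℕ.* j)
  j≤N : 3 ℕ.+ 2 ℕ.* j ℕ.≤ N
  j≤N = ℕ.≤-trans (ℕ.≤-reflexive index≡) (ℕ.≤-pred j<p)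
  open HarmonicPoint p-prime (s≤s (ℕ.≤-trans (s≤s (s≤s z≤n)) j≤N)) using (harmonic-bernoulli)
  open PowerSums p-prime using (bernoulli-integral)
  r = N ∸ (3 ℕ.+ 2 ℕ.* j)
  m+r≡N : (2 ℕ.+ 2 ℕ.* j) ℕ.+ suc r ≡ N
  m+r≡N = trans (ℕ.+-suc (2 ℕ.+ 2 ℕ.* j) r) (ℕ.m+[n∸m]≡n j≤N)
  r<N : suc r ℕ.< N
  r<N = subst (suc r ℕ.<_) m+r≡N (s≤s (ℕ.m≤n+m (suc r) (1 ℕ.+ 2 ℕ.* j)))
  B-index : suc r ≡ suc N ∸ index′ j
  B-index = trans (sym (trans (cong (_∸ (2 ℕ.+ 2 ℕ.* j)) (sym m+r≡N)) (ℕ.m+n∸m≡n (2 ℕ.+ 2 ℕ.* j) (suc r))))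
    (cong (suc N ∸_) index≡)

value-pow : ∀ {N} s a (xs : Vec ℚ N) → value (pow s a) xs ≡ value s xs ^ a
value-pow s zero    xs = refl
value-pow s (suc a) xs = cong (value s xs *_) (value-pow s a xs)

value-monomialExpr : ∀ {N m} u (α : Vec ℕ m) (xs : Vec ℚ N) →
  value (monomialExpr u α) xs ≡ monomial (tabulate {n = m} λ i → value (u (toℕ i)) xs) α
value-monomialExpr u []      xs = refl
value-monomialExpr u (a ∷ α) xs = cong₂ _*_ (value-pow (u 0) a xs) (value-monomialExpr (u ∘ suc) α xs)

value-termsExpr : ∀ {N m} u (L : Terms m) (xs : Vec ℚ N) →
  value (termsExpr u L) xs ≡ linear (monomial (tabulate λ i → value (u (toℕ i)) xs)) L
value-termsExpr u []            xs = refl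
value-termsExpr u ((c , α) ∷ L) xs = cong₂ (λ a b → c * a + b) (value-monomialExpr u α xs) (value-termsExpr u L xs)

-- Linear functionals and coefficients of lists of terms

linear-combine : ∀ {m} (F G : Vec ℕ m → ℚ) q L → linear (λ α → F α - q * G α) L ≡ linear F L - q * linear G L
linear-combine F G q [] = solve 1 (λ q → con 0ℚ := con 0ℚ :- q :* con 0ℚ) refl q
  where open ℚSolver.+-*-Solver using (solve; con; _:=_; _:*_; _:-_)
linear-combine F G q ((c , α) ∷ L) = trans (cong (c * (F α - q * G α) +_) (linear-combine F G q L))
  (solve 6 (λ c f q g x y → c :* (f :- q :* g) :+ (x :- q :* y) := (c :* f :+ x) :- q :* (c :* g :+ y)) refl
    c (F α) q (G α) (linear F L) (linear G L))
  where open ℚSolver.+-*-Solver using (solve; _:=_; _:+_; _:*_; _:-_)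

IntegralTerms : ∀ {m} → Terms m → ℕ → Set
IntegralTerms L p = All (λ t → proj₁ t ∈ℤ₍ p ₎) L

integralTerms : ∀ {m} (L : Terms m) → ForAllLargePrimes (IntegralTerms L)
integralTerms []            = 0 , λ _ _ _ → []
integralTerms ((c , α) ∷ L) = eventually-map₂ (λ _ → _∷_)
  (↧ₙ c , λ p large p-prime → Localization.∤-< p-prime {↧ₙ c} (s≤s z≤n) large) (integralTerms L)

mod-linear : ∀ {p m k} → Prime p → (F : Vec ℕ m → ℚ) (P : Vec ℕ m → Set) → (∀ α → P α → Mod p k (F α)) →
  ∀ {L} → IntegralTerms L p → All (P ∘ proj₂) L → Mod p k (linear F L)
mod-linear p-prime F P F≡0 []        []        = Localization.mod-zero p-prime
mod-linear p-prime F P F≡0 {(c , α) ∷ L} (c∈ ∷ L∈) (Pα ∷ PL) =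
  mod-+ (mod-scale c c∈ (F≡0 α Pα)) (mod-linear p-prime F P F≡0 L∈ PL)
  where open Localization p-prime

δ : ∀ {m} → Vec ℕ m → Vec ℕ m → ℚ
δ []      []      = 1ℚ
δ (a ∷ α) (c ∷ γ) = (if does (a ℕ.≟ c) then 1ℚ else 0ℚ) * δ α γ

δ-support : ∀ {m} (α γ : Vec ℕ m) → δ α γ ≢ 0ℚ → α ≡ γ
δ-support []      []      _    = refl
δ-support (a ∷ α) (c ∷ γ) δ≢0 with a ℕ.≟ c
... | yes refl = cong (a ∷_) (δ-support α γ λ δ≡0 → δ≢0
  (trans (cong (_* δ α γ) (cong (λ b → if b then 1ℚ else 0ℚ) (dec-true (a ℕ.≟ a) refl)))
    (trans (ℚ.*-identityˡ (δ α γ)) δ≡0)))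
... | no a≢c = ⊥-elim (δ≢0
  (trans (cong (_* δ α γ) (cong (λ b → if b then 1ℚ else 0ℚ) (dec-false (a ℕ.≟ c) a≢c))) (ℚ.*-zeroˡ (δ α γ))))

∑-box-δ : ∀ {m} d (α : Vec ℕ m) (F : Vec ℕ m → ℚ) → degree (toList α) ℕ.≤ d → ∑-box m d (λ γ → δ α γ * F γ) ≡ F α
∑-box-δ d []      F _ = ℚ.*-identityˡ (F [])
∑-box-δ {suc m} d (a ∷ α) F α≤d = begin
  Σ< (suc d) (λ i → ∑-box m d (λ γ → ι i * δ α γ * F (i ∷ γ)))
    ≡⟨ Σ-cong (suc d) (λ i → trans
         (∑-box-cong m d λ γ → ℚ.*-assoc (ι i) (δ α γ) (F (i ∷ γ)))
         (trans (∑-box-* m d (ι i) (λ γ → δ α γ * F (i ∷ γ)))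
           (cong (ι i *_) (∑-box-δ d α (F ∘ (i ∷_)) (ℕ.≤-trans (ℕ.m≤n+m (degree (toList α)) a) α≤d))))) ⟩
  Σ< (suc d) (λ i → ι i * F (i ∷ α))
    ≡⟨ Σ-single (suc d) a (s≤s (ℕ.≤-trans (ℕ.m≤m+n a (degree (toList α))) α≤d)) (λ i → ι i * F (i ∷ α)) (λ i i≢a → trans
         (cong (λ b → (if b then 1ℚ else 0ℚ) * F (i ∷ α)) (dec-false (a ℕ.≟ i) (i≢a ∘ sym))) (ℚ.*-zeroˡ (F (i ∷ α)))) ⟩
  ι a * F (a ∷ α)
    ≡⟨ trans (cong (λ b → (if b then 1ℚ else 0ℚ) * F (a ∷ α)) (dec-true (a ℕ.≟ a) refl)) (ℚ.*-identityˡ (F (a ∷ α))) ⟩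
  F (a ∷ α) ∎
  where
  open ≡-Reasoning
  ι : ℕ → ℚ
  ι i = if does (a ℕ.≟ i) then 1ℚ else 0ℚ

-- Exponents may repeat in a list, and a non-empty list may represent zero. Summing against `δ`
-- collects equal exponents into the coefficient function that `Polynomial` expects.
coefficient : ∀ {m} → Terms m → Vec ℕ m → ℚ
coefficient L γ = linear (λ α → δ α γ) L

coefficient-support : ∀ {m} (P : Vec ℕ m → Set) L γ → All (P ∘ proj₂) L → coefficient L γ ≢ 0ℚ → P γ
coefficient-support P []            γ []        c≢0 = ⊥-elim (c≢0 refl)
coefficient-support P ((c , α) ∷ L) γ (Pα ∷ PL) c≢0 with δ α γ ℚ.≟ 0ℚ
... | no  δ≢0 = subst P (δ-support α γ δ≢0) Pα
... | yes δ≡0 = coefficient-support P L γ PL λ L≡0 → c≢0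
  (trans (cong₂ (λ a b → c * a + b) δ≡0 L≡0) (trans (ℚ.+-identityʳ (c * 0ℚ)) (ℚ.*-zeroʳ c)))

Degree≤ : ∀ {m} → ℕ → ℚ × Vec ℕ m → Set
Degree≤ d (c , α) = degree (toList α) ℕ.≤ d

degree-bound : ∀ {m} (L : Terms m) → ∃[ d ] All (Degree≤ d) L
degree-bound []            = 0 , []
degree-bound ((c , α) ∷ L) with d , L≤d ← degree-bound L =
  degree (toList α) ℕ.⊔ d , ℕ.m≤m⊔n (degree (toList α)) d ∷ All.map (λ t≤d → ℕ.≤-trans t≤d (ℕ.m≤n⊔m (degree (toList α)) d)) L≤d

∑-box-coefficient : ∀ {m} d (L : Terms m) (F : Vec ℕ m → ℚ) → All (Degree≤ d) L →
  ∑-box m d (λ γ → coefficient L γ * F γ) ≡ linear F L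
∑-box-coefficient {m} d []            F []          = ∑-box-zero m d λ γ → ℚ.*-zeroˡ (F γ)
∑-box-coefficient {m} d ((c , α) ∷ L) F (α≤d ∷ L≤d) = begin
  ∑-box m d (λ γ → (c * δ α γ + coefficient L γ) * F γ)
    ≡⟨ ∑-box-cong m d (λ γ → solve 4 (λ c d l f → (c :* d :+ l) :* f := c :* (d :* f) :+ l :* f) refl
         c (δ α γ) (coefficient L γ) (F γ)) ⟩
  ∑-box m d (λ γ → c * (δ α γ * F γ) + coefficient L γ * F γ)
    ≡⟨ ∑-box-+ m d (λ γ → c * (δ α γ * F γ)) (λ γ → coefficient L γ * F γ) ⟩
  ∑-box m d (λ γ → c * (δ α γ * F γ)) + ∑-box m d (λ γ → coefficient L γ * F γ)
    ≡⟨ cong₂ _+_ (trans (∑-box-* m d c (λ γ → δ α γ * F γ)) (cong (c *_) (∑-box-δ d α F α≤d)))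
         (∑-box-coefficient d L F L≤d) ⟩
  c * F α + linear F L ∎
  where
  open ≡-Reasoning
  open ℚSolver.+-*-Solver using (solve; _:=_; _:+_; _:*_)

weight-index′ : ∀ {m} (α : Vec ℕ m) → weight α ≡ weightBy index′ α
weight-index′ = weight-weightBy index′

-- A non-zero coefficient would make `A` an admissible polynomial. The conjecture, asked for a prime
-- beyond the threshold `N`, then yields one that fails to divide the numerator. This refutes only
-- non-vanishing; decidable equality in ℚ turns the refutation into vanishing.
coefficient-vanish : BernoulliConjecture → ∀ m → .{{_ : NonZero m}} → ∀ w (A : Terms m) →
  All (λ t → weight (proj₂ t) ≡ w) A →
  ForAllLargePrimes (λ p → Mod p 1 (linear (monomial (bernoulliPoint m p)) A)) →
  ∀ γ → coefficient A γ ≡ 0ℚ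
coefficient-vanish conjecture m w A A≡w (N , divisible) γ =
  decidable-stable (coefficient A γ ℚ.≟ 0ℚ) λ c≢0 → contradictory λ c≡0 → c≢0 (c≡0 γ)
  where
  d = proj₁ (degree-bound A)
  A≤d = proj₂ (degree-bound A)

  h : Polynomial m
  h = record
    { coeff   = coefficient A
    ; bound   = d
    ; bounded = λ α d<α → decidable-stable (coefficient A α ℚ.≟ 0ℚ) λ c≢0 →
        ℕ.<⇒≱ d<α (coefficient-support (λ α → degree (toList α) ℕ.≤ d) A α A≤d c≢0) }

  contradictory : ¬ NonZeroPolynomial h
  contradictory nonzero with p , N<p , p-prime , p∤ ←
    conjecture m h nonzero (w , λ α → coefficient-support (λ α → weight α ≡ w) A α A≡w) N =
    p∤ (Localization.mod⇒∣↥ p-prime (Localization.mod-resp p-prime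
      (sym (∑-box-coefficient d A (monomial (bernoulliPoint m p)) A≤d)) (divisible p N<p p-prime)))

-- Carries what the conjecture says about Bernoulli values over to the other readings of the same
-- list, in particular to its symmetric function.
linear-vanish : ∀ {m} (A : Terms m) → (∀ γ → coefficient A γ ≡ 0ℚ) → ∀ F → linear F A ≡ 0ℚ
linear-vanish {m} A A≡0 F with d , A≤d ← degree-bound A = trans (sym (∑-box-coefficient d A F A≤d))
  (∑-box-zero m d λ γ → trans (cong (_* F γ) (A≡0 γ)) (ℚ.*-zeroˡ (F γ)))

-- Raising the lowest weight

record Split {m} (w : ℕ) (L : Terms m) : Set where
  field
    lowest higher : Terms m
    lowest-weight : All (λ t → weight (proj₂ t) ≡ w) lowest
    higher-weight : All (λ t → suc w ℕ.≤ weight (proj₂ t)) higher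
    linear-split  : ∀ F → linear F L ≡ linear F lowest + linear F higher

split : ∀ {m} w (L : Terms m) → All (λ t → w ℕ.≤ weight (proj₂ t)) L → Split w L
split w [] [] = record
  { lowest = [] ; higher = [] ; lowest-weight = [] ; higher-weight = [] ; linear-split = λ _ → refl }
split w ((c , α) ∷ L) (w≤α ∷ w≤L) with weight α ℕ.≟ w
... | yes α≡w = record
  { lowest = (c , α) ∷ lowest ; higher = higher
  ; lowest-weight = α≡w ∷ lowest-weight ; higher-weight = higher-weight
  ; linear-split = λ F → trans (cong (c * F α +_) (linear-split F))
      (sym (ℚ.+-assoc (c * F α) (linear F lowest) (linear F higher))) }
  where open Split (split w L w≤L)
... | no  α≢w = record
  { lowest = lowest ; higher = (c , α) ∷ higher
  ; lowest-weight = lowest-weight ; higher-weight = ℕ.≤∧≢⇒< w≤α (α≢w ∘ sym) ∷ higher-weight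
  ; linear-split = λ F → trans (cong (c * F α +_) (linear-split F))
      (solve 3 (λ x y z → x :+ (y :+ z) := y :+ (x :+ z)) refl (c * F α) (linear F lowest) (linear F higher)) }
  where
  open Split (split w L w≤L)
  open ℚSolver.+-*-Solver using (solve; _:=_; _:+_)

EvenVanishing : ∀ {m} → ℕ → Terms m → ℕ → Set
EvenVanishing n L p = Mod p n (value (evenExpr L) (harmonicPoint p))

-- Modulo p^{w+1} the whole value vanishes because w < n, and the terms of higher weight vanish by
-- their order. The lowest part, which is p^w times its value at the Bernoulli numbers, must vanish
-- too, and p^w can be divided out.
lowest-mod : ∀ {m n w} (L : Terms m) → w ℕ.< n → (s : Split w L) → ForAllLargePrimes (EvenVanishing n L) →
  ForAllLargePrimes (λ p → Mod p 1 (linear (monomial (bernoulliPoint m p)) (Split.lowest s)))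
lowest-mod {m} {n} {w} L w<n s vanishing = eventually-map
  (λ p-prime ((L≡0 , large) , (A∈ , B∈)) → conclude p-prime L≡0 large A∈ B∈)
  (eventually-map₂ (λ _ → _,_)
    -- Primes above 2m + 3 exceed all the indices 2j + 3 with j < m, so the approximation holds for
    -- every variable.
    (eventually-map₂ (λ _ → _,_) vanishing (index′ m , λ p large _ → large))
    (eventually-map₂ (λ _ → _,_) (integralTerms lowest) (integralTerms higher)))
  where
  open Split s
  conclude : ∀ {p} → Prime p → EvenVanishing n L p → index′ m ℕ.< p →
    IntegralTerms lowest p → IntegralTerms higher p → Mod p 1 (linear (monomial (bernoulliPoint m p)) lowest)
  conclude {p} p-prime L≡0 large A∈ B∈ = mod-unshift p-prime w (mod-resp
    (solve 2 (λ x y → x :- (x :- y) := y) refl (linear X lowest) (fromℕ p ^ w * linear B lowest))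
    (mod-- lowest≡0 (mod-resp (linear-combine X B (fromℕ p ^ w) lowest)
      (mod-linear p-prime (λ α → X α - fromℕ p ^ w * B α) (λ α → weight α ≡ w)
        (λ { α refl → Approx.error (approximation α) }) A∈ lowest-weight))))
    where
    open Localization p-prime
    open ℚSolver.+-*-Solver using (solve; _:=_; _:-_)
    X B : Vec ℕ m → ℚ
    X = monomial (tabulate λ i → value (evenGenerator (toℕ i)) (harmonicPoint p))
    B = monomial (bernoulliPoint m p)
    approximation : ∀ α → Approx p (weight α) (X α) (B α)
    approximation α = subst (λ k → Approx p k (X α) (B α)) (sym (weight-index′ α))
      (approx-monomial p-prime index′ (λ j → value (evenGenerator j) (harmonicPoint p)) (λ j → bernoulli (p ∸ index′ j))
        (λ j j<m → evenGenerator-approx p-prime j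
          (ℕ.≤-<-trans (ℕ.+-monoˡ-≤ 3 (ℕ.*-monoʳ-≤ 2 (ℕ.<⇒≤ j<m))) large)) α)
    higher≡0 : Mod p (suc w) (linear X higher)
    higher≡0 = mod-linear p-prime X (λ α → suc w ℕ.≤ weight α)
      (λ α w<α → mod-≤ w<α (approx⇒mod p-prime (approximation α))) B∈ higher-weight
    lowest≡0 : Mod p (suc w) (linear X lowest)
    lowest≡0 = mod-resp
      (trans (cong (_- linear X higher) (trans (value-termsExpr evenGenerator L (harmonicPoint p)) (linear-split X)))
        (solve 2 (λ a b → (a ℚSolver.+-*-Solver.:+ b) :- b := a) refl (linear X lowest) (linear X higher)))
      (mod-- (mod-≤ w<n L≡0) higher≡0)

-- Discarding the lowest part changes the list but not the polynomial, since every functional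
-- vanishes on that part. Repeating this `k` times brings the weight up to n, which is the H-degree
-- needed for 𝓘 n.
raise-weight : BernoulliConjecture → ∀ {m n} → .{{_ : NonZero m}} → ∀ k w → w ℕ.+ k ≡ n → (L : Terms m) →
  All (λ t → w ℕ.≤ weight (proj₂ t)) L → ForAllLargePrimes (EvenVanishing n L) →
  Σ (Terms m) λ K → All (λ t → n ℕ.≤ weight (proj₂ t)) K × (∀ F → linear F L ≡ linear F K)
raise-weight conjecture zero w w+k≡n L w≤L vanishing =
  L , subst (λ n → All (λ t → n ℕ.≤ weight (proj₂ t)) L) (trans (sym (ℕ.+-identityʳ w)) w+k≡n) w≤L , λ _ → refl
raise-weight conjecture {m} {n} (suc k) w w+k≡n L w≤L vanishing =
  proj₁ rest , proj₁ (proj₂ rest) , λ F → trans (L≡higher F) (proj₂ (proj₂ rest) F)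
  where
  s = split w L w≤L
  open Split s
  w<n : w ℕ.< n
  w<n = subst (w ℕ.<_) w+k≡n (subst (w ℕ.<_) (sym (ℕ.+-suc w k)) (s≤s (ℕ.m≤m+n w k)))
  L≡higher : ∀ F → linear F L ≡ linear F higher
  L≡higher F = trans (linear-split F) (trans
    (cong (_+ linear F higher) (linear-vanish lowest
      (coefficient-vanish conjecture m w lowest lowest-weight (lowest-mod L w<n s vanishing)) F))
    (ℚ.+-identityˡ (linear F higher)))
  rest = raise-weight conjecture k (suc w) (trans (sym (ℕ.+-suc w k)) w+k≡n) higher higher-weight
    (eventually-map (λ {p} p-prime → Localization.mod-resp p-prime (trans
      (value-termsExpr evenGenerator L (harmonicPoint p)) (trans (L≡higher _)
        (sym (value-termsExpr evenGenerator higher (harmonicPoint p)))))) vanishing)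

-- From weights back to the ideal

pow-homogeneous : ∀ {w s} a → Homogeneous w ⟦ s ⟧ → Homogeneous (w ℕ.* a) ⟦ pow s a ⟧
pow-homogeneous {w} zero    h = subst (λ k → Homogeneous k (constant 1ℚ)) (sym (ℕ.*-zeroʳ w)) (scalar 1ℚ)
pow-homogeneous {w} {s} (suc a) h =
  subst (λ k → Homogeneous k ⟦ pow s (suc a) ⟧) (sym (ℕ.*-suc w a)) (mul h (pow-homogeneous a h))

monomialExpr-homogeneous : ∀ {m} g u → (∀ j → Homogeneous (g j) ⟦ u j ⟧) → (α : Vec ℕ m) →
  Homogeneous (weightBy g α) ⟦ monomialExpr u α ⟧
monomialExpr-homogeneous g u h []      = scalar 1ℚ
monomialExpr-homogeneous g u h (a ∷ α) =
  mul (pow-homogeneous {s = u 0} a (h 0)) (monomialExpr-homogeneous (g ∘ suc) (u ∘ suc) (h ∘ suc) α)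

evenGenerator-homogeneous : ∀ j → Homogeneous (index′ j) ⟦ evenGenerator j ⟧
evenGenerator-homogeneous j = subst (λ k → Homogeneous k ⟦ evenGenerator j ⟧)
  (trans (ℕ.+-comm (2 ℕ.+ 2 ℕ.* j) 1) (ℕ.+-comm 3 (2 ℕ.* j))) (mul (scalar (- fromℕ (3 ℕ.+ 2 ℕ.* j))) (gen (1 ℕ.+ 2 ℕ.* j)))

terms-filtered : ∀ {m n} (L : Terms m) → All (λ t → n ℕ.≤ weight (proj₂ t)) L → Filtered n ⟦ evenExpr L ⟧
terms-filtered []            []          = resp (λ γ → sym (termsExpr-linear {0} evenGenerator [] γ)) filtered-zero
terms-filtered ((c , α) ∷ L) (n≤α ∷ n≤L) = add
  (above (ℕ.≤-trans n≤α (ℕ.≤-reflexive (weight-index′ α)))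
    (mul (scalar c) (monomialExpr-homogeneous index′ evenGenerator evenGenerator-homogeneous α)))
  (terms-filtered L n≤L)

-- The difference of `f` and `evenExpr L` lies in the ideal, so by the easy direction it vanishes
-- modulo p^n. Hence `L` inherits the congruence from `f`, and once its weight is raised to n it
-- lies in 𝓘 n.
reducible⇒I : BernoulliConjecture → ∀ f n → .{{_ : NonZero n}} → ∀ t (L : Terms n) →
  Λ.series f ≈ ⟦ t ⟧ → t ∼[ n ] evenExpr L →
  ForAllLargePrimes (λ p → f ⟨ harmonicPoint p ⟩ ≡0[mod p ^ n ]) → f ∈I[ n ]
reducible⇒I conjecture f n t L f≈t t∼L vanishing = ideal⇒I f (resp f≡ (add t∼L (filtered L-filtered)))
  where
  open ℚSolver.+-*-Solver using (solve; _:=_; _:+_; _:-_)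

  value-L : ForAllLargePrimes (EvenVanishing n L)
  value-L = eventually-map₂ difference vanishing (eventually-ideal t∼L)
    where
    difference : ∀ {p} → Prime p → f ⟨ harmonicPoint p ⟩ ≡0[mod p ^ n ] →
      ValueMod n (⟦ t ⟧ ⊖ ⟦ evenExpr L ⟧) p → EvenVanishing n L p
    difference {p} p-prime f≡0 (valueMod {q} ev q≡0) = mod-resp
      (sym (trans (solve 2 (λ l q → l := (q :+ l) :- q) refl (value (evenExpr L) xs) q) (cong (_- q) sum≡f)))
      (mod-- (toMod f≡0) q≡0)
      where
      open Localization p-prime
      xs = harmonicPoint p
      sum≡f : q + value (evenExpr L) xs ≡ f ⟨ xs ⟩
      sum≡f = evaluates-unique
        (evaluates-resp (λ α → trans (solve 2 (λ x y → (x :- y) :+ y := x) refl (⟦ t ⟧ α) (⟦ evenExpr L ⟧ α)) (sym (f≈t α)))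
          (evaluates-⊕ ev (⟦⟧-evaluates xs (evenExpr L))))
        (Λ-evaluates f xs)

  raised = raise-weight conjecture n 0 refl L (All.universal (λ _ → z≤n) L) value-L
  K = proj₁ raised

  L-filtered : Filtered n ⟦ evenExpr L ⟧
  L-filtered = resp
    (λ γ → trans (termsExpr-linear evenGenerator K γ) (trans (sym (proj₂ (proj₂ raised) _)) (sym (termsExpr-linear evenGenerator L γ))))
    (terms-filtered K (proj₁ (proj₂ raised)))

  f≡ : (⟦ t ⟧ ⊖ ⟦ evenExpr L ⟧) ⊕ ⟦ evenExpr L ⟧ ≈ Λ.series f
  f≡ α = trans (solve 2 (λ x y → (x :- y) :+ y := x) refl (⟦ t ⟧ α) (⟦ evenExpr L ⟧ α)) (sym (f≈t α))

necessary : BernoulliConjecture → ∀ f n → .{{_ : NonZero n}} →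
  ForAllLargePrimes (λ p → f ⟨ harmonicPoint p ⟩ ≡0[mod p ^ n ]) → f ∈I[ n ]
necessary conjecture f n = reducible⇒I conjecture f n t (proj₁ (reducible n t)) (proj₂ (fundamental f)) (proj₂ (reducible n t))
  where t = proj₁ (fundamental f)

theorem5p1 : BernoulliConjecture → (f : Λ) (n : ℕ) → .{{_ : NonZero n}} →
    ForAllLargePrimes (λ p → f ⟨ harmonicPoint p ⟩ ≡0[mod p ^ n ]) ⇔ f ∈I[ n ]
theorem5p1 conjecture f n = mk⇔ (necessary conjecture f n) (sufficient f n)
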